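{- Let $k\ge 4$ and let $(b_1,\dots,b_{k-3})\in\{0,1\}^{k-3}$ have exactly one entry equal to $1$. Then $\mathcal{H}(b_1,\dots,b_{k-3},2) = \mathcal{G}_1(b_1,\dots,b_{k-3})$.
   Context: A connected dominating set of $G$ is a set $D$ such that every vertex is in $D$ or adjacent to a vertex of $D$ and $G[D]$ is connected; $\gamma_c(G)$ is its minimum size, and a minimum one is a $\gamma_c$-set. $G$ is $k$-$\gamma_c$-critical if $\gamma_c(G)=k$ and $\gamma_c(G+uv)<k$ for all non-adjacent $u,v$. $\mathcal{Z}(k,\zeta)$ is the class of $k$-$\gamma_c$-critical graphs with exactly $\zeta$ cut vertices. For $k\ge4$, every $G\in\mathcal{Z}(k,k-3)$ is known to have exactly two end blocks (blocks containing exactly one cut vertex), all other blocks containing exactly two cut vertices; so its blocks and cut vertices can be labeled $B_1,\dots,B_{k-2}$ and $c_1,\dots,c_{k-3}$ with $c_1\in V(B_1)$, $c_{k-3}\in V(B_{k-2})$, $c_{i-1},c_i\in V(B_i)$ for $2\le i\le k-3$. Let $C_i=V(B_i)$ minus the cut vertices of $G$. $\mathcal{H}(b_1,\dots,b_{k-2})$ is the class of $G\in\mathcal{Z}(k,k-3)$ admitting such a labeling and a $\gamma_c$-set $D$ with $|C_i\cap D|=b_i$ for all $1\le i\le k-2$. Class $\mathcal{B}_{2,2}$: take $l\ge 2$, $m_1,\dots,m_l\ge 1$, $r\ge 0$; let $T$ be the disjoint union of stars $K_{1,m_i}$ and $r$ isolated vertices; let $S$ be the set of all star leaves. A graph in $\mathcal{B}_{2,2}$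 is the complement $\overline T$ together with a new vertex $c$ (the head) adjacent exactly to the vertices of $S$. Class $\mathcal{G}_1(i_1,\dots,i_{k-3})$, where $i_l=1$ and the other entries are $0$: take the path $c_0c_1\cdots c_{k-3}$ with the edge $c_{l-1}c_l$ deleted; add a complete graph $K_{n_l}$ ($n_l\ge2$) each of whose vertices is adjacent to $c_{l-1}$ and $c_l$; attach a graph $B\in\mathcal{B}_{2,2}$ whose head is $c_{k-3}$ (no other edges). -}

module Defs where

open import Data.Nat using (ℕ; zero; suc; _∸_; _≤_; _<_; _<?_)
open import Data.Fin using (Fin; toℕ; fromℕ<; _≟_)
open import Data.Fin.Subset using (Subset; _∈_; _⊆_; ∣_∣)
open import Data.Bool using (Bool; true; false; _∨_; _∧_)
open import Data.Product using (Σ; _×_; _,_)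
open import Data.Sum using (_⊎_)
open import Data.Unit using (⊤)
open import Data.Empty using (⊥)
open import Relation.Nullary using (¬_; yes; no)
open import Relation.Nullary.Decidable using (⌊_⌋)
open import Relation.Binary.PropositionalEquality using (_≡_; _≢_)
open import Function.Definitions using (Injective)
open import Function.Bundles using (_↔_; Inverse)

RawAdj : ℕ → Set
RawAdj n = Fin n → Fin n → Bool

record Graph (n : ℕ) : Set where
  field
    adj   : RawAdj n
    sym   : ∀ u v → adj u v ≡ adj v u
    irrefl : ∀ u → adj u u ≡ false
open Graph public

addEdge : ∀ {n} → RawAdj n → Fin n → Fin n → RawAdj n
addEdge A u v x y =
  A x y ∨ ((⌊ x ≟ u ⌋ ∧ ⌊ y ≟ v ⌋) ∨ (⌊ x ≟ v ⌋ ∧ ⌊ y ≟ u ⌋))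

data Reach {n} (A : RawAdj n) (P : Fin n → Set) : Fin n → Fin n → Set where
  here : ∀ {u} → P u → Reach A P u u
  step : ∀ {u w v} → P u → A u w ≡ true → Reach A P w v → Reach A P u v

ConnectedOn : ∀ {n} → RawAdj n → (Fin n → Set) → Set
ConnectedOn {n} A P = ∀ (u v : Fin n) → P u → P v → Reach A P u v

Dominating : ∀ {n} → RawAdj n → Subset n → Set
Dominating {n} A D = ∀ (v : Fin n) → v ∈ D ⊎ Σ (Fin n) (λ u → u ∈ D × A v u ≡ true)

IsCDS : ∀ {n} → RawAdj n → Subset n → Set
IsCDS A D = Dominating A D × ConnectedOn A (λ x → x ∈ D)

GammaC : ∀ {n} → RawAdj n → ℕ → Set
GammaC {n} A k =
  Σ (Subset n) (λ D → IsCDS A D × ∣ D ∣ ≡ k) × (∀ (D : Subset n) → IsCDS A D → k ≤ ∣ D ∣)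

IsGammaCSet : ∀ {n} → RawAdj n → Subset n → Set
IsGammaCSet A D = IsCDS A D × GammaC A ∣ D ∣

Critical : ∀ {n} → Graph n → ℕ → Set
Critical {n} G k =
  GammaC (adj G) k ×
  (∀ (u v : Fin n) → u ≢ v → adj G u v ≡ false →
     Σ (Subset n) (λ D → IsCDS (addEdge (adj G) u v) D × ∣ D ∣ < k))

Everything : ∀ {n} → Fin n → Set
Everything _ = ⊤

IsCut : ∀ {n} → RawAdj n → Fin n → Set
IsCut {n} A c = Σ (Fin n) λ u → Σ (Fin n) λ w →
  u ≢ c × w ≢ c × Reach A Everything u w × ¬ Reach A (λ x → x ≢ c) u w

HasCard : ∀ {n} → (Fin n → Set) → ℕ → Set
HasCard {n} P m = Σ (Fin m → Fin n) λ f →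
  Injective _≡_ _≡_ f × (∀ i → P (f i)) × (∀ v → P v → Σ (Fin m) λ i → f i ≡ v)

Nonsep : ∀ {n} → RawAdj n → Subset n → Set
Nonsep {n} A B =
  Σ (Fin n) (λ v → v ∈ B) × ConnectedOn A (λ x → x ∈ B) ×
  (∀ (c : Fin n) → c ∈ B → ConnectedOn A (λ x → x ∈ B × x ≢ c))

IsBlock : ∀ {n} → RawAdj n → Subset n → Set
IsBlock {n} A B = Nonsep A B × (∀ (B' : Subset n) → Nonsep A B' → B ⊆ B' → B' ≡ B)

InZ : ∀ {n} → ℕ → ℕ → Graph n → Set
InZ k ζ G = Critical G k × HasCard (IsCut (adj G)) ζ

-- the labeling B_1..B_{k-2}, c_1..c_{k-3} (0-based indices)
record Labeling {n} (k : ℕ) (A : RawAdj n) : Set where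
  field
    Bl      : Fin (k ∸ 2) → Subset n
    cv      : Fin (k ∸ 3) → Fin n
    Bl-inj  : Injective _≡_ _≡_ Bl
    Bl-blk  : ∀ t → IsBlock A (Bl t)
    Bl-all  : ∀ B → IsBlock A B → Σ (Fin (k ∸ 2)) λ t → Bl t ≡ B
    cv-inj  : Injective _≡_ _≡_ cv
    cv-cut  : ∀ s → IsCut A (cv s)
    cv-all  : ∀ c → IsCut A c → Σ (Fin (k ∸ 3)) λ s → cv s ≡ c
    -- block t contains cut vertices t-1 and t (whenever they exist):
    -- c_1 ∈ B_1, c_{k-3} ∈ B_{k-2}, c_{i-1},c_i ∈ B_i
    incid   : ∀ (t : Fin (k ∸ 2)) (s : Fin (k ∸ 3)) →
                (toℕ s ≡ toℕ t ⊎ suc (toℕ s) ≡ toℕ t) → cv s ∈ Bl t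

InH : ∀ {n} (k : ℕ) → (Fin (k ∸ 2) → ℕ) → Graph n → Set
InH {n} k bs G =
  InZ k (k ∸ 3) G ×
  Σ (Labeling k (adj G)) λ L → Σ (Subset n) λ D →
    IsGammaCSet (adj G) D ×
    (∀ t → HasCard (λ v → v ∈ Labeling.Bl L t × ¬ IsCut (adj G) v × v ∈ D) (bs t))

extB : (k : ℕ) → (Fin (k ∸ 3) → ℕ) → Fin (k ∸ 2) → ℕ
extB k b i with toℕ i <? k ∸ 3
... | yes p = b (fromℕ< p)
... | no _ = 2

-- The construction 𝒢₁: vertex type and adjacency.
-- path vertices c_0..c_{k-3} (pv), clique K_{nl} (kv), stars with
-- centres (ctr i) and leaves (lf i t), isolated vertices of T (iso).

data G1V (k nl s : ℕ) (m : Fin s → ℕ) (r : ℕ) : Set where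
  pv  : Fin (k ∸ 2) → G1V k nl s m r
  kv  : Fin nl → G1V k nl s m r
  ctr : Fin s → G1V k nl s m r
  lf  : (i : Fin s) → Fin (m i) → G1V k nl s m r
  iso : Fin r → G1V k nl s m r

module _ {k nl s : ℕ} {m : Fin s → ℕ} {r : ℕ} where

  inT : G1V k nl s m r → Set
  inT (ctr _)  = ⊤
  inT (lf _ _) = ⊤
  inT (iso _)  = ⊤
  inT _        = ⊥

  TEdge : G1V k nl s m r → G1V k nl s m r → Set
  TEdge (ctr i) (lf i' _) = i ≡ i'
  TEdge (lf i _) (ctr i') = i ≡ i'
  TEdge _ _ = ⊥

  -- remaining edges (one orientation); l = j+1 in 1-based indexing
  R : Fin (k ∸ 3) → G1V k nl s m r → G1V k nl s m r → Set
  R j (pv a) (pv b) = suc (toℕ a) ≡ toℕ b × toℕ a ≢ toℕ j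
  R j (kv x) (kv y) = x ≢ y
  R j (kv x) (pv a) = toℕ a ≡ toℕ j ⊎ toℕ a ≡ suc (toℕ j)
  R j (pv a) (lf _ _) = toℕ a ≡ k ∸ 3
  R j _ _ = ⊥

  G1Adj : Fin (k ∸ 3) → G1V k nl s m r → G1V k nl s m r → Set
  G1Adj j x y = (inT x × inT y × x ≢ y × ¬ TEdge x y) ⊎ R j x y ⊎ R j y x

-- G ∈ 𝒢₁(i_1,…,i_{k-3}) with i_{j+1} = 1 (j 0-based), up to isomorphism
InG1 : ∀ {n} (k : ℕ) → Fin (k ∸ 3) → Graph n → Set
InG1 {n} k j G =
  Σ ℕ λ nl → 2 ≤ nl × Σ ℕ λ s → 2 ≤ s × Σ (Fin s → ℕ) λ m → (∀ i → 1 ≤ m i) ×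
  Σ ℕ λ r → Σ (Fin n ↔ G1V k nl s m r) λ φ →
    ∀ u v → (adj G u v ≡ true → G1Adj j (Inverse.to φ u) (Inverse.to φ v)) ×
            (G1Adj j (Inverse.to φ u) (Inverse.to φ v) → adj G u v ≡ true)

{-# OPTIONS --safe #-}

-- A connected dominating set of a graph whose blocks form a chain contains all cut vertices, and being such a set can
-- be tested block by block. So the parts of a γ_c-set D and of a smaller set for G + uv inside a block can be
-- exchanged, and a missing edge uv inside a block forces a local gain there. If D has no other vertex than cut
-- vertices in a block, the block is therefore complete, and then it is an edge: a vertex x with N[x] ⊆ N[c] for a cut
-- vertex c makes every edge from x across c useless. If D has one more vertex there, only one pair of the block is
-- non-adjacent. If D has two more vertices in the last block, then of two non-adjacent vertices one is a neighbour of
-- the head and sees all non-neighbours of the head but the other one, so the complement is a union of stars.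
-- Two degenerate shapes remain, a middle block with adjacent cut vertices and a single star. There, joining the far
-- end of the path to a suitable vertex closes the layers up to a cycle; a connected dominating set misses at most two
-- layers of a cycle, so nothing is gained. Conversely, in a graph of the class every connected dominating set meets
-- all inner layers and has two vertices in the last block, while after adding any edge one of these can be spared.

module Submission where

open import Defs renaming (sym to adj-sym; irrefl to adj-irrefl)
open import Data.Nat using () renaming (_≟_ to _≟ℕ_)
open import Data.Nat using (ℕ; zero; suc; _∸_; _+_; _≤_; _<_; z≤n; s≤s; s≤s⁻¹; _≤?_; _<?_)
open import Data.Nat.Properties hiding (_≟_; suc-injective)
open import Data.Fin using (Fin; zero; suc; toℕ; fromℕ<; _≟_)
open import Data.Fin.Properties using (any?; all?; injective⇒≤; toℕ-injective; toℕ-fromℕ<; fromℕ<-toℕ; toℕ<n; suc-injective)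
open import Data.Fin.Subset using (Subset; inside; outside; _∈_; _∉_; _⊆_; ∣_∣; _∩_; _∪_; _─_; ⁅_⁆)
open import Data.Fin.Subset.Properties
open import Data.Vec using (_∷_; []; tabulate; _[_]=_)
open _[_]=_
open import Data.Vec.Properties using (lookup⇒[]=; []=⇒lookup; lookup∘tabulate; ≡-dec)
open import Data.List using (List; []; _∷_; length; _++_)
open import Data.List.Properties using (length-++)
open import Data.List.Membership.Propositional.Properties using (∈-++⁺ˡ; ∈-++⁺ʳ; ∈-++⁻)
import Data.List.Relation.Unary.Any as Any
open import Data.List.Membership.Propositional using () renaming (_∈_ to _∈ˡ_)
import Data.List.Membership.DecPropositional as DecMem
open import Data.Bool using (Bool; true; false; _∨_; _∧_)
import Data.Bool.Properties as Bool
open import Data.Product using (Σ; ∃; _×_; _,_; proj₁; proj₂)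
open import Data.Sum using (_⊎_; inj₁; inj₂; [_,_]′)
open import Data.Unit using (tt)
open import Data.Empty using (⊥; ⊥-elim)
open import Relation.Nullary using (Dec; yes; no; ¬_; does)
open import Relation.Nullary.Decidable using (dec-true; ¬?; _×-dec_; _⊎-dec_; _→-dec_; decidable-stable; ⌊_⌋; isYes≗does)
open import Relation.Binary.Definitions using (Tri; tri<; tri≈; tri>)
open import Relation.Binary.PropositionalEquality using (_≡_; _≢_; refl; sym; trans; cong; cong₂; subst; subst₂; module ≡-Reasoning)
open import Function using (_∘_; id)
open import Function.Definitions using (Injective)
open import Function.Bundles using (Inverse; mk↔ₛ′)

-- Inside a block everything is local: a new edge within block `t` leaves the other blocks alone, so
-- sets for G and for G + uv can be cut at the cut vertices and recombined. The two degenerate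
-- shapes, however, are consistent with all these local conditions. It takes an edge between
-- different blocks to exclude them, and then an initial run of blocks, or the whole graph, has to
-- be compared at once. The counts are tight there: a single star gives k + 2 layers once the cycle
-- is closed, and missing two of them still costs k vertices; the run up to a middle block `j` gives
-- j + 3 layers against the j + 1 vertices that D spends on it. Both classes are compared with a
-- common description, `Layered`, with N = k - 2: equal or consecutive layers among 0..N are
-- completely joined, and layer N + 1 is the complement of a star forest. The value k = N + 2 is one
-- vertex for each of the layers 1..N and two for the last one. The clique has the layer q = j + 1
-- to itself, which puts the ends of the deleted path edge two layers apart and shifts all later
-- layers by one against the indices of the blocks.

false≢true : ∀ {b} → b ≡ true → b ≡ false → ⊥
false≢true refl ()

-- Subsets

opaque

  subset : ∀ {n} {P : Fin n → Set} → (∀ v → Dec (P v)) → Subset n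
  subset P? = tabulate (λ v → does (P? v))

  ∈-subset⁺ : ∀ {n} {P : Fin n → Set} (P? : ∀ v → Dec (P v)) {v} → P v → v ∈ subset P?
  ∈-subset⁺ P? {v} p =
    lookup⇒[]= v _ (trans (lookup∘tabulate (λ v → does (P? v)) v) (dec-true (P? v) p))

  ∈-subset⁻ : ∀ {n} {P : Fin n → Set} (P? : ∀ v → Dec (P v)) {v} → v ∈ subset P? → P v
  ∈-subset⁻ P? {v} v∈ with P? v | trans (sym (lookup∘tabulate (λ v → does (P? v)) v)) ([]=⇒lookup v∈)
  ... | yes p | _ = p
  ... | no _  | ()

elem : ∀ {n} (p : Subset n) → Fin ∣ p ∣ → Fin n
elem (inside  ∷ p) zero    = zero
elem (inside  ∷ p) (suc i) = suc (elem p i)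
elem (outside ∷ p) i       = suc (elem p i)

elem∈ : ∀ {n} (p : Subset n) i → elem p i ∈ p
elem∈ (inside  ∷ p) zero    = here
elem∈ (inside  ∷ p) (suc i) = there (elem∈ p i)
elem∈ (outside ∷ p) i       = there (elem∈ p i)

index : ∀ {n} {p : Subset n} {x} → x ∈ p → Fin ∣ p ∣
index {p = inside  ∷ p} here       = zero
index {p = inside  ∷ p} (there x∈) = suc (index x∈)
index {p = outside ∷ p} (there x∈) = index x∈

elem-index : ∀ {n} {p : Subset n} {x} (x∈ : x ∈ p) → elem p (index x∈) ≡ x
elem-index {p = inside  ∷ p} here       = refl
elem-index {p = inside  ∷ p} (there x∈) = cong suc (elem-index x∈)
elem-index {p = outside ∷ p} (there x∈) = cong suc (elem-index x∈)

elem-injective : ∀ {n} (p : Subset n) → Injective _≡_ _≡_ (elem p)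
elem-injective (inside  ∷ p) {zero}  {zero}  _  = refl
elem-injective (inside  ∷ p) {suc i} {suc j} eq = cong suc (elem-injective p (suc-injective eq))
elem-injective (outside ∷ p) eq = elem-injective p (suc-injective eq)

index-injective : ∀ {n} {p : Subset n} {x y} (x∈ : x ∈ p) (y∈ : y ∈ p) → index x∈ ≡ index y∈ → x ≡ y
index-injective {p = p} x∈ y∈ eq =
  trans (sym (elem-index x∈)) (trans (cong (elem p) eq) (elem-index y∈))

injection⇒≤∣∣ : ∀ {m n} (p : Subset n) (f : Fin m → Fin n) → Injective _≡_ _≡_ f →
                (∀ i → f i ∈ p) → m ≤ ∣ p ∣
injection⇒≤∣∣ p f f-inj f∈ =
  injective⇒≤ {f = λ i → index (f∈ i)} (λ eq → f-inj (index-injective (f∈ _) (f∈ _) eq))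

injection⇒∣∣≤ : ∀ {m n} (p : Subset n) (f : ∀ x → x ∈ p → Fin m) →
                (∀ x y x∈ y∈ → f x x∈ ≡ f y y∈ → x ≡ y) → ∣ p ∣ ≤ m
injection⇒∣∣≤ p f f-inj =
  injective⇒≤ {f = λ i → f (elem p i) (elem∈ p i)} (λ eq → elem-injective p (f-inj _ _ _ _ eq))

hits⇒≤∣∣ : ∀ {m n} (p : Subset n) (g : Fin n → ℕ) →
           (∀ i → i < m → ∃ λ d → d ∈ p × g d ≡ i) → m ≤ ∣ p ∣
hits⇒≤∣∣ {m} {n} p g hit = injection⇒≤∣∣ p f f-inj (λ i → proj₁ (proj₂ (hit (toℕ i) (toℕ<n i))))
  where
  f : Fin m → Fin n
  f i = proj₁ (hit (toℕ i) (toℕ<n i))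
  g∘f : ∀ i → g (f i) ≡ toℕ i
  g∘f i = proj₂ (proj₂ (hit (toℕ i) (toℕ<n i)))
  f-inj : Injective _≡_ _≡_ f
  f-inj {a} {b} eq = toℕ-injective (trans (sym (g∘f a)) (trans (cong g eq) (g∘f b)))

labels⇒∣∣≤ : ∀ {m n} (p : Subset n) (h : Fin n → ℕ) → (∀ {x} → x ∈ p → h x < m) →
             (∀ {x y} → x ∈ p → y ∈ p → h x ≡ h y → x ≡ y) → ∣ p ∣ ≤ m
labels⇒∣∣≤ p h bound h-inj = injection⇒∣∣≤ p (λ x x∈ → fromℕ< (bound x∈)) λ x y x∈ y∈ eq →
  h-inj x∈ y∈ (trans (sym (toℕ-fromℕ< (bound x∈))) (trans (cong toℕ eq) (toℕ-fromℕ< (bound y∈))))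

cover⇒∣∣≤ : ∀ {n} (p : Subset n) (xs : List (Fin n)) → (∀ {x} → x ∈ p → x ∈ˡ xs) → ∣ p ∣ ≤ length xs
cover⇒∣∣≤ p xs p⊆xs = injection⇒∣∣≤ p (λ x x∈ → Any.index (p⊆xs x∈)) inj
  where
  open import Data.List.Relation.Unary.Any.Properties using (lookup-index)
  open import Data.List using (lookup)
  inj : ∀ x y x∈ y∈ → Any.index (p⊆xs {x} x∈) ≡ Any.index (p⊆xs {y} y∈) → x ≡ y
  inj x y x∈ y∈ eq = trans (lookup-index (p⊆xs x∈))
    (trans (cong (lookup xs) eq) (sym (lookup-index (p⊆xs y∈))))

fromList : ∀ {n} → List (Fin n) → Subset n
fromList xs = subset (λ v → v ∈ˡ? xs)
  where open DecMem _≟_ renaming (_∈?_ to _∈ˡ?_)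

∈-fromList⁺ : ∀ {n} {xs : List (Fin n)} {v} → v ∈ˡ xs → v ∈ fromList xs
∈-fromList⁺ {xs = xs} = ∈-subset⁺ (λ v → DecMem._∈?_ _≟_ v xs)

∈-fromList⁻ : ∀ {n} {xs : List (Fin n)} {v} → v ∈ fromList xs → v ∈ˡ xs
∈-fromList⁻ {xs = xs} = ∈-subset⁻ (λ v → DecMem._∈?_ _≟_ v xs)

∣fromList∣≤ : ∀ {n} (xs : List (Fin n)) → ∣ fromList xs ∣ ≤ length xs
∣fromList∣≤ xs = cover⇒∣∣≤ (fromList xs) xs ∈-fromList⁻

∣p∣≡∣p∩q∣+∣p─q∣ : ∀ {n} (p q : Subset n) → ∣ p ∣ ≡ ∣ p ∩ q ∣ + ∣ p ─ q ∣
∣p∣≡∣p∩q∣+∣p─q∣ [] [] = refl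
∣p∣≡∣p∩q∣+∣p─q∣ (inside  ∷ p) (inside  ∷ q) = cong suc (∣p∣≡∣p∩q∣+∣p─q∣ p q)
∣p∣≡∣p∩q∣+∣p─q∣ (inside  ∷ p) (outside ∷ q) =
  trans (cong suc (∣p∣≡∣p∩q∣+∣p─q∣ p q)) (sym (+-suc _ _))
∣p∣≡∣p∩q∣+∣p─q∣ (outside ∷ p) (inside  ∷ q) = ∣p∣≡∣p∩q∣+∣p─q∣ p q
∣p∣≡∣p∩q∣+∣p─q∣ (outside ∷ p) (outside ∷ q) = ∣p∣≡∣p∩q∣+∣p─q∣ p q

∈-─⁻ : ∀ {n} (p q : Subset n) {x} → x ∈ p ─ q → x ∈ p × x ∉ q
∈-─⁻ (inside  ∷ p) (outside ∷ q) {zero} here = here , λ ()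
∈-─⁻ (inside  ∷ p) (inside  ∷ q) {zero} ()
∈-─⁻ (outside ∷ p) (outside ∷ q) {zero} ()
∈-─⁻ (outside ∷ p) (inside  ∷ q) {zero} ()
∈-─⁻ (_ ∷ p) (_ ∷ q) (there x∈) with ∈-─⁻ p q x∈
... | a , b = there a , λ { (there c) → b c }

-- r is made of p on X and of q off X; no subtraction, so that nothing gets truncated.
exchange-card : ∀ {n} (p q r X : Subset n) →
  (∀ {v} → v ∈ r → v ∈ X → v ∈ p) → (∀ {v} → v ∈ r → v ∉ X → v ∈ q) →
  ∣ r ∣ + ∣ q ∩ X ∣ ≤ ∣ q ∣ + ∣ p ∩ X ∣
exchange-card p q r X on off = begin
    ∣ r ∣ + ∣ q ∩ X ∣                     ≡⟨ cong (_+ ∣ q ∩ X ∣) (∣p∣≡∣p∩q∣+∣p─q∣ r X) ⟩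
    (∣ r ∩ X ∣ + ∣ r ─ X ∣) + ∣ q ∩ X ∣   ≤⟨ +-monoˡ-≤ _ (+-mono-≤ (p⊆q⇒∣p∣≤∣q∣ r∩X⊆) (p⊆q⇒∣p∣≤∣q∣ r─X⊆)) ⟩
    (∣ p ∩ X ∣ + ∣ q ─ X ∣) + ∣ q ∩ X ∣   ≡⟨ +-assoc ∣ p ∩ X ∣ _ _ ⟩
    ∣ p ∩ X ∣ + (∣ q ─ X ∣ + ∣ q ∩ X ∣)   ≡⟨ +-comm ∣ p ∩ X ∣ _ ⟩
    (∣ q ─ X ∣ + ∣ q ∩ X ∣) + ∣ p ∩ X ∣   ≡⟨ cong (_+ ∣ p ∩ X ∣) (trans (+-comm ∣ q ─ X ∣ _) (sym (∣p∣≡∣p∩q∣+∣p─q∣ q X))) ⟩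
    ∣ q ∣ + ∣ p ∩ X ∣ ∎
  where
  open ≤-Reasoning
  r∩X⊆ : r ∩ X ⊆ p ∩ X
  r∩X⊆ x∈ with x∈p∩q⁻ r X x∈
  ... | a , b = x∈p∩q⁺ (on a b , b)
  r─X⊆ : r ─ X ⊆ q ─ X
  r─X⊆ x∈ with ∈-─⁻ r X x∈
  ... | a , b = x∈p∧x∉q⇒x∈p─q (off a b) b

HasCard-∣∣ : ∀ {n m} {P : Fin n → Set} (p : Subset n) → HasCard P m → (∀ {v} → v ∈ p → P v) → ∣ p ∣ ≤ m
HasCard-∣∣ p (f , _ , _ , onto) p⊆P = injection⇒∣∣≤ p (λ x x∈ → proj₁ (onto x (p⊆P x∈)))
  (λ x y x∈ y∈ eq → trans (sym (proj₂ (onto x (p⊆P x∈)))) (trans (cong f eq) (proj₂ (onto y (p⊆P y∈)))))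

HasCard-≤∣∣ : ∀ {n m} {P : Fin n → Set} (p : Subset n) → HasCard P m → (∀ {v} → P v → v ∈ p) → m ≤ ∣ p ∣
HasCard-≤∣∣ p (f , f-inj , Pf , _) P⊆p = injection⇒≤∣∣ p f f-inj (λ i → P⊆p (Pf i))

∣p∣≡0⇒∉ : ∀ {n} (p : Subset n) {x} → ∣ p ∣ ≤ 0 → x ∉ p
∣p∣≡0⇒∉ p le x∈ with ∣ p ∣ | index x∈
∣p∣≡0⇒∉ p z≤n x∈ | .0 | ()

∣p∣≤1⇒≡ : ∀ {n} (p : Subset n) {x y} → ∣ p ∣ ≤ 1 → x ∈ p → y ∈ p → x ≡ y
∣p∣≤1⇒≡ p le x∈ y∈ = index-injective x∈ y∈ (lem le (index x∈) (index y∈))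
  where
  lem : ∀ {m} → m ≤ 1 → (i j : Fin m) → i ≡ j
  lem (s≤s z≤n) zero zero = refl

subsingleton⇒∣∣≤1 : ∀ {n} (p : Subset n) → (∀ {x y} → x ∈ p → y ∈ p → x ≡ y) → ∣ p ∣ ≤ 1
subsingleton⇒∣∣≤1 p h = injection⇒∣∣≤ p (λ _ _ → zero {0}) (λ x y x∈ y∈ _ → h x∈ y∈)

empty⇒∣∣≤0 : ∀ {n} (p : Subset n) → (∀ {x} → x ∉ p) → ∣ p ∣ ≤ 0
empty⇒∣∣≤0 p h = injection⇒∣∣≤ p (λ _ x∈ → ⊥-elim (h x∈)) (λ x y x∈ → ⊥-elim (h x∈))

-- Paths inside a vertex set

module _ {n : ℕ} {A : RawAdj n} where

  reach-start : ∀ {P u v} → Reach A P u v → P u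
  reach-start (here p) = p
  reach-start (step p _ _) = p

  reach-trans : ∀ {P u v w} → Reach A P u v → Reach A P v w → Reach A P u w
  reach-trans (here _) r = r
  reach-trans (step p a r) r′ = step p a (reach-trans r r′)

  reach-edge : ∀ {P u v} → P u → P v → A u v ≡ true → Reach A P u v
  reach-edge p q a = step p a (here q)

  reach-sym : (∀ u v → A u v ≡ A v u) → ∀ {P u v} → Reach A P u v → Reach A P v u
  reach-sym A-sym (here p) = here p
  reach-sym A-sym (step p a r) =
    reach-trans (reach-sym A-sym r) (reach-edge (reach-start r) p (trans (A-sym _ _) a))

  -- The map may contract edges. This is what retractions onto a block and the replacement of one
  -- vertex by another need in order to carry connectedness over.
  reach-map : ∀ {P} {B : RawAdj n} {Q : Fin n → Set} (π : Fin n → Fin n) → (∀ {x} → P x → Q (π x)) →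
              (∀ {x y} → P x → P y → A x y ≡ true → π x ≡ π y ⊎ B (π x) (π y) ≡ true) →
              ∀ {u v} → Reach A P u v → Reach B Q (π u) (π v)
  reach-map π onV onE (here p) = here (onV p)
  reach-map {B = B} {Q} π onV onE {v = v} (step p a r) with onE p (reach-start r) a
  ... | inj₁ eq = subst (λ z → Reach B Q z (π v)) (sym eq) (reach-map π onV onE r)
  ... | inj₂ b  = step (onV p) b (reach-map π onV onE r)

  reach-weaken : ∀ {P} {B : RawAdj n} {Q : Fin n → Set} → (∀ {x} → P x → Q x) →
              (∀ {x y} → P x → P y → A x y ≡ true → B x y ≡ true) →
              ∀ {u v} → Reach A P u v → Reach B Q u v
  reach-weaken onV onE = reach-map id onV (λ p q a → inj₂ (onE p q a))

  opaque

    -- The edge along which a path leaves a region. Arguments that a connected set has to contain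
    -- some separating vertex, or to meet some layer, inspect this edge.
    reach-cross : ∀ {P Q : Fin n → Set} → (∀ v → Dec (Q v)) → ∀ {u v} → Reach A P u v → Q u → ¬ Q v →
                  ∃ λ a → ∃ λ b → P a × P b × Q a × ¬ Q b × A a b ≡ true
    reach-cross Q? (here _) q ¬q = ⊥-elim (¬q q)
    reach-cross Q? (step {u} {w} p a r) q ¬q with Q? w
    ... | yes qw = reach-cross Q? r qw ¬q
    ... | no ¬qw = u , w , p , reach-start r , q , ¬qw , a

  -- For detours: each edge of G + uv used by a path is replaced by a path of G inside the same set.
  reach-bind : ∀ {P} {B : RawAdj n} → (∀ {x y} → P x → P y → A x y ≡ true → Reach B P x y) →
               ∀ {u v} → Reach A P u v → Reach B P u v
  reach-bind path (here p) = here p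
  reach-bind path (step p a (here q)) = path p q a
  reach-bind path (step p a r@(step q _ _)) = go (path p q a) (reach-bind path r)
    where
    go : ∀ {B : RawAdj n} {P u v w} → Reach B P u v → Reach B P v w → Reach B P u w
    go (here _) r = r
    go (step p b r) r′ = step p b (go r r′)

  connected-via : (∀ u v → A u v ≡ A v u) → ∀ {P} h → (∀ x → P x → Reach A P x h) → ConnectedOn A P
  connected-via A-sym h toHub u v p q = reach-trans (toHub u p) (reach-sym A-sym (toHub v q))

  -- Deciding reachability, and extending nonseparable sets to blocks

  module _ {P : Fin n → Set} (P? : ∀ v → Dec (P v)) where

    private
      Closed : Subset n → Set
      Closed S = ∀ x y → x ∈ S → A x y ≡ true → P y → y ∈ S

      -- Closure of a vertex under edges that stay in `P`, one vertex at a time. The bound makes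
      -- `fuel` at least the number of vertices outside `S`, so it cannot run out before `S` is
      -- closed.
      grow : ∀ {u} fuel (S : Subset n) → n ≤ fuel + ∣ S ∣ → u ∈ S → (∀ v → v ∈ S → Reach A P u v) →
             Σ (Subset n) λ S → u ∈ S × (∀ v → v ∈ S → Reach A P u v) × Closed S
      grow fuel S le u∈ reaches with any? (λ x → any? (λ y →
        (x ∈? S) ×-dec (A x y Bool.≟ true) ×-dec P? y ×-dec ¬? (y ∈? S)))
      ... | no none = S , u∈ , reaches , λ x y x∈ a py →
              decidable-stable (y ∈? S) (λ y∉ → none (x , y , x∈ , a , py , y∉))
      grow {u} fuel S le u∈ reaches | yes (x , y , x∈ , a , py , y∉) = continue fuel le
        where
        S′ : Subset n
        S′ = S ∪ ⁅ y ⁆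
        bigger : ∣ S ∣ < ∣ S′ ∣
        bigger = p⊂q⇒∣p∣<∣q∣ (p⊆p∪q ⁅ y ⁆ , y , x∈p∪q⁺ (inj₂ (x∈⁅x⁆ y)) , y∉)
        reaches′ : ∀ v → v ∈ S′ → Reach A P u v
        reaches′ v v∈ with x∈p∪q⁻ S ⁅ y ⁆ v∈
        ... | inj₁ v∈S = reaches v v∈S
        ... | inj₂ v∈y with x∈⁅y⁆⇒x≡y y v∈y
        ... | refl = reach-trans (reaches x x∈) (reach-edge (end (reaches x x∈)) py a)
          where
          end : ∀ {v w} → Reach A P v w → P w
          end (here p) = p
          end (step _ _ r) = end r
        continue : ∀ fuel → n ≤ fuel + ∣ S ∣ →
                   Σ (Subset n) λ S → u ∈ S × (∀ v → v ∈ S → Reach A P u v) × Closed S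
        continue zero le = ⊥-elim (<⇒≱ bigger (≤-trans (∣p∣≤n S′) le))
        continue (suc fuel) le = grow fuel S′
          (≤-trans le (≤-trans (≤-reflexive (sym (+-suc fuel ∣ S ∣))) (+-monoʳ-≤ fuel bigger)))
          (p⊆p∪q ⁅ y ⁆ u∈) reaches′

    reach? : ∀ u v → Dec (Reach A P u v)
    reach? u v with P? u
    ... | no ¬pu = no (¬pu ∘ reach-start)
    ... | yes pu with grow n ⁅ u ⁆ (m≤m+n n _) (x∈⁅x⁆ u) (λ { w w∈ → subst (Reach A P u) (sym (x∈⁅y⁆⇒x≡y u w∈)) (here pu) })
    ... | S , u∈ , reaches , closed with v ∈? S
    ... | yes v∈ = yes (reaches v v∈)
    ... | no v∉ = no λ r → let (a , b , _ , pb , a∈ , b∉ , ab) = reach-cross (_∈? S) r u∈ v∉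
                           in b∉ (closed a b a∈ ab pb)

    connectedOn? : Dec (ConnectedOn A P)
    connectedOn? = all? λ u → all? λ v → P? u →-dec (P? v →-dec reach? u v)

  nonsep? : ∀ B → Dec (Nonsep A B)
  nonsep? B = any? (_∈? B) ×-dec connectedOn? (_∈? B) ×-dec
    all? (λ c → (c ∈? B) →-dec connectedOn? (λ x → (x ∈? B) ×-dec ¬? (x ≟ c)))

  ⊆∧≢⇒∣∣< : ∀ {p q : Subset n} → p ⊆ q → q ≢ p → ∣ p ∣ < ∣ q ∣
  ⊆∧≢⇒∣∣< {p} {q} p⊆q q≢p with any? (λ x → (x ∈? q) ×-dec ¬? (x ∈? p))
  ... | yes (x , x∈ , x∉) = p⊂q⇒∣p∣<∣q∣ (p⊆q , x , x∈ , x∉)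
  ... | no none = ⊥-elim (q≢p (⊆-antisym (λ {x} x∈q → decidable-stable (x ∈? p) (λ x∉ → none (x , x∈q , x∉))) p⊆q))

  -- Replace the set by a larger nonseparable one as long as there is any; sizes are bounded by `n`.
  -- Applied to single vertices and edges, it shows that the blocks cover the graph.
  nonsep⊆block : ∀ B → Nonsep A B → Σ (Subset n) λ B′ → IsBlock A B′ × B ⊆ B′
  nonsep⊆block B = grow n B (m≤m+n n _)
    where
    grow : ∀ fuel B → n ≤ fuel + ∣ B ∣ → Nonsep A B → Σ (Subset n) λ B′ → IsBlock A B′ × B ⊆ B′
    grow fuel B le ns with anySubset? (λ B′ → nonsep? B′ ×-dec (B ⊆? B′) ×-dec ¬? (≡-dec Bool._≟_ B′ B))
    ... | no none = B , (ns , λ B′ ns′ B⊆B′ → decidable-stable (≡-dec Bool._≟_ B′ B)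
                       (λ neq → none (B′ , ns′ , B⊆B′ , neq))) , id
    grow fuel B le ns | yes (B′ , ns′ , B⊆B′ , neq) = continue fuel le
      where
      bigger : ∣ B ∣ < ∣ B′ ∣
      bigger = ⊆∧≢⇒∣∣< B⊆B′ neq
      continue : ∀ fuel → n ≤ fuel + ∣ B ∣ → Σ (Subset n) λ B′ → IsBlock A B′ × B ⊆ B′
      continue zero le = ⊥-elim (<⇒≱ bigger (≤-trans (∣p∣≤n B′) le))
      continue (suc fuel) le with grow fuel B′
        (≤-trans le (≤-trans (≤-reflexive (sym (+-suc fuel ∣ B ∣))) (+-monoʳ-≤ fuel bigger))) ns′
      ... | B″ , blk , B′⊆B″ = B″ , blk , λ x∈ → B′⊆B″ (B⊆B′ x∈)

-- Adding an edge

≟-refl : ∀ {n} (u : Fin n) → ⌊ u ≟ u ⌋ ≡ true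
≟-refl u = trans (isYes≗does (u ≟ u)) (dec-true (u ≟ u) refl)

module _ {n : ℕ} (A : RawAdj n) (u v : Fin n) where

  addEdge-old : ∀ {x y} → A x y ≡ true → addEdge A u v x y ≡ true
  addEdge-old a rewrite a = refl

  addEdge-new : addEdge A u v u v ≡ true
  addEdge-new rewrite ≟-refl u | ≟-refl v = Bool.∨-zeroʳ (A u v)

  addEdge-new′ : addEdge A u v v u ≡ true
  addEdge-new′ rewrite ≟-refl u | ≟-refl v
    | Bool.∨-zeroʳ (⌊ v ≟ u ⌋ ∧ ⌊ u ≟ v ⌋) = Bool.∨-zeroʳ (A v u)

  addEdge⁻ : ∀ {x y} → addEdge A u v x y ≡ true → A x y ≡ true ⊎ (x ≡ u × y ≡ v) ⊎ (x ≡ v × y ≡ u)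
  addEdge⁻ {x} {y} a with A x y | x ≟ u | y ≟ v | x ≟ v | y ≟ u
  ... | true  | _ | _ | _ | _ = inj₁ refl
  ... | false | yes p | yes q | _ | _ = inj₂ (inj₁ (p , q))
  ... | false | _ | _ | yes p | yes q = inj₂ (inj₂ (p , q))
  addEdge⁻ () | false | yes _ | no _ | yes _ | no _
  addEdge⁻ () | false | yes _ | no _ | no _ | _
  addEdge⁻ () | false | no _ | _ | yes _ | no _
  addEdge⁻ () | false | no _ | _ | no _ | _

  addEdge-sym : (∀ x y → A x y ≡ A y x) → ∀ x y → addEdge A u v x y ≡ addEdge A u v y x
  addEdge-sym A-sym x y = cong₂ _∨_ (A-sym x y) (trans (Bool.∨-comm (⌊ x ≟ u ⌋ ∧ ⌊ y ≟ v ⌋) _)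
    (cong₂ _∨_ (Bool.∧-comm ⌊ x ≟ v ⌋ _) (Bool.∧-comm ⌊ x ≟ u ⌋ _)))

-- Chains of blocks

module _ {n : ℕ} (bl : ℕ → Subset n) (cv : ℕ → Fin n) where

  -- Paths pass from block to block through the cut vertices. The window from `lo` to `hi` serves
  -- the case of a deleted cut vertex, where only the blocks on one side may be walked.
  chain-reach : (A : RawAdj n) (P : Fin n → Set) (lo hi : ℕ) →
    (∀ s → lo ≤ s → s < hi → P (cv s) × cv s ∈ bl s × cv s ∈ bl (suc s)) →
    (∀ t → lo ≤ t → t ≤ hi → ∀ u v → u ∈ bl t → v ∈ bl t → P u → P v → Reach A P u v) →
    ∀ t t′ → lo ≤ t → t ≤ t′ → t′ ≤ hi → ∀ u v → u ∈ bl t → v ∈ bl t′ → P u → P v → Reach A P u v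
  chain-reach A P lo hi cvP inside-block t t′ lo≤t t≤t′ t′≤hi u v u∈ v∈ p q =
    go (t′ ∸ t) t lo≤t (m∸n+n≡m t≤t′) u u∈ p
    where
    go : ∀ d t → lo ≤ t → d + t ≡ t′ → ∀ u → u ∈ bl t → P u → Reach A P u v
    go zero t lo≤t refl u u∈ p = inside-block t lo≤t t′≤hi u v u∈ v∈ p q
    go (suc d) t lo≤t eq u u∈ p with cvP t lo≤t t<hi
      where
      t<hi : t < hi
      t<hi = ≤-trans (≤-trans (s≤s (m≤n+m t d)) (≤-reflexive eq)) t′≤hi
    ... | p′ , c∈ , c∈′ = reach-trans
            (inside-block t lo≤t (≤-trans (m≤n+m t (suc d)) (≤-trans (≤-reflexive eq) t′≤hi)) u (cv t) u∈ c∈ p p′)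
            (go d (suc t) (m≤n⇒m≤1+n lo≤t) (trans (+-suc d t) eq) (cv t) c∈′ p′)

-- Blocks 0..K and cut vertices 0..K-1; values at larger indices are meaningless. The field `meet`
-- says that the blocks form a path: only consecutive ones intersect, and only in the cut vertex
-- between them.
record Chain (n K : ℕ) : Set where
  field
    bl    : ℕ → Subset n
    cv    : ℕ → Fin n
    cv∈   : ∀ {s} → s < K → cv s ∈ bl s
    cv∈′  : ∀ {s} → s < K → cv s ∈ bl (suc s)
    cover : ∀ v → ∃ λ t → t ≤ K × v ∈ bl t
    meet  : ∀ {t t′ v} → t < t′ → t′ ≤ K → v ∈ bl t → v ∈ bl t′ → t′ ≡ suc t × v ≡ cv t
    two   : ∀ {t} → t ≤ K → ∀ v → ∃ λ w → w ∈ bl t × w ≢ v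

-- Connected dominating sets of a chain, block by block

module ChainCDS {n K : ℕ} (C : Chain n K) where
  open Chain C

  -- The two sides of `cv s` are `Below (suc s)` and `Above s`, which share only that vertex; the
  -- two sides of block `t` are `Below t` and `Above t`.
  Below Above : ℕ → Fin n → Set
  Below s v = ∃ λ t → t < s × v ∈ bl t
  Above s v = ∃ λ t → s < t × t ≤ K × v ∈ bl t

  below? : ∀ s v → Dec (Below s v)
  below? s v = anyUpTo? (λ t → v ∈? bl t) s

  below∩above : ∀ {s v} → Below (suc s) v → Above s v → v ≡ cv s
  below∩above {s} (t , t≤s , v∈) (t′ , s<t′ , t′≤K , v∈′) with meet (<-≤-trans t≤s s<t′) t′≤K v∈ v∈′
  ... | refl , v≡ = trans v≡ (cong cv (≤-antisym (s≤s⁻¹ t≤s) (s≤s⁻¹ s<t′)))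

  -- Conditions on an arbitrary relation rather than on G, since they survive added edges: an edge
  -- inside one block, or one with both ends on the same side.
  Fits Sep : RawAdj n → ℕ → Set
  Fits A t = ∀ u v → A u v ≡ true →
    (u ∈ bl t × v ∈ bl t) ⊎ (Below t u × Below t v) ⊎ (Above t u × Above t v)
  Sep A s = ∀ u v → A u v ≡ true → (Below (suc s) u × Below (suc s) v) ⊎ (Above s u × Above s v)

  edge⇒fits : ∀ {A : RawAdj n} → (∀ {u v} → A u v ≡ true → ∃ λ t → t ≤ K × u ∈ bl t × v ∈ bl t) →
              ∀ {t} → Fits A t
  edge⇒fits edge {t} u v a with edge a
  ... | i , i≤K , u∈ , v∈ with <-cmp i t
  ... | tri< lt _ _ = inj₂ (inj₁ ((i , lt , u∈) , (i , lt , v∈)))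
  ... | tri≈ _ refl _ = inj₁ (u∈ , v∈)
  ... | tri> _ _ gt = inj₂ (inj₂ ((i , gt , i≤K , u∈) , (i , gt , i≤K , v∈)))

  fits⇒sep : ∀ {A t} → Fits A t → Sep A t
  fits⇒sep {t = t} fits u v a with fits u v a
  ... | inj₁ (p , q) = inj₁ ((t , ≤-refl , p) , (t , ≤-refl , q))
  ... | inj₂ (inj₁ ((i , i< , p) , (j , j< , q))) = inj₁ ((i , m≤n⇒m≤1+n i< , p) , (j , m≤n⇒m≤1+n j< , q))
  ... | inj₂ (inj₂ pq) = inj₂ pq

  fits⇒sep-pred : ∀ {A t} → suc t ≤ K → Fits A (suc t) → Sep A t
  fits⇒sep-pred {t = t} t≤K fits u v a with fits u v a
  ... | inj₁ (p , q) = inj₂ ((suc t , ≤-refl , t≤K , p) , (suc t , ≤-refl , t≤K , q))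
  ... | inj₂ (inj₁ pq) = inj₁ pq
  ... | inj₂ (inj₂ ((i , i> , i≤ , p) , (j , j> , j≤ , q))) =
          inj₂ ((i , ≤-trans (n≤1+n _) i> , i≤ , p) , (j , ≤-trans (n≤1+n _) j> , j≤ , q))

  opaque

    -- Each side of `cv s` has a further vertex, which is in D or dominated from its own side. A
    -- path of D from one side to the other can change sides only at `cv s`.
    cv∈CDS : ∀ {A D s} → s < K → Sep A s → IsCDS A D → cv s ∈ D
    cv∈CDS {A} {D} {s} s<K sep (dom , conn) = decidable-stable (cv s ∈? D) contra
      where
      contra : ¬ ¬ (cv s ∈ D)
      contra c∉ with two {s} (<⇒≤ s<K) (cv s) | two {suc s} s<K (cv s)
      ... | w , w∈ , w≢ | w′ , w′∈ , w′≢ = absurd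
        where
        belowW : Below (suc s) w
        belowW = s , ≤-refl , w∈
        aboveW′ : Above s w′
        aboveW′ = suc s , ≤-refl , s<K , w′∈
        lower : ∃ λ d → d ∈ D × Below (suc s) d
        lower with dom w
        ... | inj₁ w∈D = w , w∈D , belowW
        ... | inj₂ (d , d∈ , a) with sep w d a
        ... | inj₁ (_ , b) = d , d∈ , b
        ... | inj₂ (b , _) = ⊥-elim (w≢ (below∩above belowW b))
        upper : ∃ λ d → d ∈ D × Above s d
        upper with dom w′
        ... | inj₁ w∈D = w′ , w∈D , aboveW′
        ... | inj₂ (d , d∈ , a) with sep w′ d a
        ... | inj₁ (b , _) = ⊥-elim (w′≢ (below∩above b aboveW′))
        ... | inj₂ (_ , b) = d , d∈ , b
        absurd : ⊥
        absurd with lower | upper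
        ... | d , d∈ , bd | d′ , d′∈ , ad′
          with reach-cross (below? (suc s)) (conn d d′ d∈ d′∈) bd
                 (λ b → c∉ (subst (_∈ D) (below∩above b ad′) d′∈))
        ... | a , b , a∈ , b∈ , qa , ¬qb , ab with sep a b ab
        ... | inj₁ (_ , qb) = ¬qb qb
        ... | inj₂ (aa , _) = c∉ (subst (_∈ D) (below∩above qa aa) a∈)

  Local : RawAdj n → Subset n → ℕ → Set
  Local A D t =
    (∀ v → v ∈ bl t → v ∈ D ⊎ ∃ λ u → u ∈ D × u ∈ bl t × A v u ≡ true) ×
    ConnectedOn A (λ x → x ∈ D × x ∈ bl t)

  -- Retraction onto block t; what lies beyond a cut vertex of the block goes to that cut vertex.
  retract : ℕ → Fin n → Fin n
  retract t v with v ∈? bl t | below? t v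
  ... | yes _ | _     = v
  ... | no _  | yes _ = cv (t ∸ 1)
  ... | no _  | no _  = cv t

  retract-in : ∀ {t v} → v ∈ bl t → retract t v ≡ v
  retract-in {t} {v} v∈ with v ∈? bl t | below? t v
  ... | yes _ | _ = refl
  ... | no v∉ | _ = ⊥-elim (v∉ v∈)

  retract-below : ∀ {t v} → t ≤ K → Below t v → retract t v ≡ cv (t ∸ 1)
  retract-below {t} {v} t≤K b with v ∈? bl t | below? t v
  retract-below t≤K (t′ , t′< , v∈′) | yes v∈ | _ with meet t′< t≤K v∈′ v∈
  ... | refl , v≡ = v≡
  retract-below t≤K b | no _ | yes _ = refl
  retract-below t≤K b | no _ | no ¬b = ⊥-elim (¬b b)

  retract-above : ∀ {t v} → Above t v → retract t v ≡ cv t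
  retract-above {t} {v} a with v ∈? bl t | below? t v
  retract-above (t′ , t<t′ , t′≤K , v∈′) | yes v∈ | _ = proj₂ (meet t<t′ t′≤K v∈ v∈′)
  retract-above (t′ , t<t′ , t′≤K , v∈′) | no _ | yes (i , i<t , v∈i)
    with meet (<-trans i<t t<t′) t′≤K v∈i v∈′
  ... | refl , _ = ⊥-elim (<⇒≱ i<t (s≤s⁻¹ t<t′))
  retract-above a | no _ | no _ = refl

  retract-∈ : ∀ {t} → t ≤ K → {P : Fin n → Set} →
              (∀ s → suc s ≡ t → P (cv s)) → (t < K → P (cv t)) → ∀ v → P v →
              P (retract t v) × retract t v ∈ bl t
  retract-∈ {t} t≤K pred next v pv′ with v ∈? bl t | below? t v
  ... | yes v∈ | _ = pv′ , v∈
  retract-∈ {suc t} t≤K pred next v pv′ | no _ | yes _ = pred t refl , cv∈′ t≤K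
  retract-∈ {zero} t≤K pred next v pv′ | no _ | yes (_ , () , _)
  retract-∈ {t} t≤K pred next v pv′ | no v∉ | no ¬b with cover v
  ... | t′ , t′≤K , v∈ with <-cmp t t′
  ... | tri< t<t′ _ _ = next (<-≤-trans t<t′ t′≤K) , cv∈ (<-≤-trans t<t′ t′≤K)
  ... | tri≈ _ refl _ = ⊥-elim (v∉ v∈)
  ... | tri> _ _ t′<t = ⊥-elim (¬b (t′ , t′<t , v∈))

  opaque

    -- The cut vertices of the block are in D, so `retract` carries a path of D to one inside the
    -- block, contracting all edges elsewhere. A vertex of the block that is dominated from outside
    -- it is a cut vertex, hence in D itself.
    cds⇒local : ∀ {A D t} → t ≤ K → Fits A t → IsCDS A D → Local A D t
    cds⇒local {A} {D} {t} t≤K fits cds@(dom , conn) = dom′ , conn′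
      where
      prev : ∀ s → suc s ≡ t → cv s ∈ D
      prev s refl = cv∈CDS t≤K (fits⇒sep-pred t≤K fits) cds
      next : t < K → cv t ∈ D
      next t<K = cv∈CDS t<K (fits⇒sep fits) cds
      dom′ : ∀ v → v ∈ bl t → v ∈ D ⊎ ∃ λ u → u ∈ D × u ∈ bl t × A v u ≡ true
      dom′ v v∈ with dom v
      ... | inj₁ v∈D = inj₁ v∈D
      ... | inj₂ (u , u∈D , a) with fits v u a
      ... | inj₁ (_ , u∈) = inj₂ (u , u∈D , u∈ , a)
      ... | inj₂ (inj₁ ((i , i<t , v∈i) , _)) with meet i<t t≤K v∈i v∈
      ... | refl , refl = inj₁ (prev i refl)
      dom′ v v∈ | inj₂ (u , u∈D , a) | inj₂ (inj₂ ((i , t<i , i≤K , v∈i) , _)) with meet t<i i≤K v∈ v∈i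
      ... | refl , refl = inj₁ (next i≤K)
      conn′ : ConnectedOn A (λ x → x ∈ D × x ∈ bl t)
      conn′ u v (u∈D , u∈) (v∈D , v∈) =
        subst (Reach A _ u) (retract-in v∈) (subst (λ z → Reach A (λ x → x ∈ D × x ∈ bl t) z (retract t v)) (retract-in u∈)
          (reach-map (retract t) (λ {x} x∈ → retract-∈ t≤K {_∈ D} prev next x x∈) edge (conn u v u∈D v∈D)))
        where
        edge : ∀ {x y} → x ∈ D → y ∈ D → A x y ≡ true → retract t x ≡ retract t y ⊎ A (retract t x) (retract t y) ≡ true
        edge {x} {y} _ _ a with fits x y a
        ... | inj₁ (x∈ , y∈) = inj₂ (trans (cong₂ A (retract-in x∈) (retract-in y∈)) a)
        ... | inj₂ (inj₁ (bx , by)) = inj₁ (trans (retract-below t≤K bx) (sym (retract-below t≤K by)))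
        ... | inj₂ (inj₂ (ax , ay)) = inj₁ (trans (retract-above ax) (sym (retract-above ay)))

  local⇒cds : ∀ {A D} → (∀ u v → A u v ≡ A v u) → (∀ s → s < K → cv s ∈ D) →
              (∀ t → t ≤ K → Local A D t) → IsCDS A D
  local⇒cds {A} {D} A-sym cvs loc = dom , conn
    where
    dom : Dominating A D
    dom v with cover v
    ... | t , t≤K , v∈ with proj₁ (loc t t≤K) v v∈
    ... | inj₁ v∈D = inj₁ v∈D
    ... | inj₂ (u , u∈D , _ , a) = inj₂ (u , u∈D , a)
    up : ∀ t t′ → t ≤ t′ → t′ ≤ K → ∀ u v → u ∈ bl t → v ∈ bl t′ → u ∈ D → v ∈ D → Reach A (_∈ D) u v
    up t t′ t≤t′ t′≤K = chain-reach bl cv A (_∈ D) 0 K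
      (λ s _ s<K → cvs s s<K , cv∈ s<K , cv∈′ s<K)
      (λ t _ t≤K u v u∈ v∈ u∈D v∈D → reach-weaken proj₁ (λ _ _ a → a) (proj₂ (loc t t≤K) u v (u∈D , u∈) (v∈D , v∈)))
      t t′ z≤n t≤t′ t′≤K
    conn : ConnectedOn A (_∈ D)
    conn u v u∈D v∈D with cover u | cover v
    ... | t , t≤K , u∈ | t′ , t′≤K , v∈ with ≤-total t t′
    ... | inj₁ t≤t′ = up t t′ t≤t′ t′≤K u v u∈ v∈ u∈D v∈D
    ... | inj₂ t′≤t = reach-sym A-sym (up t′ t t′≤t t≤K v u v∈ u∈ v∈D u∈D)

  -- For a cut vertex this is an arbitrary one of its two blocks; by `near-home` the choice does not
  -- matter for `mix`.
  home : Fin n → ℕ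
  home v = proj₁ (cover v)

  home≤ : ∀ v → home v ≤ K
  home≤ v = proj₁ (proj₂ (cover v))

  home∈ : ∀ v → v ∈ bl (home v)
  home∈ v = proj₂ (proj₂ (cover v))

  -- Take D₁ on the blocks satisfying Q and D₂ on the others.
  module Mix {Q : ℕ → Set} (Q? : ∀ t → Dec (Q t)) (D₁ D₂ : Subset n)
             (cv₁ : ∀ s → s < K → cv s ∈ D₁)
             (cv₂ : ∀ s → s < K → cv s ∈ D₂ ⊎ (Q s × Q (suc s))) where

    mix? : ∀ v → Dec ((Q (home v) × v ∈ D₁) ⊎ (¬ Q (home v) × v ∈ D₂))
    mix? v = (Q? (home v) ×-dec (v ∈? D₁)) ⊎-dec (¬? (Q? (home v)) ×-dec (v ∈? D₂))

    mix : Subset n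
    mix = subset mix?

    private
      near-home : ∀ {t v} → t ≤ K → v ∈ bl t →
                  t ≡ home v ⊎ ∃ λ s → s < K × v ≡ cv s × (t ≡ s ⊎ t ≡ suc s) × (home v ≡ s ⊎ home v ≡ suc s)
      near-home {t} {v} t≤K v∈ with <-cmp t (home v)
      ... | tri≈ _ eq _ = inj₁ eq
      ... | tri< lt _ _ with meet lt (home≤ v) v∈ (home∈ v)
      ... | eq , v≡ = inj₂ (t , <-≤-trans lt (home≤ v) , v≡ , inj₁ refl , inj₂ eq)
      near-home {t} {v} t≤K v∈ | tri> _ _ gt with meet gt t≤K (home∈ v) v∈
      ... | eq , v≡ = inj₂ (home v , <-≤-trans gt t≤K , v≡ , inj₂ eq , inj₁ refl)

      q-of : ∀ {s t} → Q s × Q (suc s) → t ≡ s ⊎ t ≡ suc s → Q t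
      q-of (q , _) (inj₁ refl) = q
      q-of (_ , q) (inj₂ refl) = q

    mix-on : ∀ {t v} → t ≤ K → v ∈ bl t → Q t → (v ∈ mix → v ∈ D₁) × (v ∈ D₁ → v ∈ mix)
    mix-on {t} {v} t≤K v∈ q with near-home t≤K v∈
    ... | inj₁ refl = (λ m → [ proj₂ , (λ p → ⊥-elim (proj₁ p q)) ]′ (∈-subset⁻ mix? m)) ,
                      (λ d → ∈-subset⁺ mix? (inj₁ (q , d)))
    ... | inj₂ (s , s<K , refl , ts , hs) = (λ _ → cv₁ s s<K) , λ d → ∈-subset⁺ mix? (back d (Q? (home v)) (cv₂ s s<K))
      where
      back : v ∈ D₁ → Dec (Q (home v)) → v ∈ D₂ ⊎ (Q s × Q (suc s)) → (Q (home v) × v ∈ D₁) ⊎ (¬ Q (home v) × v ∈ D₂)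
      back d (yes q) _ = inj₁ (q , d)
      back d (no ¬q) (inj₁ d₂) = inj₂ (¬q , d₂)
      -- Here `cv s` may be absent from `D₂`, but both blocks around it satisfy `Q`, and its home is
      -- one of them.
      back d (no ¬q) (inj₂ qq) = ⊥-elim (¬q (q-of qq hs))

    mix-off : ∀ {t v} → t ≤ K → v ∈ bl t → ¬ Q t → (v ∈ mix → v ∈ D₂) × (v ∈ D₂ → v ∈ mix)
    mix-off {t} {v} t≤K v∈ ¬q with near-home t≤K v∈
    ... | inj₁ refl = (λ m → [ (λ p → ⊥-elim (¬q (proj₁ p))) , proj₂ ]′ (∈-subset⁻ mix? m)) ,
                      (λ d → ∈-subset⁺ mix? (inj₂ (¬q , d)))
    ... | inj₂ (s , s<K , refl , ts , hs) with cv₂ s s<K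
    ... | inj₂ qq = ⊥-elim (¬q (q-of qq ts))
    ... | inj₁ d₂ = (λ _ → d₂) , λ _ → ∈-subset⁺ mix? (back (Q? (home v)))
      where
      back : Dec (Q (home v)) → (Q (home v) × v ∈ D₁) ⊎ (¬ Q (home v) × v ∈ D₂)
      back (yes q) = inj₁ (q , cv₁ s s<K)
      back (no ¬q) = inj₂ (¬q , d₂)

    local-≗ : ∀ {A D D′ t} → (∀ v → v ∈ bl t → (v ∈ D′ → v ∈ D) × (v ∈ D → v ∈ D′)) → Local A D t → Local A D′ t
    local-≗ {A} {D} {D′} {t} eqv (dom , conn) =
      (λ v v∈ → [ (λ d → inj₁ (proj₂ (eqv v v∈) d)) ,
                  (λ { (u , u∈D , u∈ , a) → inj₂ (u , proj₂ (eqv u u∈) u∈D , u∈ , a) }) ]′ (dom v v∈)) ,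
      λ u v (ud , ub) (vd , vb) → reach-weaken (λ { (d , b) → proj₂ (eqv _ b) d , b }) (λ _ _ a → a)
        (conn u v (proj₁ (eqv u ub) ud , ub) (proj₁ (eqv v vb) vd , vb))

    mix-cds : ∀ {A} → (∀ u v → A u v ≡ A v u) →
      (∀ t → t ≤ K → Q t → Local A D₁ t) → (∀ t → t ≤ K → ¬ Q t → Local A D₂ t) → IsCDS A mix
    mix-cds {A} A-sym l₁ l₂ = local⇒cds A-sym cvs loc
      where
      cvs : ∀ s → s < K → cv s ∈ mix
      cvs s s<K with Q? s | cv₂ s s<K
      ... | yes q | _ = proj₂ (mix-on (<⇒≤ s<K) (cv∈ s<K) q) (cv₁ s s<K)
      ... | no ¬q | inj₁ d = proj₂ (mix-off (<⇒≤ s<K) (cv∈ s<K) ¬q) d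
      ... | no ¬q | inj₂ (q , _) = ⊥-elim (¬q q)
      loc : ∀ t → t ≤ K → Local A mix t
      loc t t≤K with Q? t
      ... | yes q = local-≗ (λ v v∈ → mix-on t≤K v∈ q) (l₁ t t≤K q)
      ... | no ¬q = local-≗ (λ v v∈ → mix-off t≤K v∈ ¬q) (l₂ t t≤K ¬q)

    -- The mixed set agrees with `D₁` on `X` and lies in `D₂` off `X`. So `X` only has to contain
    -- those vertices of the chosen blocks that `D₁` has and `D₂` lacks.
    mix-card : (X : Subset n) → (∀ {v} → v ∈ X → Q (home v)) →
               (∀ {v} → v ∉ X → Q (home v) → v ∈ D₁ → v ∈ D₂) →
               ∣ mix ∣ + ∣ D₂ ∩ X ∣ ≤ ∣ D₂ ∣ + ∣ D₁ ∩ X ∣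
    mix-card X on off = exchange-card D₁ D₂ mix X
      (λ m x → [ proj₂ , (λ p → ⊥-elim (proj₁ p (on x))) ]′ (∈-subset⁻ mix? m))
      (λ m x → [ (λ p → off x (proj₁ p) (proj₂ p)) , proj₂ ]′ (∈-subset⁻ mix? m))

-- Critical graphs with a chain of blocks

module CriticalChain {n K : ℕ} (G : Graph n) (C : Chain n K)
  (edge : ∀ {u v} → adj G u v ≡ true → ∃ λ t → t ≤ K × u ∈ Chain.bl C t × v ∈ Chain.bl C t)
  (nonsep : ∀ {t} → t ≤ K → Nonsep (adj G) (Chain.bl C t))
  {k : ℕ} (critical : Critical G k) (D : Subset n) (cdsD : IsCDS (adj G) D) (∣D∣≡k : ∣ D ∣ ≡ k) where

  open Chain C
  open ChainCDS C

  A : RawAdj n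
  A = adj G

  A-sym : ∀ u v → A u v ≡ A v u
  A-sym = adj-sym G

  flip-adj : ∀ {u v b} → A u v ≡ b → A v u ≡ b
  flip-adj a = trans (A-sym _ _) a

  fits : ∀ {t} → t ≤ K → Fits A t
  fits _ = edge⇒fits edge

  minimal : ∀ E → IsCDS A E → k ≤ ∣ E ∣
  minimal = proj₂ (proj₁ critical)

  sep : ∀ {s} → s < K → Sep A s
  sep s<K = fits⇒sep (fits (<⇒≤ s<K))

  cvD : ∀ s → s < K → cv s ∈ D
  cvD s s<K = cv∈CDS s<K (sep s<K) cdsD

  IsCv : Fin n → Set
  IsCv v = ∃ λ s → s < K × v ≡ cv s

  isCv? : ∀ v → Dec (IsCv v)
  isCv? v = anyUpTo? (λ s → v ≟ cv s) K

  opaque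

    inner : ℕ → Subset n
    inner t = subset (λ v → (v ∈? bl t) ×-dec ¬? (isCv? v))

    inner⁺ : ∀ {t v} → v ∈ bl t → ¬ IsCv v → v ∈ inner t
    inner⁺ v∈ ¬cv = ∈-subset⁺ _ (v∈ , ¬cv)

    inner⁻ : ∀ {t v} → v ∈ inner t → v ∈ bl t × ¬ IsCv v
    inner⁻ = ∈-subset⁻ _

  inner-unique : ∀ {t t′ v} → t ≤ K → t′ ≤ K → ¬ IsCv v → v ∈ bl t → v ∈ bl t′ → t ≡ t′
  inner-unique {t} {t′} t≤K t′≤K ¬cv v∈ v∈′ with <-cmp t t′
  ... | tri≈ _ eq _ = eq
  ... | tri< lt _ _ = ⊥-elim (¬cv (t , <-≤-trans lt t′≤K , proj₂ (meet lt t′≤K v∈ v∈′)))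
  ... | tri> _ _ gt = ⊥-elim (¬cv (t′ , <-≤-trans gt t≤K , proj₂ (meet gt t≤K v∈′ v∈)))

  two-blocks : ∀ {t t′ u v} → t ≤ K → t′ ≤ K → t ≢ t′ → u ∈ bl t → v ∈ bl t → u ∈ bl t′ → v ∈ bl t′ → u ≡ v
  two-blocks {t} {t′} t≤K t′≤K t≢t′ u∈ v∈ u∈′ v∈′ with <-cmp t t′
  ... | tri≈ _ eq _ = ⊥-elim (t≢t′ eq)
  ... | tri< lt _ _ = trans (proj₂ (meet lt t′≤K u∈ u∈′)) (sym (proj₂ (meet lt t′≤K v∈ v∈′)))
  ... | tri> _ _ gt = trans (proj₂ (meet gt t≤K u∈′ u∈)) (sym (proj₂ (meet gt t≤K v∈′ v∈)))

  fits-addEdge : ∀ {t u v} → t ≤ K → u ∈ bl t → v ∈ bl t → ∀ {t′} → t′ ≤ K → Fits (addEdge A u v) t′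
  fits-addEdge {t} {u} {v} t≤K u∈ v∈ {t′} t′≤K x y a with addEdge⁻ A u v a
  ... | inj₁ old = fits t′≤K x y old
  ... | inj₂ new = place (<-cmp t t′) (members new)
    where
    members : (x ≡ u × y ≡ v) ⊎ (x ≡ v × y ≡ u) → x ∈ bl t × y ∈ bl t
    members (inj₁ (refl , refl)) = u∈ , v∈
    members (inj₂ (refl , refl)) = v∈ , u∈
    place : Tri (t < t′) (t ≡ t′) (t′ < t) → x ∈ bl t × y ∈ bl t →
            (x ∈ bl t′ × y ∈ bl t′) ⊎ (Below t′ x × Below t′ y) ⊎ (Above t′ x × Above t′ y)
    place (tri< lt _ _) (x∈ , y∈) = inj₂ (inj₁ ((t , lt , x∈) , (t , lt , y∈)))
    place (tri≈ _ refl _) xy = inj₁ xy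
    place (tri> _ _ gt) (x∈ , y∈) = inj₂ (inj₂ ((t , gt , t≤K , x∈) , (t , gt , t≤K , y∈)))

  drop-edge : ∀ {E t u v} → ¬ (u ∈ bl t × v ∈ bl t) → Local (addEdge A u v) E t → Local A E t
  drop-edge {E} {t} {u} {v} apart (dom , conn) =
    (λ x x∈ → [ inj₁ , (λ { (y , y∈E , y∈ , a) → inj₂ (y , y∈E , y∈ , old x∈ y∈ a) }) ]′ (dom x x∈)) ,
    λ x y px py → reach-weaken id (λ p q a → old (proj₂ p) (proj₂ q) a) (conn x y px py)
    where
    old : ∀ {x y} → x ∈ bl t → y ∈ bl t → addEdge A u v x y ≡ true → A x y ≡ true
    old x∈ y∈ a with addEdge⁻ A u v a
    ... | inj₁ a′ = a′
    ... | inj₂ (inj₁ (refl , refl)) = ⊥-elim (apart (x∈ , y∈))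
    ... | inj₂ (inj₂ (refl , refl)) = ⊥-elim (apart (y∈ , x∈))

  private
    X-home : ∀ {t} → t ≤ K → ∀ {v} → v ∈ inner t → home v ≡ t
    X-home {t} t≤K {v} v∈ with inner⁻ v∈
    ... | v∈b , ¬cv = inner-unique (home≤ v) t≤K ¬cv (home∈ v) v∈b

    X-off : ∀ {t} (E : Subset n) → (∀ s → s < K → cv s ∈ E) → ∀ {v} → v ∉ inner t → home v ≡ t → v ∈ E
    X-off {t} E cvE {v} v∉ refl with isCv? v
    ... | yes (s , s<K , refl) = cvE s s<K
    ... | no ¬cv = ⊥-elim (v∉ (inner⁺ (home∈ v) ¬cv))

  opaque

    -- With D on block `t` and E on the others, the new edge is out of use, as u and v have no
    -- second block in common. The result is a set for G and has at least k > ∣E∣ vertices, so E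
    -- must be the smaller one inside block `t`.
    edge-gain : ∀ {t u v} → t ≤ K → u ∈ bl t → v ∈ bl t → u ≢ v → A u v ≡ false →
      Σ (Subset n) λ E → (∀ s → s < K → cv s ∈ E) × Local (addEdge A u v) E t × ∣ E ∩ inner t ∣ < ∣ D ∩ inner t ∣
    edge-gain {t} {u} {v} t≤K u∈ v∈ u≢v nonadj with proj₂ critical u v u≢v nonadj
    ... | E , cdsE , E<k = E , cvE , cds⇒local t≤K (fits′ t≤K) cdsE , +-cancelˡ-< k _ _ (begin-strict
          k + ∣ E ∩ inner t ∣         ≤⟨ +-monoˡ-≤ _ (minimal mix (mix-cds A-sym onL offL)) ⟩
          ∣ mix ∣ + ∣ E ∩ inner t ∣   ≤⟨ mix-card (inner t) (X-home t≤K) (λ x q _ → X-off E cvE x q) ⟩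
          ∣ E ∣ + ∣ D ∩ inner t ∣     <⟨ +-monoˡ-< _ E<k ⟩
          k + ∣ D ∩ inner t ∣         ∎)
      where
      open ≤-Reasoning
      fits′ : ∀ {t′} → t′ ≤ K → Fits (addEdge A u v) t′
      fits′ = fits-addEdge t≤K u∈ v∈
      cvE : ∀ s → s < K → cv s ∈ E
      cvE s s<K = cv∈CDS s<K (fits⇒sep (fits′ (<⇒≤ s<K))) cdsE
      open Mix (λ t′ → t′ ≟ℕ t) D E cvD (λ s s<K → inj₁ (cvE s s<K))
      onL : ∀ t′ → t′ ≤ K → t′ ≡ t → Local A D t′
      onL t′ t′≤K _ = cds⇒local t′≤K (fits t′≤K) cdsD
      offL : ∀ t′ → t′ ≤ K → t′ ≢ t → Local A E t′
      offL t′ t′≤K ne = drop-edge (λ { (u∈′ , v∈′) → u≢v (two-blocks t≤K t′≤K (ne ∘ sym) u∈ v∈ u∈′ v∈′) })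
        (cds⇒local t′≤K (fits′ t′≤K) cdsE)

  -- The opposite exchange: E on block `t`, D on the others. No set can do better than D inside a
  -- single block.
  local-minimal : ∀ {t} → t ≤ K → ∀ E → (∀ s → s < K → cv s ∈ E) → Local A E t →
                  ∣ D ∩ inner t ∣ ≤ ∣ E ∩ inner t ∣
  local-minimal {t} t≤K E cvE locE = +-cancelˡ-≤ k _ _ (begin
      k + ∣ D ∩ inner t ∣         ≤⟨ +-monoˡ-≤ _ (minimal mix (mix-cds A-sym onL offL)) ⟩
      ∣ mix ∣ + ∣ D ∩ inner t ∣   ≤⟨ mix-card (inner t) (X-home t≤K) (λ x q _ → X-off D cvD x q) ⟩
      ∣ D ∣ + ∣ E ∩ inner t ∣     ≡⟨ cong (_+ ∣ E ∩ inner t ∣) ∣D∣≡k ⟩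
      k + ∣ E ∩ inner t ∣         ∎)
    where
    open ≤-Reasoning
    open Mix (λ t′ → t′ ≟ℕ t) E D cvE (λ s s<K → inj₁ (cvD s s<K))
    onL : ∀ t′ → t′ ≤ K → t′ ≡ t → Local A E t′
    onL t′ t′≤K refl = locE
    offL : ∀ t′ → t′ ≤ K → t′ ≢ t → Local A D t′
    offL t′ t′≤K _ = cds⇒local t′≤K (fits t′≤K) cdsD

  -- In G + xz the vertex c can take over the role of x, so the edge xz brings no gain.
  not-dominated-by-cv : ∀ {s x y z} → s < K → Below (suc s) x → x ≢ cv s → A x (cv s) ≡ true →
    Above s z → z ≢ cv s → A (cv s) z ≡ true → (∀ w → A x w ≡ true → w ≡ cv s ⊎ A (cv s) w ≡ true) →
    Below (suc s) y → y ≢ cv s → y ≢ x → ⊥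
  not-dominated-by-cv {s} {x} {y} {z} s<K bx x≢c xc az z≢c cz nbrs by y≢c y≢x
    with A x z in xz
  ... | true with sep s<K x z xz
  ... | inj₁ (_ , bz) = z≢c (below∩above bz az)
  ... | inj₂ (ax , _) = x≢c (below∩above bx ax)
  not-dominated-by-cv {s} {x} {y} {z} s<K bx x≢c xc az z≢c cz nbrs by y≢c y≢x | false
    with proj₂ critical x z (λ { refl → x≢c (below∩above bx az) }) xz
  ... | E , (dom , conn) , E<k = contra
    where
    c : Fin n
    c = cv s
    A′ : RawAdj n
    A′ = addEdge A x z
    through : ∀ {v} → A′ v x ≡ true → v ≢ x → v ≡ c ⊎ A v c ≡ true
    through a v≢x with addEdge⁻ A x z a
    ... | inj₁ old = [ inj₁ , (λ b → inj₂ (flip-adj b)) ]′ (nbrs _ (flip-adj old))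
    ... | inj₂ (inj₁ (refl , _)) = ⊥-elim (v≢x refl)
    ... | inj₂ (inj₂ (refl , _)) = inj₂ (flip-adj cz)
    old-edge : ∀ {v w} → A′ v w ≡ true → v ≢ x → w ≢ x → A v w ≡ true
    old-edge a v≢x w≢x with addEdge⁻ A x z a
    ... | inj₁ old = old
    ... | inj₂ (inj₁ (p , _)) = ⊥-elim (v≢x p)
    ... | inj₂ (inj₂ (_ , q)) = ⊥-elim (w≢x q)

    with-c : c ∈ E → ⊥
    with-c c∈ = <⇒≱ E<k (minimal E (dom′ , λ u v u∈ v∈ → reach-bind detour (conn u v u∈ v∈)))
      where
      dom′ : Dominating A E
      dom′ v with dom v
      ... | inj₁ v∈ = inj₁ v∈
      ... | inj₂ (u , u∈ , a) with addEdge⁻ A x z a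
      ... | inj₁ old = inj₂ (u , u∈ , old)
      ... | inj₂ (inj₁ (refl , refl)) = inj₂ (c , c∈ , xc)
      ... | inj₂ (inj₂ (refl , refl)) = inj₂ (c , c∈ , flip-adj cz)
      detour : ∀ {u v} → u ∈ E → v ∈ E → A′ u v ≡ true → Reach A (_∈ E) u v
      detour u∈ v∈ a with addEdge⁻ A x z a
      ... | inj₁ old = reach-edge u∈ v∈ old
      ... | inj₂ (inj₁ (refl , refl)) = step u∈ xc (reach-edge c∈ v∈ cz)
      ... | inj₂ (inj₂ (refl , refl)) = step u∈ (flip-adj cz) (reach-edge c∈ v∈ (flip-adj xc))

    -- Exchange x for c. Every neighbour of x in G + xz is c or a neighbour of c in G, so sending x
    -- to c keeps the set dominating and connected, without the new edge.
    with-x : c ∉ E → x ∈ E → ⊥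
    with-x c∉ x∈ = <⇒≱ E<k (≤-trans (minimal E′ (dom′ , conn′)) card)
      where
      E′? : ∀ v → Dec (v ≡ c ⊎ (v ∈ E × v ≢ x))
      E′? v = (v ≟ c) ⊎-dec ((v ∈? E) ×-dec ¬? (v ≟ x))
      E′ : Subset n
      E′ = subset E′?
      c∈′ : c ∈ E′
      c∈′ = ∈-subset⁺ E′? (inj₁ refl)
      keep : ∀ {v} → v ∈ E → v ≢ x → v ∈ E′
      keep v∈ v≢x = ∈-subset⁺ E′? (inj₂ (v∈ , v≢x))
      origin : ∀ v → v ∈ E′ → ∃ λ w → w ∈ E × ((v ≡ c × w ≡ x) ⊎ (w ≡ v × v ≢ x))
      origin v v∈ with ∈-subset⁻ E′? v∈
      ... | inj₁ refl = x , x∈ , inj₁ (refl , refl)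
      ... | inj₂ (v∈E , v≢x) = v , v∈E , inj₂ (refl , v≢x)
      card : ∣ E′ ∣ ≤ ∣ E ∣
      card = injection⇒∣∣≤ E′ (λ v v∈ → index (proj₁ (proj₂ (origin v v∈))))
        λ v w v∈ w∈ eq → same (origin v v∈) (origin w w∈) (index-injective (proj₁ (proj₂ (origin v v∈))) _ eq)
        where
        same : ∀ {v w} (p : ∃ λ w′ → w′ ∈ E × ((v ≡ c × w′ ≡ x) ⊎ (w′ ≡ v × v ≢ x)))
                       (q : ∃ λ w′ → w′ ∈ E × ((w ≡ c × w′ ≡ x) ⊎ (w′ ≡ w × w ≢ x))) →
               proj₁ p ≡ proj₁ q → v ≡ w
        same (_ , _ , inj₁ (refl , _)) (_ , _ , inj₁ (refl , _)) _ = refl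
        same (_ , _ , inj₁ (_ , refl)) (_ , _ , inj₂ (refl , ne)) eq = ⊥-elim (ne (sym eq))
        same (_ , _ , inj₂ (refl , ne)) (_ , _ , inj₁ (_ , refl)) eq = ⊥-elim (ne eq)
        same (_ , _ , inj₂ (refl , _)) (_ , _ , inj₂ (refl , _)) eq = eq
      dom′ : Dominating A E′
      dom′ v with v ≟ x
      ... | yes refl = inj₂ (c , c∈′ , xc)
      ... | no v≢x with dom v
      ... | inj₁ v∈ = inj₁ (keep v∈ v≢x)
      ... | inj₂ (u , u∈ , a) = by-cases (u ≟ x)
        where
        by-cases : Dec (u ≡ x) → v ∈ E′ ⊎ Σ (Fin n) (λ u → u ∈ E′ × A v u ≡ true)
        by-cases (no u≢x) = inj₂ (u , keep u∈ u≢x , old-edge a v≢x u≢x)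
        by-cases (yes refl) with through a v≢x
        ... | inj₁ refl = inj₁ c∈′
        ... | inj₂ b = inj₂ (c , c∈′ , b)
      f : Fin n → Fin n
      f v with v ≟ x
      ... | yes _ = c
      ... | no _  = v
      f-x : f x ≡ c
      f-x with x ≟ x
      ... | yes _ = refl
      ... | no ne = ⊥-elim (ne refl)
      f-other : ∀ {v} → v ≢ x → f v ≡ v
      f-other {v} v≢x with v ≟ x
      ... | yes p = ⊥-elim (v≢x p)
      ... | no _ = refl
      f∈ : ∀ {v} → v ∈ E → f v ∈ E′
      f∈ {v} v∈ with v ≟ x
      ... | yes _ = c∈′
      ... | no v≢x = keep v∈ v≢x
      f-edge : ∀ {u v} → u ∈ E → v ∈ E → A′ u v ≡ true → f u ≡ f v ⊎ A (f u) (f v) ≡ true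
      f-edge {u} {v} u∈ v∈ a = by-cases (u ≟ x) (v ≟ x)
        where
        by-cases : Dec (u ≡ x) → Dec (v ≡ x) → f u ≡ f v ⊎ A (f u) (f v) ≡ true
        by-cases (yes refl) (yes refl) = inj₁ refl
        by-cases (no u≢x) (no v≢x) = inj₂ (trans (cong₂ A (f-other u≢x) (f-other v≢x)) (old-edge a u≢x v≢x))
        by-cases (no u≢x) (yes refl) rewrite f-x | f-other u≢x = through a u≢x
        by-cases (yes refl) (no v≢x) rewrite f-x | f-other v≢x
          with through (trans (addEdge-sym A x z A-sym v x) a) v≢x
        ... | inj₁ eq = inj₁ (sym eq)
        ... | inj₂ b = inj₂ (flip-adj b)
      lift : ∀ v → v ∈ E′ → ∃ λ w → w ∈ E × f w ≡ v
      lift v v∈ with ∈-subset⁻ E′? v∈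
      ... | inj₁ refl = x , x∈ , f-x
      ... | inj₂ (v∈E , v≢x) = v , v∈E , f-other v≢x
      conn′ : ConnectedOn A (_∈ E′)
      conn′ u v u∈ v∈ with lift u u∈ | lift v v∈
      ... | u′ , u′∈ , refl | v′ , v′∈ , refl = reach-map f f∈ f-edge (conn u′ v′ u′∈ v′∈)

    without : c ∉ E → x ∉ E → ⊥
    without c∉ x∉ = absurd lower upper
      where
      avoids : ∀ {v} → v ∈ E → v ≢ x
      avoids v∈ refl = x∉ v∈
      z≢x : z ≢ x
      z≢x refl = x≢c (below∩above bx az)
      lower : ∃ λ d → d ∈ E × Below (suc s) d
      lower with dom y
      ... | inj₁ y∈ = y , y∈ , by
      ... | inj₂ (d , d∈ , a) with sep s<K y d (old-edge a y≢x (avoids d∈))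
      ... | inj₁ (_ , b) = d , d∈ , b
      ... | inj₂ (ay , _) = ⊥-elim (y≢c (below∩above by ay))
      upper : ∃ λ d → d ∈ E × Above s d
      upper with dom z
      ... | inj₁ z∈ = z , z∈ , az
      ... | inj₂ (d , d∈ , a) with sep s<K z d (old-edge a z≢x (avoids d∈))
      ... | inj₁ (bz , _) = ⊥-elim (z≢c (below∩above bz az))
      ... | inj₂ (_ , b) = d , d∈ , b
      absurd : (∃ λ d → d ∈ E × Below (suc s) d) → (∃ λ d → d ∈ E × Above s d) → ⊥
      absurd (d , d∈ , bd) (d′ , d′∈ , ad′)
        with reach-cross (below? (suc s)) (conn d d′ d∈ d′∈) bd
               (λ b → c∉ (subst (_∈ E) (below∩above b ad′) d′∈))
      ... | a , b , a∈ , b∈ , qa , ¬qb , ab with sep s<K a b (old-edge ab (avoids a∈) (avoids b∈))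
      ... | inj₁ (_ , qb) = ¬qb qb
      ... | inj₂ (aa , _) = c∉ (subst (_∈ E) (below∩above qa aa) a∈)

    contra : ⊥
    contra with c ∈? E | x ∈? E
    ... | yes c∈ | _ = with-c c∈
    ... | no c∉ | yes x∈ = with-x c∉ x∈
    ... | no c∉ | no x∉ = without c∉ x∉

-- From block labelings to chains

module _ {n : ℕ} {A : RawAdj n} (A-sym : ∀ u v → A u v ≡ A v u) where

  nonsep-singleton : ∀ v → Nonsep A ⁅ v ⁆
  nonsep-singleton v = (v , x∈⁅x⁆ v) , conn , cut
    where
    conn : ConnectedOn A (_∈ ⁅ v ⁆)
    conn x y x∈ y∈ with x∈⁅y⁆⇒x≡y v x∈ | x∈⁅y⁆⇒x≡y v y∈
    ... | refl | refl = here x∈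
    cut : ∀ c → c ∈ ⁅ v ⁆ → ConnectedOn A (λ x → x ∈ ⁅ v ⁆ × x ≢ c)
    cut c c∈ x y (x∈ , x≢c) _ = ⊥-elim (x≢c (trans (x∈⁅y⁆⇒x≡y v x∈) (sym (x∈⁅y⁆⇒x≡y v c∈))))

  pair? : ∀ (u v : Fin n) x → Dec (x ≡ u ⊎ x ≡ v)
  pair? u v x = (x ≟ u) ⊎-dec (x ≟ v)

  nonsep-edge : ∀ {u v} → A u v ≡ true → Nonsep A (subset (pair? u v))
  nonsep-edge {u} {v} a = (u , u∈) , conn , cut
    where
    B : Subset n
    B = subset (pair? u v)
    u∈ : u ∈ B
    u∈ = ∈-subset⁺ (pair? u v) (inj₁ refl)
    v∈ : v ∈ B
    v∈ = ∈-subset⁺ (pair? u v) (inj₂ refl)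
    link : ∀ {P : Fin n → Set} x y → x ∈ B → y ∈ B → P x → P y → Reach A P x y
    link x y x∈ y∈ p q with ∈-subset⁻ (pair? u v) x∈ | ∈-subset⁻ (pair? u v) y∈
    ... | inj₁ refl | inj₁ refl = here p
    ... | inj₁ refl | inj₂ refl = reach-edge p q a
    ... | inj₂ refl | inj₁ refl = reach-edge p q (trans (A-sym _ _) a)
    ... | inj₂ refl | inj₂ refl = here p
    conn : ConnectedOn A (_∈ B)
    conn x y x∈ y∈ = link x y x∈ y∈ x∈ y∈
    cut : ∀ c → c ∈ B → ConnectedOn A (λ x → x ∈ B × x ≢ c)
    cut c c∈ x y p q = link x y (proj₁ p) (proj₁ q) p q

  nonsep-reach : ∀ {B} → Nonsep A B → ∀ c u v → u ∈ B → v ∈ B → u ≢ c → v ≢ c → Reach A (_≢ c) u v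
  nonsep-reach {B} (_ , conn , cut) c u v u∈ v∈ u≢c v≢c with c ∈? B
  ... | yes c∈ = reach-weaken proj₂ (λ _ _ a → a) (cut c c∈ u v (u∈ , u≢c) (v∈ , v≢c))
  ... | no c∉ = reach-weaken (λ { x∈ refl → c∉ x∈ }) (λ _ _ a → a) (conn u v u∈ v∈)

  reach-neighbour : ∀ {P w x} → Reach A P w x → x ≢ w → ∃ λ y → A w y ≡ true
  reach-neighbour (here _) ne = ⊥-elim (ne refl)
  reach-neighbour (step _ a _) _ = _ , a

  cds⇒neighbour : ∀ {D} → IsCDS A D → ∀ {w x} → x ≢ w → ∃ λ y → A w y ≡ true
  cds⇒neighbour {D} (dom , conn) {w} {x} x≢w with dom w
  ... | inj₂ (y , _ , a) = y , a
  ... | inj₁ w∈ with dom x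
  ... | inj₁ x∈ = reach-neighbour (conn w x w∈ x∈) x≢w
  ... | inj₂ (d , d∈ , a) with d ≟ w
  ... | yes refl = x , trans (A-sym _ _) a
  ... | no d≢w = reach-neighbour (conn w d w∈ d∈) d≢w

module LabelingChain {n κ : ℕ} (G : Graph n) (L : Labeling (4 + κ) (adj G))
                     {D : Subset n} (cdsD : IsCDS (adj G) D) where

  open Labeling L using (Bl; Bl-blk; Bl-all; cv-inj; cv-cut; cv-all; incid) renaming (cv to cut)

  K : ℕ
  K = suc κ

  A : RawAdj n
  A = adj G

  A-sym : ∀ u v → A u v ≡ A v u
  A-sym = adj-sym G

  bl : ℕ → Subset n
  bl t with t <? suc K
  ... | yes t< = Bl (fromℕ< t<)
  -- A default; the indices that matter satisfy `t ≤ K`.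
  ... | no _   = Bl zero

  cv : ℕ → Fin n
  cv s with s <? K
  ... | yes s< = cut (fromℕ< s<)
  ... | no _   = cut zero

  bl-toℕ : ∀ i → bl (toℕ i) ≡ Bl i
  bl-toℕ i with toℕ i <? suc K
  ... | yes i< = cong Bl (fromℕ<-toℕ i i<)
  ... | no i≮ = ⊥-elim (i≮ (toℕ<n i))

  cv-toℕ : ∀ i → cv (toℕ i) ≡ cut i
  cv-toℕ i with toℕ i <? K
  ... | yes i< = cong cut (fromℕ<-toℕ i i<)
  ... | no i≮ = ⊥-elim (i≮ (toℕ<n i))

  fin≤ : ∀ {t} → t ≤ K → ∃ λ i → toℕ {suc K} i ≡ t
  fin≤ t≤K = fromℕ< (s≤s t≤K) , toℕ-fromℕ< (s≤s t≤K)

  fin< : ∀ {s} → s < K → ∃ λ i → toℕ {K} i ≡ s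
  fin< s<K = fromℕ< s<K , toℕ-fromℕ< s<K

  cv-injective : ∀ {s s′} → s < K → s′ < K → cv s ≡ cv s′ → s ≡ s′
  cv-injective s<K s′<K eq with fin< s<K | fin< s′<K
  ... | i , refl | i′ , refl = cong toℕ (cv-inj (trans (sym (cv-toℕ i)) (trans eq (cv-toℕ i′))))

  cv-isCut : ∀ {s} → s < K → IsCut A (cv s)
  cv-isCut s<K with fin< s<K
  ... | i , refl = subst (IsCut A) (sym (cv-toℕ i)) (cv-cut i)

  isCut-cv : ∀ {v} → IsCut A v → ∃ λ s → s < K × v ≡ cv s
  isCut-cv {v} c with cv-all v c
  ... | i , refl = toℕ i , toℕ<n i , sym (cv-toℕ i)

  block : ∀ {t} → t ≤ K → IsBlock A (bl t)
  block t≤K with fin≤ t≤K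
  ... | i , refl = subst (IsBlock A) (sym (bl-toℕ i)) (Bl-blk i)

  nonsep : ∀ {t} → t ≤ K → Nonsep A (bl t)
  nonsep t≤K = proj₁ (block t≤K)

  nonsep⊆bl : ∀ B → Nonsep A B → ∃ λ t → t ≤ K × B ⊆ bl t
  nonsep⊆bl B ns with nonsep⊆block B ns
  ... | B′ , blk , B⊆B′ with Bl-all B′ blk
  ... | i , refl = toℕ i , s≤s⁻¹ (toℕ<n i) , λ x∈ → subst (_ ∈_) (sym (bl-toℕ i)) (B⊆B′ x∈)

  cv∈ : ∀ {s} → s < K → cv s ∈ bl s
  cv∈ {s} s<K with fin< s<K | fin≤ (<⇒≤ s<K)
  ... | i , refl | t , eq = subst (cv (toℕ i) ∈_) (cong bl eq)
          (subst (cv (toℕ i) ∈_) (sym (bl-toℕ t)) (subst (_∈ Bl t) (sym (cv-toℕ i)) (incid t i (inj₁ (sym eq)))))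

  cv∈′ : ∀ {s} → s < K → cv s ∈ bl (suc s)
  cv∈′ {s} s<K with fin< s<K | fin≤ s<K
  ... | i , refl | t , eq = subst (cv (toℕ i) ∈_) (cong bl eq)
          (subst (cv (toℕ i) ∈_) (sym (bl-toℕ t)) (subst (_∈ Bl t) (sym (cv-toℕ i)) (incid t i (inj₂ (sym eq)))))

  cover : ∀ v → ∃ λ t → t ≤ K × v ∈ bl t
  cover v with nonsep⊆bl ⁅ v ⁆ (nonsep-singleton A-sym v)
  ... | t , t≤K , sub = t , t≤K , sub (x∈⁅x⁆ v)

  edge : ∀ {u v} → A u v ≡ true → ∃ λ t → t ≤ K × u ∈ bl t × v ∈ bl t
  edge {u} {v} a with nonsep⊆bl _ (nonsep-edge A-sym a)
  ... | t , t≤K , sub = t , t≤K , sub (∈-subset⁺ (pair? A-sym u v) (inj₁ refl)) , sub (∈-subset⁺ (pair? A-sym u v) (inj₂ refl))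

  -- Single vertices count as nonseparable, so a block of one vertex has to be excluded: that vertex
  -- has a neighbour, and the edge is a larger nonseparable set.
  two : ∀ {t} → t ≤ K → ∀ v → ∃ λ w → w ∈ bl t × w ≢ v
  two {t} t≤K v with any? (λ w → (w ∈? bl t) ×-dec ¬? (w ≟ v))
  ... | yes p = p
  ... | no none with block t≤K
  ... | ((w , w∈) , _) , maximal = ⊥-elim contra
    where
    only-v : ∀ {x} → x ∈ bl t → x ≡ v
    only-v {x} x∈ = decidable-stable (x ≟ v) (λ x≢v → none (x , x∈ , x≢v))
    other : ∃ λ x → x ≢ v
    other with v ≟ cv 0
    ... | no v≢ = cv 0 , (v≢ ∘ sym)
    ... | yes refl with cv-isCut {0} (s≤s z≤n)
    ... | u , _ , u≢ , _ = u , u≢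
    contra : ⊥
    contra with cds⇒neighbour A-sym cdsD (proj₂ other)
    ... | y , vy = absurd (only-v y∈)
      where
      B : Subset n
      B = subset (pair? A-sym v y)
      B≡ : B ≡ bl t
      B≡ = maximal B (nonsep-edge A-sym vy) (λ x∈ → ∈-subset⁺ (pair? A-sym v y) (inj₁ (only-v x∈)))
      y∈ : y ∈ bl t
      y∈ = subst (y ∈_) B≡ (∈-subset⁺ (pair? A-sym v y) (inj₂ refl))
      absurd : y ≡ v → ⊥
      absurd refl with trans (sym vy) (adj-irrefl G y)
      ... | ()

  -- If block t ≤ s and block t′ > s shared a vertex other than c = cv s, then G − c would be connected.
  meet-at : ∀ {s t t′ v} → s < K → t ≤ s → s < t′ → t′ ≤ K → v ∈ bl t → v ∈ bl t′ → v ≡ cv s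
  meet-at {s} {t} {t′} {v} s<K t≤s s<t′ t′≤K v∈ v∈′ with v ≟ cv s
  ... | yes eq = eq
  ... | no v≢c with cv-isCut s<K
  ... | u₀ , w₀ , u₀≢c , w₀≢c , _ , apart =
          ⊥-elim (apart (reach-trans (toV u₀ u₀≢c) (reach-sym A-sym (toV w₀ w₀≢c))))
    where
    c : Fin n
    c = cv s
    inside-block : ∀ t → t ≤ K → ∀ u v → u ∈ bl t → v ∈ bl t → u ≢ c → v ≢ c → Reach A (_≢ c) u v
    inside-block t t≤K u v = nonsep-reach A-sym (nonsep t≤K) c u v
    low : ∀ t t′ → t ≤ t′ → t′ ≤ s → ∀ u v → u ∈ bl t → v ∈ bl t′ → u ≢ c → v ≢ c → Reach A (_≢ c) u v
    low t t′ t≤t′ t′≤s = chain-reach bl cv A (_≢ c) 0 s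
      (λ i _ i<s → (λ eq → <⇒≢ i<s (cv-injective (<-trans i<s s<K) s<K eq)) , cv∈ (<-trans i<s s<K) , cv∈′ (<-trans i<s s<K))
      (λ i _ i≤s → inside-block i (≤-trans i≤s (<⇒≤ s<K)))
      t t′ z≤n t≤t′ t′≤s
    high : ∀ t t′ → s < t → t ≤ t′ → t′ ≤ K → ∀ u v → u ∈ bl t → v ∈ bl t′ → u ≢ c → v ≢ c → Reach A (_≢ c) u v
    high t t′ s<t t≤t′ t′≤K = chain-reach bl cv A (_≢ c) (suc s) K
      (λ i s<i i<K → (λ eq → <⇒≢ s<i (cv-injective s<K i<K (sym eq))) , cv∈ i<K , cv∈′ i<K)
      (λ i _ i≤K → inside-block i i≤K)
      t t′ s<t t≤t′ t′≤K
    toV : ∀ x → x ≢ c → Reach A (_≢ c) x v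
    toV x x≢c with cover x
    ... | i , i≤K , x∈ with i ≤? s
    toV x x≢c | i , i≤K , x∈ | yes i≤s with ≤-total i t
    ... | inj₁ i≤t = low i t i≤t t≤s x v x∈ v∈ x≢c v≢c
    ... | inj₂ t≤i = reach-sym A-sym (low t i t≤i i≤s v x v∈ x∈ v≢c x≢c)
    toV x x≢c | i , i≤K , x∈ | no i≰s with ≤-total i t′
    ... | inj₁ i≤t′ = high i t′ (≰⇒> i≰s) i≤t′ t′≤K x v x∈ v∈′ x≢c v≢c
    ... | inj₂ t′≤i = reach-sym A-sym (high t′ i s<t′ t′≤i i≤K v x v∈′ x∈ v≢c x≢c)

  -- Blocks `t` and `t′` lie on different sides of `cv t` and also of the cut vertex just before
  -- `t′`. A common vertex equals both, so these two coincide and the blocks are consecutive.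
  meet : ∀ {t t′ v} → t < t′ → t′ ≤ K → v ∈ bl t → v ∈ bl t′ → t′ ≡ suc t × v ≡ cv t
  meet {t} {suc t″} {v} (s≤s t≤t″) t′≤K v∈ v∈′ = cong suc (sym t≡t″) , v≡
    where
    v≡ : v ≡ cv t
    v≡ = meet-at (<-≤-trans (s≤s t≤t″) t′≤K) ≤-refl (s≤s t≤t″) t′≤K v∈ v∈′
    t≡t″ : t ≡ t″
    t≡t″ = cv-injective (<-≤-trans (s≤s t≤t″) t′≤K) t′≤K
      (trans (sym v≡) (meet-at t′≤K t≤t″ ≤-refl t′≤K v∈ v∈′))

  chain : Chain n K
  chain = record { bl = bl ; cv = cv ; cv∈ = cv∈ ; cv∈′ = cv∈′ ; cover = cover ; meet = meet ; two = two }

-- Layerings over a cycle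

least-counterexample : ∀ {P : ℕ → Set} → (∀ i → Dec (P i)) → ∀ M →
  (∀ i → i < M → P i) ⊎ ∃ λ e → e < M × ¬ P e × (∀ i → i < e → P i)
least-counterexample P? zero = inj₁ λ _ ()
least-counterexample {P} P? (suc M) with least-counterexample P? M
... | inj₂ (e , e<M , ¬Pe , below) = inj₂ (e , m≤n⇒m≤1+n e<M , ¬Pe , below)
... | inj₁ all with P? M
... | no ¬PM = inj₂ (M , ≤-refl , ¬PM , all)
... | yes PM = inj₁ λ i i≤M → [ all i , (λ { refl → PM }) ]′ (m≤n⇒m<n∨m≡n (s≤s⁻¹ i≤M))

greatest-counterexample : ∀ {P : ℕ → Set} → (∀ i → Dec (P i)) → ∀ M →
  (∀ i → i < M → P i) ⊎ ∃ λ f → f < M × ¬ P f × (∀ i → f < i → i < M → P i)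
greatest-counterexample P? zero = inj₁ λ _ ()
greatest-counterexample {P} P? (suc M) with P? M
... | no ¬PM = inj₂ (M , ≤-refl , ¬PM , λ i M<i i≤M → ⊥-elim (<⇒≱ M<i (s≤s⁻¹ i≤M)))
... | yes PM with greatest-counterexample P? M
... | inj₁ all = inj₁ λ i i≤M → [ all i , (λ { refl → PM }) ]′ (m≤n⇒m<n∨m≡n (s≤s⁻¹ i≤M))
... | inj₂ (f , f<M , ¬Pf , above) =
        inj₂ (f , m≤n⇒m≤1+n f<M , ¬Pf , λ i f<i i≤M → [ above i f<i , (λ { refl → PM }) ]′ (m≤n⇒m<n∨m≡n (s≤s⁻¹ i≤M)))

-- Among the layers 0..M-1 this is distance at most one on a cycle of length M; `wrap` makes M - 1
-- and 0 neighbours.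
data Close (M : ℕ) : ℕ → ℕ → Set where
  same  : ∀ {a} → Close M a a
  up    : ∀ {a} → Close M a (suc a)
  down  : ∀ {a} → Close M (suc a) a
  wrap  : ∀ {a} → suc a ≡ M → Close M 0 a
  wrap′ : ∀ {a} → suc a ≡ M → Close M a 0

Close-sym : ∀ {M a b} → Close M a b → Close M b a
Close-sym same = same
Close-sym up = down
Close-sym down = up
Close-sym (wrap eq) = wrap′ eq
Close-sym (wrap′ eq) = wrap eq

module _ {n : ℕ} {A : RawAdj n} {D : Subset n} (M : ℕ) (g : Fin n → ℕ)
  (edges : ∀ {u v} → A u v ≡ true → Close M (g u) (g v))
  (conn : ConnectedOn A (_∈ D))
  (dom : ∀ i → i < M → ∃ λ d → d ∈ D × Close M i (g d)) where

  private
    Hit : ℕ → Set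
    Hit i = ∃ λ d → d ∈ D × g d ≡ i

    hit? : ∀ i → Dec (Hit i)
    hit? i = any? (λ d → (d ∈? D) ×-dec (g d ≟ℕ i))

    -- Let e and f be missed. If D avoids the layers strictly between them, nothing is close to
    -- layer e + 1. Otherwise D, being connected, is confined to these layers; then e and f can only
    -- be dominated from e + 1 and f - 1, and a path of D between those two passes every layer in
    -- between.
    between : ∀ {e f} → f < M → ¬ Hit e → ¬ Hit f → ∀ i → e < i → i < f → Hit i
    between {e} {f} f<M ¬e ¬f i e<i i<f with any? (λ d → (d ∈? D) ×-dec (e <? g d) ×-dec (g d <? f))
    ... | no none with dom (suc e) (<-trans (≤-<-trans e<i i<f) f<M)
    ... | d , d∈ , close = ⊥-elim (contra (g d) refl close)
      where
      contra : ∀ x → g d ≡ x → Close M (suc e) x → ⊥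
      contra _ eq same = none (d , d∈ , subst (e <_) (sym eq) ≤-refl , subst (_< f) (sym eq) (≤-<-trans e<i i<f))
      contra _ eq up with m≤n⇒m<n∨m≡n (<-≤-trans (s≤s e<i) i<f)
      ... | inj₁ lt = none (d , d∈ , subst (e <_) (sym eq) (n≤1+n _) , subst (_< f) (sym eq) lt)
      ... | inj₂ refl = ¬f (d , d∈ , eq)
      contra _ eq down = ¬e (d , d∈ , eq)
      contra _ eq (wrap′ refl) = <⇒≱ (≤-<-trans e<i i<f) (s≤s⁻¹ f<M)
    between {e} {f} f<M ¬e ¬f i e<i i<f | yes (d₀ , d₀∈ , e<d₀ , d₀<f) = decidable-stable (hit? i) contra
      where
      In : Fin n → Set
      In d = e < g d × g d < f
      in? : ∀ d → Dec (In d)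
      in? d = (e <? g d) ×-dec (g d <? f)
      leave : ∀ {x y} → Close M x y → e < x → x < f → ¬ (e < y × y < f) → y ≡ e ⊎ y ≡ f
      leave same p q r = ⊥-elim (r (p , q))
      leave up p q r with m≤n⇒m<n∨m≡n q
      ... | inj₁ lt = ⊥-elim (r (m≤n⇒m≤1+n p , lt))
      ... | inj₂ eq = inj₂ eq
      leave down p q r with m≤n⇒m<n∨m≡n p
      ... | inj₁ lt = ⊥-elim (r (s≤s⁻¹ lt , <-trans ≤-refl q))
      ... | inj₂ eq = inj₁ (sym (cong (_∸ 1) eq))
      leave (wrap′ refl) p q r = ⊥-elim (<⇒≱ q (s≤s⁻¹ f<M))
      all-in : ∀ d → d ∈ D → In d
      all-in d d∈ = decidable-stable (in? d) λ out →
        let (a , b , _ , b∈ , (ea , af) , ¬b , ab) = reach-cross in? (conn d₀ d d₀∈ d∈) (e<d₀ , d₀<f) out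
        in [ (λ eq → ¬e (b , b∈ , eq)) , (λ eq → ¬f (b , b∈ , eq)) ]′ (leave (edges ab) ea af ¬b)
      first : ∃ λ d → d ∈ D × g d ≡ suc e
      first with dom e (<-trans (<-trans e<i i<f) f<M)
      ... | d , d∈ , close = d , d∈ , lem close (all-in d d∈)
        where
        lem : ∀ {x} → Close M e x → e < x × x < f → x ≡ suc e
        lem same (p , _) = ⊥-elim (<-irrefl refl p)
        lem up _ = refl
        lem down (p , _) = ⊥-elim (<-asym p ≤-refl)
        lem (wrap refl) (_ , q) = ⊥-elim (<⇒≱ q (s≤s⁻¹ f<M))
      last : ∃ λ d → d ∈ D × suc (g d) ≡ f
      last with dom f f<M
      ... | d , d∈ , close = d , d∈ , lem close (all-in d d∈)
        where
        lem : ∀ {x} → Close M f x → e < x × x < f → suc x ≡ f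
        lem same (_ , q) = ⊥-elim (<-irrefl refl q)
        lem up (_ , q) = ⊥-elim (<-asym q ≤-refl)
        lem down _ = refl
        lem (wrap _) (_ , ())
      contra : ¬ ¬ Hit i
      contra ¬i with first | last
      ... | d₁ , d₁∈ , eq₁ | d₂ , d₂∈ , eq₂
        with reach-cross (λ d → g d <? i) (conn d₁ d₂ d₁∈ d₂∈) low high
        where
        low : g d₁ < i
        low = ≤∧≢⇒< (subst (_≤ i) (sym eq₁) e<i) (λ eq → ¬i (d₁ , d₁∈ , eq))
        high : ¬ g d₂ < i
        high lt = ¬i (d₂ , d₂∈ , ≤-antisym (<⇒≤ lt) (s≤s⁻¹ (subst (i <_) (sym eq₂) i<f)))
      ... | a , b , a∈ , b∈ , a<i , b≮i , ab = lem (edges ab) a<i (≮⇒≥ b≮i) (λ eq → ¬i (b , b∈ , eq)) (proj₂ (all-in b b∈))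
        where
        lem : ∀ {x y} → Close M x y → x < i → i ≤ y → y ≢ i → y < f → ⊥
        lem same p q _ _ = <⇒≱ p q
        lem up p q r _ = r (≤-antisym p q)
        lem down p q _ _ = <⇒≱ p (m≤n⇒m≤1+n q)
        lem (wrap refl) _ _ _ s = <⇒≱ s (s≤s⁻¹ f<M)
        lem (wrap′ _) _ q _ _ = <⇒≱ (≤-<-trans z≤n e<i) q

  opaque

    -- Let e be the least and f the greatest missed layer. Layers outside the interval are hit by
    -- this choice, those inside by `between`.
    cycle-hits : ∃ λ e → ∃ λ f → ∀ i → i < M → i ≢ e → i ≢ f → ∃ λ d → d ∈ D × g d ≡ i
    cycle-hits with least-counterexample hit? M | greatest-counterexample hit? M
    ... | inj₁ all | _ = 0 , 0 , λ i i<M _ _ → all i i<M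
    ... | inj₂ _ | inj₁ all = 0 , 0 , λ i i<M _ _ → all i i<M
    ... | inj₂ (e , _ , ¬e , below) | inj₂ (f , f<M , ¬f , above) = e , f , hits
      where
      hits : ∀ i → i < M → i ≢ e → i ≢ f → Hit i
      hits i i<M i≢e i≢f with <-cmp i e | <-cmp i f
      ... | tri< i<e _ _ | _ = below i i<e
      ... | tri≈ _ eq _ | _ = ⊥-elim (i≢e eq)
      ... | tri> _ _ e<i | tri< i<f _ _ = between f<M ¬e ¬f i e<i i<f
      ... | tri> _ _ _ | tri≈ _ eq _ = ⊥-elim (i≢f eq)
      ... | tri> _ _ _ | tri> _ _ f<i = above i f<i i<M

all-but-two-hits : ∀ {n} M (p : Subset n) (g : Fin n → ℕ) e f →
  (∀ i → i < M → i ≢ e → i ≢ f → ∃ λ d → d ∈ p × g d ≡ i) → M ≤ 2 + ∣ p ∣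
all-but-two-hits {n} M p g e f hit = injective⇒≤ {f = φ} φ-inj
  where
  code : ∀ (i : Fin M) → Dec (toℕ i ≡ e) → Dec (toℕ i ≡ f) → Fin (2 + ∣ p ∣)
  code i (yes _) _ = zero
  code i (no _) (yes _) = suc zero
  code i (no i≢e) (no i≢f) = suc (suc (index (proj₁ (proj₂ (hit (toℕ i) (toℕ<n i) i≢e i≢f)))))
  φ : Fin M → Fin (2 + ∣ p ∣)
  φ i = code i (toℕ i ≟ℕ e) (toℕ i ≟ℕ f)
  code-inj : ∀ i j de df de′ df′ → code i de df ≡ code j de′ df′ → toℕ i ≡ toℕ j
  code-inj i j (yes p) _ (yes q) _ _ = trans p (sym q)
  code-inj i j (no _) (yes p) (no _) (yes q) _ = trans p (sym q)
  code-inj i j (no a) (no b) (no c) (no d) eq =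
    trans (sym (proj₂ (proj₂ hi))) (trans (cong g same-d) (proj₂ (proj₂ hj)))
    where
    hi : ∃ λ d → d ∈ p × g d ≡ toℕ i
    hi = hit (toℕ i) (toℕ<n i) a b
    hj : ∃ λ d → d ∈ p × g d ≡ toℕ j
    hj = hit (toℕ j) (toℕ<n j) c d
    same-d : proj₁ hi ≡ proj₁ hj
    same-d = index-injective (proj₁ (proj₂ hi)) (proj₁ (proj₂ hj)) (suc-injective (suc-injective eq))
  code-inj i j (yes _) _ (no _) (yes _) ()
  code-inj i j (yes _) _ (no _) (no _) ()
  code-inj i j (no _) (yes _) (yes _) _ ()
  code-inj i j (no _) (yes _) (no _) (no _) ()
  code-inj i j (no _) (no _) (yes _) _ ()
  code-inj i j (no _) (no _) (no _) (yes _) ()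
  φ-inj : Injective _≡_ _≡_ φ
  φ-inj {i} {j} eq = toℕ-injective (code-inj i j _ _ _ _ eq)

-- Shapes of the blocks before the last one

module BlockShapes {n K : ℕ} (G : Graph n) (C : Chain n K)
  (edge : ∀ {u v} → adj G u v ≡ true → ∃ λ t → t ≤ K × u ∈ Chain.bl C t × v ∈ Chain.bl C t)
  (nonsep : ∀ {t} → t ≤ K → Nonsep (adj G) (Chain.bl C t))
  {k : ℕ} (critical : Critical G k) (D : Subset n) (cdsD : IsCDS (adj G) D) (∣D∣≡k : ∣ D ∣ ≡ k) where

  open Chain C
  open ChainCDS C
  open CriticalChain G C edge nonsep critical D cdsD ∣D∣≡k

  irreflexive : ∀ {u v} → A u v ≡ true → u ≢ v
  irreflexive a refl with trans (sym a) (adj-irrefl G _)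
  ... | ()

  opaque

    neighbour-in-block : ∀ {t u} → t ≤ K → u ∈ bl t → ∃ λ z → z ∈ bl t × A u z ≡ true
    neighbour-in-block {t} {u} t≤K u∈ with two t≤K u
    ... | w , w∈ , w≢u = first (proj₁ (proj₂ (nonsep t≤K)) u w u∈ w∈) w≢u
      where
      first : ∀ {w} → Reach A (_∈ bl t) u w → w ≢ u → ∃ λ z → z ∈ bl t × A u z ≡ true
      first (here _) ne = ⊥-elim (ne refl)
      first (step _ a r) _ = _ , reach-start r , a

  second-neighbour-in-block : ∀ {t u w d} → t ≤ K → u ∈ bl t → w ∈ bl t → d ∈ bl t → u ≢ d → w ≢ d → w ≢ u →
                              ∃ λ z → z ∈ bl t × z ≢ d × A u z ≡ true
  second-neighbour-in-block {t} {u} {w} {d} t≤K u∈ w∈ d∈ u≢d w≢d w≢u =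
    first (proj₂ (proj₂ (nonsep t≤K)) d d∈ u w (u∈ , u≢d) (w∈ , w≢d)) w≢u
    where
    first : ∀ {w} → Reach A (λ x → x ∈ bl t × x ≢ d) u w → w ≢ u → ∃ λ z → z ∈ bl t × z ≢ d × A u z ≡ true
    first (here _) ne = ⊥-elim (ne refl)
    first (step _ a r) _ = _ , proj₁ (reach-start r) , proj₂ (reach-start r) , a

  opaque

    cv-block : ∀ {s t} → s < K → t ≤ K → cv s ∈ bl t → t ≡ s ⊎ t ≡ suc s
    cv-block {s} {t} s<K t≤K c∈ with <-cmp t s
    ... | tri≈ _ eq _ = inj₁ eq
    ... | tri> _ _ s<t = inj₂ (proj₁ (meet s<t t≤K (cv∈ s<K) c∈))
    ... | tri< t<s _ _ with meet (m≤n⇒m≤1+n t<s) s<K c∈ (cv∈′ s<K)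
    ... | eq , _ = ⊥-elim (<-irrefl (sym (cong (_∸ 1) eq)) t<s)

  edge-in-block : ∀ {t u v} → t ≤ K → u ∈ bl t → ¬ IsCv u → A u v ≡ true → v ∈ bl t
  edge-in-block {t} {u} {v} t≤K u∈ ¬cv a with fits t≤K u v a
  ... | inj₁ (_ , v∈) = v∈
  ... | inj₂ (inj₁ ((i , i<t , u∈i) , _)) =
          ⊥-elim (¬cv (i , <-≤-trans i<t t≤K , proj₂ (meet i<t t≤K u∈i u∈)))
  ... | inj₂ (inj₂ ((i , t<i , i≤K , u∈i) , _)) =
          ⊥-elim (¬cv (t , <-≤-trans t<i i≤K , proj₂ (meet t<i i≤K u∈ u∈i)))

  complete : ∀ {t} → t ≤ K → ∣ D ∩ inner t ∣ ≤ 0 → ∀ {u v} → u ∈ bl t → v ∈ bl t → u ≢ v → A u v ≡ true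
  complete {t} t≤K none {u} {v} u∈ v∈ u≢v with A u v in eq
  ... | true = refl
  ... | false with edge-gain t≤K u∈ v∈ u≢v eq
  ... | _ , _ , _ , lt with ≤-trans lt none
  ... | ()

  opaque

    -- The vertex `y` may be the cut vertex before the block. Hence a middle block of this kind has
    -- no vertices but its two cut vertices, while block 0 has exactly one besides `cv 0`.
    thin : ∀ {t} → t < K → ∣ D ∩ inner t ∣ ≤ 0 → ∀ {x y} → x ∈ bl t → x ≢ cv t → (∀ s → suc s ≡ t → x ≢ cv s) →
           y ∈ bl t → y ≢ cv t → y ≡ x
    thin {t} t<K none {x} {y} x∈ x≢c x≢p y∈ y≢c with y ≟ x
    ... | yes eq = eq
    ... | no y≢x with neighbour-in-block t<K (cv∈′ t<K)
    ... | z , z∈ , cz = ⊥-elim (not-dominated-by-cv t<K (t , ≤-refl , x∈) x≢c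
            (complete (<⇒≤ t<K) none x∈ (cv∈ t<K) x≢c)
            (suc t , ≤-refl , t<K , z∈) (irreflexive cz ∘ sym) cz nbrs
            (t , ≤-refl , y∈) y≢c y≢x)
      where
      ¬cv : ¬ IsCv x
      ¬cv (s , s<K , refl) with cv-block s<K (<⇒≤ t<K) x∈
      ... | inj₁ refl = x≢c refl
      ... | inj₂ refl = x≢p s refl refl
      nbrs : ∀ w → A x w ≡ true → w ≡ cv t ⊎ A (cv t) w ≡ true
      nbrs w a with w ≟ cv t
      ... | yes eq = inj₁ eq
      ... | no w≢c = inj₂ (complete (<⇒≤ t<K) none (cv∈ t<K) (edge-in-block (<⇒≤ t<K) x∈ ¬cv a) (w≢c ∘ sym))

  opaque

    thin-middle : ∀ {s} → suc s < K → ∣ D ∩ inner (suc s) ∣ ≤ 0 → ∀ {x} → x ∈ bl (suc s) → x ≡ cv s ⊎ x ≡ cv (suc s)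
    thin-middle {s} s<K none {x} x∈ with x ≟ cv s | x ≟ cv (suc s)
    ... | yes p | _ = inj₁ p
    ... | no _ | yes q = inj₂ q
    ... | no x≢p | no x≢c = ⊥-elim (x≢p (sym (thin s<K none x∈ x≢c (λ { .s refl → x≢p })
            (cv∈′ (<-trans ≤-refl s<K)) (λ eq → c≢ eq))))
      where
      c≢ : cv s ≢ cv (suc s)
      c≢ eq with cv-block s<K (<⇒≤ (<-trans ≤-refl s<K)) (subst (_∈ bl s) eq (cv∈ (<-trans ≤-refl s<K)))
      ... | inj₁ p = <-irrefl p ≤-refl
      ... | inj₂ p = <-irrefl p (m≤n⇒m≤1+n ≤-refl)

  cv-injective : ∀ {s s′} → s < K → s′ < K → cv s ≡ cv s′ → s ≡ s′
  cv-injective {s} {s′} s<K s′<K eq with <-cmp s s′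
  ... | tri≈ _ p _ = p
  ... | tri< lt _ _ with meet (m≤n⇒m≤1+n lt) s′<K (cv∈ s<K) (subst (_∈ bl (suc s′)) (sym eq) (cv∈′ s′<K))
  ... | p , _ = ⊥-elim (<-irrefl (sym (cong (_∸ 1) p)) lt)
  cv-injective {s} {s′} s<K s′<K eq | tri> _ _ gt
    with meet (m≤n⇒m≤1+n gt) s<K (cv∈ s′<K) (subst (_∈ bl (suc s)) eq (cv∈′ s<K))
  ... | p , _ = ⊥-elim (<-irrefl (sym (cong (_∸ 1) p)) gt)

  module OneInside {j : ℕ} (j<K : j < K) (atMost : ∣ D ∩ inner j ∣ ≤ 1) (atLeast : 1 ≤ ∣ D ∩ inner j ∣) where

    j≤K : j ≤ K
    j≤K = <⇒≤ j<K

    record Gain (u v : Fin n) : Set where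
      field
        E     : Subset n
        cvE   : ∀ s → s < K → cv s ∈ E
        local : Local (addEdge A u v) E j
        onlyCv : ∀ {x} → x ∈ E → x ∈ bl j → IsCv x

    gain : ∀ {u v} → u ∈ bl j → v ∈ bl j → u ≢ v → A u v ≡ false → Gain u v
    gain u∈ v∈ u≢v a with edge-gain j≤K u∈ v∈ u≢v a
    ... | E , cvE , loc , lt = record
      { E = E ; cvE = cvE ; local = loc
      ; onlyCv = λ {x} x∈E x∈ → decidable-stable (isCv? x) λ ¬cv →
          ∣p∣≡0⇒∉ (E ∩ inner j) (s≤s⁻¹ (≤-trans lt atMost)) (x∈p∩q⁺ (x∈E , inner⁺ x∈ ¬cv)) }

    Undominated : Fin n → Set
    Undominated m = m ∈ bl j × ¬ IsCv m × (∀ s → s < K → cv s ∈ bl j → A m (cv s) ≡ false)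

    cvs : Subset n
    cvs = subset isCv?

    -- Otherwise the cut vertices of the block, connected by assumption, would serve it alone,
    -- although D cannot do without an inner vertex there.
    undominated : ConnectedOn A (λ x → x ∈ cvs × x ∈ bl j) → ∃ Undominated
    undominated conn with any? (λ m → (m ∈? bl j) ×-dec ¬? (isCv? m) ×-dec
                               ¬? (anyUpTo? (λ s → (cv s ∈? bl j) ×-dec (A m (cv s) Bool.≟ true)) K))
    ... | yes (m , m∈ , ¬cv , ¬dom) = m , m∈ , ¬cv , λ s s<K s∈ → Bool.¬-not (λ a → ¬dom (s , s<K , s∈ , a))
    ... | no none = ⊥-elim (<⇒≱ (≤-<-trans (local-minimal j≤K cvs (λ s s<K → ∈-subset⁺ isCv? (s , s<K , refl)) (dom , conn))
                                 (s≤s (empty⇒∣∣≤0 (cvs ∩ inner j) empty))) atLeast)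
      where
      dom : ∀ v → v ∈ bl j → v ∈ cvs ⊎ ∃ λ u → u ∈ cvs × u ∈ bl j × A v u ≡ true
      dom v v∈ with isCv? v
      ... | yes cv′ = inj₁ (∈-subset⁺ isCv? cv′)
      ... | no ¬cv with anyUpTo? (λ s → (cv s ∈? bl j) ×-dec (A v (cv s) Bool.≟ true)) K
      ... | yes (s , s<K , s∈ , a) = inj₂ (cv s , ∈-subset⁺ isCv? (s , s<K , refl) , s∈ , a)
      ... | no ¬dom = ⊥-elim (none (v , v∈ , ¬cv , ¬dom))
      empty : ∀ {x} → x ∉ cvs ∩ inner j
      empty x∈ with x∈p∩q⁻ cvs (inner j) x∈
      ... | p , q = proj₂ (inner⁻ q) (∈-subset⁻ isCv? p)

    -- In G + uv the cut vertices alone serve the block, so one of them dominates m. In G none does;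
    -- hence the new edge joins m to a cut vertex.
    nonadjacent-undominated : ∀ {m} → Undominated m → ∀ {u v} → u ∈ bl j → v ∈ bl j → u ≢ v → A u v ≡ false →
                              (u ≡ m × IsCv v) ⊎ (v ≡ m × IsCv u)
    nonadjacent-undominated {m} (m∈ , ¬cv , ¬dom) {u} {v} u∈ v∈ u≢v a = lem (proj₁ local m m∈)
      where
      open Gain (gain u∈ v∈ u≢v a)
      lem : m ∈ E ⊎ (∃ λ x → x ∈ E × x ∈ bl j × addEdge A u v m x ≡ true) → (u ≡ m × IsCv v) ⊎ (v ≡ m × IsCv u)
      lem (inj₁ m∈E) = ⊥-elim (¬cv (onlyCv m∈E m∈))
      lem (inj₂ (x , x∈E , x∈ , b)) with onlyCv x∈E x∈ | addEdge⁻ A u v b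
      ... | s , s<K , refl | inj₁ old with trans (sym old) (¬dom s s<K x∈)
      ... | ()
      lem (inj₂ (x , x∈E , x∈ , b)) | cv′ | inj₂ (inj₁ (refl , refl)) = inj₁ (refl , cv′)
      lem (inj₂ (x , x∈E , x∈ , b)) | cv′ | inj₂ (inj₂ (refl , refl)) = inj₂ (refl , cv′)

  -- The two cut vertices of a middle block are not adjacent: otherwise joining the vertex m that both miss to
  -- the end c₀ of the graph closes a cycle, and no vertex is gained.
  module TooClose {i : ℕ} (j<K : suc i < K)
    (atMost : ∣ D ∩ inner (suc i) ∣ ≤ 1) (atLeast : 1 ≤ ∣ D ∩ inner (suc i) ∣)
    (none : ∀ t → t < suc i → ∣ D ∩ inner t ∣ ≤ 0)
    (close : A (cv i) (cv (suc i)) ≡ true) where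

    open OneInside j<K atMost atLeast

    j : ℕ
    j = suc i

    a c : Fin n
    a = cv i
    c = cv j

    i<K : i < K
    i<K = <-trans ≤-refl j<K

    cv-in-j : ∀ {x} → IsCv x → x ∈ bl j → x ≡ a ⊎ x ≡ c
    cv-in-j (s , s<K , refl) x∈ with cv-block s<K j≤K x∈
    ... | inj₁ refl = inj₂ refl
    ... | inj₂ refl = inj₁ refl

    opaque

      m-exists : ∃ Undominated
      m-exists = undominated λ { x y (x∈ , x∈b) (y∈ , y∈b) →
          link (cv-in-j (∈-subset⁻ isCv? x∈) x∈b) (cv-in-j (∈-subset⁻ isCv? y∈) y∈b) (x∈ , x∈b) (y∈ , y∈b) }
        where
        link : ∀ {P : Fin n → Set} {x y} → x ≡ a ⊎ x ≡ c → y ≡ a ⊎ y ≡ c → P x → P y → Reach A P x y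
        link (inj₁ refl) (inj₁ refl) p q = here p
        link (inj₁ refl) (inj₂ refl) p q = reach-edge p q close
        link (inj₂ refl) (inj₁ refl) p q = reach-edge p q (flip-adj close)
        link (inj₂ refl) (inj₂ refl) p q = here p

    m : Fin n
    m = proj₁ m-exists

    m∈ : m ∈ bl j
    m∈ = proj₁ (proj₂ m-exists)

    m-¬cv : ¬ IsCv m
    m-¬cv = proj₁ (proj₂ (proj₂ m-exists))

    m≁cv : ∀ {s} → s < K → A m (cv s) ≡ true → ⊥
    m≁cv s<K e with trans (sym e) (proj₂ (proj₂ (proj₂ m-exists)) _ s<K (edge-in-block j≤K m∈ m-¬cv e))
    ... | ()

    opaque

      c₀-exists : ∃ λ w → w ∈ bl 0 × w ≢ cv 0
      c₀-exists = two z≤n (cv 0)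

    c₀ : Fin n
    c₀ = proj₁ c₀-exists

    c₀∈ : c₀ ∈ bl 0
    c₀∈ = proj₁ (proj₂ c₀-exists)

    c₀≢ : c₀ ≢ cv 0
    c₀≢ = proj₂ (proj₂ c₀-exists)

    0<K : 0 < K
    0<K = ≤-<-trans z≤n j<K

    bl0 : ∀ {v} → v ∈ bl 0 → v ≡ cv 0 ⊎ v ≡ c₀
    bl0 {v} v∈ with v ≟ cv 0
    ... | yes eq = inj₁ eq
    ... | no v≢ = inj₂ (thin 0<K (none 0 (s≤s z≤n)) c₀∈ c₀≢ (λ _ ()) v∈ v≢)

    c₀≢cv : ∀ {s} → s < K → c₀ ≢ cv s
    c₀≢cv s<K eq with cv-block s<K z≤n (subst (_∈ bl 0) eq c₀∈)
    ... | inj₁ refl = c₀≢ eq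

    c₀∉ : ∀ {t} → 0 < t → t ≤ K → c₀ ∉ bl t
    c₀∉ 0<t t≤K c∈ = c₀≢ (proj₂ (meet 0<t t≤K c₀∈ c∈))

    m∉ : ∀ {t} → t ≤ K → t ≢ j → m ∉ bl t
    m∉ t≤K t≢j m∈t = t≢j (inner-unique t≤K j≤K m-¬cv m∈t m∈)

    c₀≢m : c₀ ≢ m
    c₀≢m eq = m∉ z≤n (λ ()) (subst (_∈ bl 0) eq c₀∈)

    c₀≁m : A c₀ m ≡ false
    c₀≁m = Bool.¬-not λ e → m∉ z≤n (λ ()) (edge-in-block z≤n c₀∈ (λ { (s , s<K , eq) → c₀≢cv s<K eq }) e)

    belowC₀ : ∀ {s} → Below (suc s) c₀
    belowC₀ = 0 , s≤s z≤n , c₀∈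

    belowM : ∀ {s} → j ≤ s → Below (suc s) m
    belowM j≤s = j , s≤s j≤s , m∈

    A′ : RawAdj n
    A′ = addEdge A c₀ m

    opaque

      gained : Σ (Subset n) λ E → IsCDS A′ E × ∣ E ∣ < k
      gained = proj₂ critical c₀ m c₀≢m c₀≁m

    E : Subset n
    E = proj₁ gained

    cdsE : IsCDS A′ E
    cdsE = proj₁ (proj₂ gained)

    sep′ : ∀ {s} → j ≤ s → s < K → Sep A′ s
    sep′ j≤s s<K u v e with addEdge⁻ A c₀ m e
    ... | inj₁ old = sep s<K u v old
    ... | inj₂ (inj₁ (refl , refl)) = inj₁ (belowC₀ , belowM j≤s)
    ... | inj₂ (inj₂ (refl , refl)) = inj₁ (belowM j≤s , belowC₀)

    fits′ : ∀ {t} → j < t → t ≤ K → Fits A′ t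
    fits′ {suc t} (s≤s j≤t) t≤K u v e with addEdge⁻ A c₀ m e
    ... | inj₁ old = fits t≤K u v old
    ... | inj₂ (inj₁ (refl , refl)) = inj₂ (inj₁ (belowC₀ , belowM j≤t))
    ... | inj₂ (inj₂ (refl , refl)) = inj₂ (inj₁ (belowM j≤t , belowC₀))

    cvE : ∀ {s} → j ≤ s → s < K → cv s ∈ E
    cvE j≤s s<K = cv∈CDS s<K (sep′ j≤s s<K) cdsE

    c∈E : c ∈ E
    c∈E = cvE ≤-refl j<K

    left? : ∀ v → Dec (Below (suc j) v × v ≢ c)
    left? v = below? (suc j) v ×-dec ¬? (v ≟ c)

    X : Subset n
    X = subset left?

    -- The cyclic order in G + c₀m: c₀, the cut vertices up to a in layer j, the other inner
    -- vertices of block j, then m, which is now next to c₀. Everything from c on shares the layer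
    -- `x₀`. To its left c sees only a and inner vertices other than m, so layers j and j + 1 are
    -- both possible for it.
    data Place (x₀ : ℕ) : Fin n → ℕ → Set where
      end   : Place x₀ c₀ 0
      cut   : ∀ {s} → s < j → Place x₀ (cv s) (suc s)
      mid   : ∀ {v} → v ∈ bl j → ¬ IsCv v → v ≢ m → Place x₀ v (suc j)
      far   : Place x₀ m (suc (suc j))
      right : ∀ {v t} → j < t → t ≤ K → v ∈ bl t → Place x₀ v x₀

    opaque

      place-in : ∀ x₀ {t v} → t ≤ K → v ∈ bl t → ∃ (Place x₀ v)
      place-in x₀ {t} {v} t≤K v∈ with <-cmp t j
      ... | tri> _ _ gt = x₀ , right gt t≤K v∈
      place-in x₀ {zero} {v} t≤K v∈ | tri< lt _ _ with bl0 v∈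
      ... | inj₁ refl = 1 , cut lt
      ... | inj₂ refl = 0 , end
      place-in x₀ {suc t} {v} t≤K v∈ | tri< lt _ _ with thin-middle (<-trans lt j<K) (none (suc t) lt) v∈
      ... | inj₁ refl = suc t , cut (<-trans ≤-refl lt)
      ... | inj₂ refl = suc (suc t) , cut lt
      place-in x₀ {t} {v} t≤K v∈ | tri≈ _ refl _ with isCv? v
      ... | yes cv′ with cv-in-j cv′ v∈
      ... | inj₁ refl = suc i , cut ≤-refl
      ... | inj₂ refl = x₀ , right ≤-refl j<K (cv∈′ j<K)
      place-in x₀ {t} {v} t≤K v∈ | tri≈ _ refl _ | no ¬cv with v ≟ m
      ... | yes refl = suc (suc j) , far
      ... | no v≢m = suc j , mid v∈ ¬cv v≢m

    opaque

      place-unique : ∀ {x₀ v x y} → Place x₀ v x → Place x₀ v y → x ≡ y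
      place-unique p q = lem p q refl
        where
        cut-right : ∀ {s t} → s < j → j < t → t ≤ K → cv s ∈ bl t → ⊥
        cut-right s<j j<t t≤K v∈ with cv-block (<-trans s<j j<K) t≤K v∈
        ... | inj₁ refl = <-asym s<j j<t
        ... | inj₂ refl = <⇒≱ s<j (s≤s⁻¹ j<t)
        lem : ∀ {x₀ v w x y} → Place x₀ v x → Place x₀ w y → v ≡ w → x ≡ y
        lem end end _ = refl
        lem end (cut s<j) eq = ⊥-elim (c₀≢cv (<-trans s<j j<K) eq)
        lem end (mid v∈ _ _) refl = ⊥-elim (c₀∉ (s≤s z≤n) j≤K v∈)
        lem end far eq = ⊥-elim (c₀≢m eq)
        lem end (right j<t t≤K v∈) refl = ⊥-elim (c₀∉ (≤-<-trans z≤n j<t) t≤K v∈)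
        lem (cut s<j) end eq = ⊥-elim (c₀≢cv (<-trans s<j j<K) (sym eq))
        lem (cut s<j) (cut s′<j) eq = cong suc (cv-injective (<-trans s<j j<K) (<-trans s′<j j<K) eq)
        lem (cut s<j) (mid _ ¬cv _) refl = ⊥-elim (¬cv (_ , <-trans s<j j<K , refl))
        lem (cut s<j) far eq = ⊥-elim (m-¬cv (_ , <-trans s<j j<K , sym eq))
        lem (cut s<j) (right j<t t≤K v∈) refl = ⊥-elim (cut-right s<j j<t t≤K v∈)
        lem (mid v∈ _ _) end refl = ⊥-elim (c₀∉ (s≤s z≤n) j≤K v∈)
        lem (mid _ ¬cv _) (cut s<j) refl = ⊥-elim (¬cv (_ , <-trans s<j j<K , refl))
        lem (mid _ _ _) (mid _ _ _) _ = refl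
        lem (mid _ _ v≢m) far eq = ⊥-elim (v≢m eq)
        lem (mid v∈ ¬cv _) (right j<t t≤K v∈′) refl = ⊥-elim (<⇒≢ j<t (inner-unique j≤K t≤K ¬cv v∈ v∈′))
        lem far end eq = ⊥-elim (c₀≢m (sym eq))
        lem far (cut s<j) eq = ⊥-elim (m-¬cv (_ , <-trans s<j j<K , eq))
        lem far (mid _ _ v≢m) eq = ⊥-elim (v≢m (sym eq))
        lem far far _ = refl
        lem far (right j<t t≤K v∈) refl = ⊥-elim (m∉ t≤K (λ eq → <⇒≢ j<t (sym eq)) v∈)
        lem (right j<t t≤K v∈) end refl = ⊥-elim (c₀∉ (≤-<-trans z≤n j<t) t≤K v∈)
        lem (right j<t t≤K v∈) (cut s<j) refl = ⊥-elim (cut-right s<j j<t t≤K v∈)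
        lem (right j<t t≤K v∈) (mid v∈′ ¬cv _) refl = ⊥-elim (<⇒≢ j<t (inner-unique j≤K t≤K ¬cv v∈′ v∈))
        lem (right j<t t≤K v∈) far refl = ⊥-elim (m∉ t≤K (λ eq → <⇒≢ j<t (sym eq)) v∈)
        lem (right _ _ _) (right _ _ _) _ = refl

    -- The layer of everything from c on may be chosen as that of a or that of the middle vertices.
    module Layers (x₀ : ℕ) (x₀-ok : x₀ ≡ j ⊎ x₀ ≡ suc j) where

      M : ℕ
      M = suc (suc (suc j))

      g : Fin n → ℕ
      g v = proj₁ (place-in x₀ (home≤ v) (home∈ v))

      g-place : ∀ {v x} → Place x₀ v x → g v ≡ x
      g-place {v} p = place-unique (proj₂ (place-in x₀ (home≤ v) (home∈ v))) p

      place : ∀ v → Place x₀ v (g v)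
      place v = proj₂ (place-in x₀ (home≤ v) (home∈ v))

      as : ∀ {v w x y} → Place x₀ v x → Place x₀ w y → Close M x y → Close M (g v) (g w)
      as p q cl rewrite g-place p | g-place q = cl

      mid-x₀ : Close M (suc j) x₀
      mid-x₀ = [ (λ eq → subst (Close M (suc j)) (sym eq) down) , (λ eq → subst (Close M (suc j)) (sym eq) same) ]′ x₀-ok

      a-x₀ : Close M j x₀
      a-x₀ = [ (λ eq → subst (Close M j) (sym eq) same) , (λ eq → subst (Close M j) (sym eq) up) ]′ x₀-ok

      block-edge : ∀ {t u v} → t ≤ K → u ∈ bl t → v ∈ bl t → A u v ≡ true → Close M (g u) (g v)
      block-edge {t} {u} {v} t≤K u∈ v∈ e with <-cmp t j
      ... | tri> _ _ gt = as (right gt t≤K u∈) (right gt t≤K v∈) same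
      block-edge {zero} {u} {v} t≤K u∈ v∈ e | tri< lt _ _ with bl0 u∈ | bl0 v∈
      ... | inj₁ refl | inj₁ refl = same
      ... | inj₁ refl | inj₂ refl = as (cut lt) end down
      ... | inj₂ refl | inj₁ refl = as end (cut lt) up
      ... | inj₂ refl | inj₂ refl = same
      block-edge {suc t} {u} {v} t≤K u∈ v∈ e | tri< lt _ _
        with thin-middle (<-trans lt j<K) (none (suc t) lt) u∈ | thin-middle (<-trans lt j<K) (none (suc t) lt) v∈
      ... | inj₁ refl | inj₁ refl = same
      ... | inj₁ refl | inj₂ refl = as (cut (<-trans ≤-refl lt)) (cut lt) up
      ... | inj₂ refl | inj₁ refl = as (cut lt) (cut (<-trans ≤-refl lt)) down
      ... | inj₂ refl | inj₂ refl = same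
      block-edge {t} {u} {v} t≤K u∈ v∈ e | tri≈ _ refl _ = in-j (kind u∈) (kind v∈)
        where
        data Kind : Fin n → Set where
          isA : Kind a
          isC : Kind c
          isM : Kind m
          isX : ∀ {v} → v ∈ bl j → ¬ IsCv v → v ≢ m → Kind v
        kind : ∀ {v} → v ∈ bl j → Kind v
        kind {v} v∈ with isCv? v | v ≟ m
        ... | no ¬cv | yes refl = isM
        ... | no ¬cv | no v≢m = isX v∈ ¬cv v≢m
        ... | yes cv′ | _ with cv-in-j cv′ v∈
        ... | inj₁ refl = isA
        ... | inj₂ refl = isC
        placeC : Place x₀ c x₀
        placeC = right ≤-refl j<K (cv∈′ j<K)
        placeA : Place x₀ a j
        placeA = cut ≤-refl
        in-j : Kind u → Kind v → Close M (g u) (g v)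
        in-j isA isA = same
        in-j isA isC = as placeA placeC a-x₀
        in-j isA isM = ⊥-elim (m≁cv i<K (flip-adj e))
        in-j isA (isX p q r) = as placeA (mid p q r) up
        in-j isC isA = as placeC placeA (Close-sym a-x₀)
        in-j isC isC = same
        in-j isC isM = ⊥-elim (m≁cv j<K (flip-adj e))
        in-j isC (isX p q r) = as placeC (mid p q r) (Close-sym mid-x₀)
        in-j isM isA = ⊥-elim (m≁cv i<K e)
        in-j isM isC = ⊥-elim (m≁cv j<K e)
        in-j isM isM = same
        in-j isM (isX p q r) = as far (mid p q r) down
        in-j (isX p q r) isA = as (mid p q r) placeA down
        in-j (isX p q r) isC = as (mid p q r) placeC mid-x₀
        in-j (isX p q r) isM = as (mid p q r) far up
        in-j (isX p q r) (isX p′ q′ r′) = as (mid p q r) (mid p′ q′ r′) same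

      edges : ∀ {u v} → A′ u v ≡ true → Close M (g u) (g v)
      edges e with addEdge⁻ A c₀ m e
      ... | inj₂ (inj₁ (refl , refl)) = as end far (wrap refl)
      ... | inj₂ (inj₂ (refl , refl)) = as far end (wrap′ refl)
      ... | inj₁ old with edge old
      ... | t , t≤K , u∈ , v∈ = block-edge t≤K u∈ v∈ old

      inhabited : ∀ l → l < M → ∃ λ v → g v ≡ l
      inhabited zero _ = c₀ , g-place end
      inhabited (suc l) l<M with <-cmp l j
      ... | tri< lt _ _ = cv l , g-place (cut lt)
      ... | tri> _ _ gt = m , trans (g-place far) (≤-antisym (s≤s gt) (s≤s⁻¹ l<M))
      ... | tri≈ _ refl _ with neighbour-in-block j≤K m∈
      ... | x , x∈ , mx = x , g-place (mid x∈ (λ { (s , s<K , refl) → m≁cv s<K mx }) (irreflexive mx ∘ sym))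

      dominated : ∀ l → l < M → ∃ λ d → d ∈ E × Close M l (g d)
      dominated l l<M with inhabited l l<M
      ... | v , refl with proj₁ cdsE v
      ... | inj₁ v∈ = v , v∈ , same
      ... | inj₂ (d , d∈ , e) = d , d∈ , edges e

      -- A layer hit only from c onwards is the layer x₀, which y hits instead.
      many : ∀ {y} → y ∈ E → y ∈ X → g y ≡ x₀ → suc j ≤ ∣ E ∩ X ∣
      many {y} y∈E y∈X gy with cycle-hits M g edges (proj₂ cdsE) dominated
      ... | e , f , hits = s≤s⁻¹ (s≤s⁻¹ (all-but-two-hits M (E ∩ X) g e f hits′))
        where
        hits′ : ∀ l → l < M → l ≢ e → l ≢ f → ∃ λ d → d ∈ E ∩ X × g d ≡ l
        hits′ l l<M l≢e l≢f with hits l l<M l≢e l≢f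
        ... | d , d∈ , refl with left? d
        ... | yes in-left = d , x∈p∩q⁺ (d∈ , ∈-subset⁺ left? in-left) , refl
        ... | no ¬left = y , x∈p∩q⁺ (y∈E , y∈X) , trans gy (sym (g-place (beyond (place d))))
          where
          beyond : ∀ {x} → Place x₀ d x → Place x₀ d x₀
          beyond end = ⊥-elim (¬left (belowC₀ , c₀≢cv j<K))
          beyond (cut {s} s<j) = ⊥-elim (¬left ((s , m≤n⇒m≤1+n s<j , cv∈ (<-trans s<j j<K)) ,
            λ eq → <⇒≢ s<j (cv-injective (<-trans s<j j<K) j<K eq)))
          beyond (mid v∈ ¬cv _) = ⊥-elim (¬left ((j , ≤-refl , v∈) , λ eq → ¬cv (j , j<K , eq)))
          beyond far = ⊥-elim (¬left (belowM ≤-refl , λ eq → m-¬cv (j , j<K , eq)))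
          beyond (right p q r) = right p q r

    aX : a ∈ X
    aX = ∈-subset⁺ left? ((i , m≤n⇒m≤1+n ≤-refl , cv∈ i<K) , λ eq → <⇒≢ ≤-refl (cv-injective i<K j<K eq))

    midX : ∀ {x} → x ∈ bl j → ¬ IsCv x → x ∈ X
    midX x∈ ¬cv = ∈-subset⁺ left? ((j , ≤-refl , x∈) , λ eq → ¬cv (j , j<K , eq))

    Mid : Fin n → Set
    Mid x = x ∈ E × x ∈ bl j × ¬ IsCv x × x ≢ m

    -- To dominate m, the set E contains m or c₀ when it has no middle vertex. A path of E from
    -- there to c enters c from the left, and the only left neighbours of c are a and middle
    -- vertices.
    a∈E : ¬ ∃ Mid → a ∈ E
    a∈E noMid = decidable-stable (a ∈? E) contra
      where
      start : ∃ λ d → d ∈ E × (d ≡ m ⊎ d ≡ c₀)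
      start with proj₁ cdsE m
      ... | inj₁ m∈E = m , m∈E , inj₁ refl
      ... | inj₂ (d , d∈ , e) with addEdge⁻ A c₀ m e
      ... | inj₂ (inj₁ (eq , _)) = ⊥-elim (c₀≢m (sym eq))
      ... | inj₂ (inj₂ (_ , refl)) = c₀ , d∈ , inj₂ refl
      ... | inj₁ old = ⊥-elim (noMid (d , d∈ , edge-in-block j≤K m∈ m-¬cv old ,
                          (λ { (s , s<K , refl) → m≁cv s<K old }) , (irreflexive old ∘ sym)))
      startX : ∀ {d} → d ≡ m ⊎ d ≡ c₀ → Below (suc j) d × d ≢ c
      startX (inj₁ refl) = belowM ≤-refl , λ eq → m-¬cv (j , j<K , eq)
      startX (inj₂ refl) = belowC₀ , c₀≢cv j<K
      to-c : ∀ {x} → x ∈ E → a ∉ E → Below (suc j) x → x ≢ c → A x c ≡ true → ⊥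
      to-c {x} x∈E a∉ bx x≢c xc with edge xc
      ... | t , t≤K , x∈ , c∈ with cv-block j<K t≤K c∈
      ... | inj₂ refl = x≢c (below∩above bx (suc j , ≤-refl , t≤K , x∈))
      ... | inj₁ refl with isCv? x | x ≟ m
      ... | no ¬cv | no x≢m = noMid (x , x∈E , x∈ , ¬cv , x≢m)
      ... | no ¬cv | yes refl = m≁cv j<K xc
      ... | yes cv′ | _ with cv-in-j cv′ x∈
      ... | inj₁ refl = a∉ x∈E
      ... | inj₂ eq = x≢c eq
      contra : ¬ ¬ (a ∈ E)
      contra a∉ with start
      ... | d , d∈ , which with reach-cross left? (proj₂ cdsE d c d∈ c∈E) (startX which) (λ { (_ , ne) → ne refl })
      ... | x , y , x∈ , y∈ , (bx , x≢c) , ¬ly , xy with addEdge⁻ A c₀ m xy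
      ... | inj₂ (inj₁ (refl , refl)) = ¬ly (startX (inj₁ refl))
      ... | inj₂ (inj₂ (refl , refl)) = ¬ly (startX (inj₂ refl))
      ... | inj₁ old with sep j<K x y old
      ... | inj₂ (ax , _) = x≢c (below∩above bx ax)
      ... | inj₁ (_ , by) with y ≟ c
      ... | no y≢c = ¬ly (by , y≢c)
      ... | yes refl = to-c x∈ a∉ bx x≢c old

    -- Of j + 3 layers at most two are missed. The vertices from c on are put into a layer that E
    -- also hits inside `X`: that of a middle vertex if E has one, otherwise that of a. So they
    -- contribute no layer of their own.
    many : suc j ≤ ∣ E ∩ X ∣
    many with any? (λ x → (x ∈? E) ×-dec (x ∈? bl j) ×-dec ¬? (isCv? x) ×-dec ¬? (x ≟ m))
    ... | yes (x , x∈E , x∈ , ¬cv , x≢m) = L.many x∈E (midX x∈ ¬cv) (L.g-place (mid x∈ ¬cv x≢m))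
      where module L = Layers (suc j) (inj₂ refl)
    ... | no noMid = L.many (a∈E noMid) aX (L.g-place (cut ≤-refl))
      where module L = Layers j (inj₁ refl)

    -- The j cut vertices before c, and the one vertex of D inside block j; earlier blocks have no
    -- inner vertex of D.
    few : ∣ D ∩ X ∣ ≤ suc j
    few = labels⇒∣∣≤ (D ∩ X) label bound inj
      where
      data Sort (x : Fin n) : ℕ → Set where
        cutV : ∀ {s} → s < j → x ≡ cv s → Sort x s
        midV : x ∈ D ∩ inner j → Sort x j
      label′ : ∀ {x} → Dec (IsCv x) → ℕ
      label′ (yes (s , _)) = s
      label′ (no _) = j
      label : Fin n → ℕ
      label x = label′ (isCv? x)
      sort′ : ∀ {x} → x ∈ D → Below (suc j) x → x ≢ c → (d : Dec (IsCv x)) → Sort x (label′ d)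
      sort′ x∈D bx x≢c (yes (s , s<K , refl)) with <-cmp s j
      ... | tri< s<j _ _ = cutV s<j refl
      ... | tri≈ _ refl _ = ⊥-elim (x≢c refl)
      ... | tri> _ _ j<s = ⊥-elim (x≢c (below∩above bx (s , j<s , <⇒≤ s<K , cv∈ s<K)))
      sort′ x∈D (t , t≤j , x∈) x≢c (no ¬cv) with m≤n⇒m<n∨m≡n (s≤s⁻¹ t≤j)
      ... | inj₁ t<j = ⊥-elim (∣p∣≡0⇒∉ _ (none t t<j) (x∈p∩q⁺ (x∈D , inner⁺ x∈ ¬cv)))
      ... | inj₂ refl = midV (x∈p∩q⁺ (x∈D , inner⁺ x∈ ¬cv))
      sort : ∀ {x} → x ∈ D ∩ X → Sort x (label x)
      sort {x} x∈ with x∈p∩q⁻ D X x∈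
      ... | x∈D , x∈X with ∈-subset⁻ left? x∈X
      ... | bx , x≢c = sort′ x∈D bx x≢c (isCv? x)
      below-suc-j : ∀ {x l} → Sort x l → l < suc j
      below-suc-j (cutV s<j _) = m≤n⇒m≤1+n s<j
      below-suc-j (midV _) = ≤-refl
      bound : ∀ {x} → x ∈ D ∩ X → label x < suc j
      bound x∈ = below-suc-j (sort x∈)
      inj′ : ∀ {x y l l′} → Sort x l → Sort y l′ → l ≡ l′ → x ≡ y
      inj′ (cutV _ refl) (cutV _ refl) refl = refl
      inj′ (cutV s<j _) (midV _) refl = ⊥-elim (<-irrefl refl s<j)
      inj′ (midV _) (cutV s<j _) refl = ⊥-elim (<-irrefl refl s<j)
      inj′ (midV p) (midV q) _ = ∣p∣≤1⇒≡ _ atMost p q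
      inj : ∀ {x y} → x ∈ D ∩ X → y ∈ D ∩ X → label x ≡ label y → x ≡ y
      inj x∈ y∈ = inj′ (sort x∈) (sort y∈)

    absurd : ⊥
    absurd = <⇒≱ (s≤s many) (≤-trans lt few)
      where
      -- The blocks 0..j together take the place of the single block in `edge-gain`, since the new
      -- edge lies among them. E need not contain the cut vertices before c, but both blocks of such
      -- a vertex are taken from D.
      open Mix (λ t → t ≤? j) D E cvD
        (λ s s<K → [ (λ s<j → inj₂ (<⇒≤ s<j , s<j)) , (λ j≤s → inj₁ (cvE j≤s s<K)) ]′ (<-≤-connex s j))
      onL : ∀ t → t ≤ K → t ≤ j → Local A D t
      onL t t≤K _ = cds⇒local t≤K (fits t≤K) cdsD
      offL : ∀ t → t ≤ K → ¬ t ≤ j → Local A E t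
      offL t t≤K t≰j = drop-edge (λ { (c₀∈t , _) → c₀∉ (≤-<-trans z≤n (≰⇒> t≰j)) t≤K c₀∈t })
        (cds⇒local t≤K (fits′ (≰⇒> t≰j) t≤K) cdsE)
      X-on : ∀ {v} → v ∈ X → home v ≤ j
      X-on {v} v∈ with ∈-subset⁻ left? v∈
      ... | bv , v≢c with home v ≤? j
      ... | yes p = p
      ... | no p = ⊥-elim (v≢c (below∩above bv (home v , ≰⇒> p , home≤ v , home∈ v)))
      X-off′ : ∀ {v} → v ∉ X → home v ≤ j → v ∈ D → v ∈ E
      X-off′ {v} v∉ h _ with v ≟ c
      ... | yes refl = c∈E
      ... | no v≢c = ⊥-elim (v∉ (∈-subset⁺ left? ((home v , s≤s h , home∈ v) , v≢c)))
      lt : ∣ E ∩ X ∣ < ∣ D ∩ X ∣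
      lt = +-cancelˡ-< k _ _ (begin-strict
        k + ∣ E ∩ X ∣         ≤⟨ +-monoˡ-≤ _ (minimal mix (mix-cds A-sym onL offL)) ⟩
        ∣ mix ∣ + ∣ E ∩ X ∣   ≤⟨ mix-card X X-on X-off′ ⟩
        ∣ E ∣ + ∣ D ∩ X ∣     <⟨ +-monoˡ-< _ (proj₂ (proj₂ gained)) ⟩
        k + ∣ D ∩ X ∣         ∎)
        where open ≤-Reasoning

  -- The shape of the block that holds the clique: p and `cv j` are the ends of the deleted path
  -- edge. For j > 0, p is the preceding cut vertex; for j = 0 it is the end c₀ of the path and not
  -- a cut vertex.
  record CentralShape (j : ℕ) : Set where
    field
      p      : Fin n
      p∈     : p ∈ bl j
      p≢c    : p ≢ cv j
      p≁c    : A p (cv j) ≡ false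
      p-prev : ∀ s → suc s ≡ j → p ≡ cv s
      rest   : ∀ {u v} → u ∈ bl j → v ∈ bl j → u ≢ v → A u v ≡ false → (u ≡ p × v ≡ cv j) ⊎ (u ≡ cv j × v ≡ p)

  -- In block 0 the vertex missed by the only cut vertex is p. In a later block the cut vertices are
  -- not adjacent by `TooClose`; for any missing edge the gained set has only cut vertices in the
  -- block and is connected there, so the new edge has to join these two.
  central : ∀ j → j < K → ∣ D ∩ inner j ∣ ≤ 1 → 1 ≤ ∣ D ∩ inner j ∣ → (∀ t → t < j → ∣ D ∩ inner t ∣ ≤ 0) → CentralShape j
  central zero j<K atMost atLeast _ = fromUndominated (undominated conn)
    where
    open OneInside j<K atMost atLeast
    cv-in-0 : ∀ {x} → IsCv x → x ∈ bl 0 → x ≡ cv 0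
    cv-in-0 (s , s<K , refl) x∈ with cv-block s<K z≤n x∈
    ... | inj₁ refl = refl
    conn : ConnectedOn A (λ x → x ∈ cvs × x ∈ bl 0)
    conn x y (x∈ , x∈b) (y∈ , y∈b) with cv-in-0 (∈-subset⁻ isCv? x∈) x∈b | cv-in-0 (∈-subset⁻ isCv? y∈) y∈b
    ... | refl | refl = here (x∈ , x∈b)
    fromUndominated : ∃ Undominated → CentralShape 0
    fromUndominated (m , m∈ , ¬cv , ¬dom) = record
      { p = m ; p∈ = m∈ ; p≢c = λ { refl → ¬cv (0 , j<K , refl) } ; p≁c = ¬dom 0 j<K (cv∈ j<K) ; p-prev = λ _ ()
      ; rest = λ u∈ v∈ u≢v a → [ (λ { (p , q) → inj₁ (p , cv-in-0 q v∈) }) , (λ { (p , q) → inj₂ (cv-in-0 q u∈ , p) }) ]′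
          (nonadjacent-undominated (m∈ , ¬cv , ¬dom) u∈ v∈ u≢v a) }
  central (suc i) j<K atMost atLeast none with A (cv i) (cv (suc i)) in eq
  ... | true = ⊥-elim (TooClose.absurd j<K atMost atLeast none eq)
  ... | false = record
      { p = cv i ; p∈ = cv∈′ i<K ; p≢c = p≢c ; p≁c = eq ; p-prev = λ { _ refl → refl }
      ; rest = λ u∈ v∈ u≢v a → rest (gain u∈ v∈ u≢v a) }
    where
    open OneInside j<K atMost atLeast
    i<K : i < K
    i<K = <-trans ≤-refl j<K
    p≢c : cv i ≢ cv (suc i)
    p≢c e = <⇒≢ ≤-refl (cv-injective i<K j<K e)
    rest : ∀ {u v} → Gain u v → (u ≡ cv i × v ≡ cv (suc i)) ⊎ (u ≡ cv (suc i) × v ≡ cv i)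
    rest {u} {v} gn = last (reach-cross (_≟ cv i)
        (proj₂ local (cv i) (cv (suc i)) (cvE i i<K , cv∈′ i<K) (cvE (suc i) j<K , cv∈ j<K)) refl (p≢c ∘ sym))
      where
      open Gain gn
      last : (∃ λ x → ∃ λ y → (x ∈ E × x ∈ bl (suc i)) × (y ∈ E × y ∈ bl (suc i)) × x ≡ cv i × y ≢ cv i ×
               addEdge A u v x y ≡ true) → (u ≡ cv i × v ≡ cv (suc i)) ⊎ (u ≡ cv (suc i) × v ≡ cv i)
      last (x , y , _ , (y∈E , y∈) , refl , y≢ , xy) with onlyCv y∈E y∈
      ... | s , s<K , refl with cv-block s<K j≤K y∈
      ... | inj₂ refl = ⊥-elim (y≢ refl)
      ... | inj₁ refl with addEdge⁻ A u v xy
      ... | inj₂ (inj₁ (p , q)) = inj₁ (sym p , sym q)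
      ... | inj₂ (inj₂ (p , q)) = inj₂ (sym q , sym p)
      ... | inj₁ old with trans (sym old) eq
      ... | ()

-- Layered description of the class 𝒢₁

-- Layers 0..N carry the path and the clique (layer q), layer N + 1 carries the complement of the star forest;
-- centre is meaningful on leaves only.
record Layered {n : ℕ} (G : Graph n) (N q : ℕ) : Set where
  field
    lay    : Fin n → ℕ
    leaf   : Fin n → Bool
    centre : Fin n → Fin n
    lay≤        : ∀ v → lay v ≤ suc N
    far         : ∀ {u v} → adj G u v ≡ true → lay u ≤ suc (lay v)
    near        : ∀ {u v} → u ≢ v → lay v ≤ N → lay u ≤ lay v → lay v ≤ suc (lay u) → adj G u v ≡ true
    head-leaf   : ∀ {u v} → lay u ≡ N → lay v ≡ suc N → leaf v ≡ true → adj G u v ≡ true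
    head-leaf⁻  : ∀ {u v} → lay u ≡ N → lay v ≡ suc N → adj G u v ≡ true → leaf v ≡ true
    tail        : ∀ {u v} → lay u ≡ suc N → lay v ≡ suc N → u ≢ v →
                  (leaf u ≡ true → leaf v ≡ false → centre u ≢ v) →
                  (leaf v ≡ true → leaf u ≡ false → centre v ≢ u) → adj G u v ≡ true
    leaf-centre : ∀ {u} → lay u ≡ suc N → leaf u ≡ true →
                  lay (centre u) ≡ suc N × leaf (centre u) ≡ false × adj G u (centre u) ≡ false
    unique      : ∀ {u v} → lay u ≡ lay v → lay v ≤ N → lay v ≢ q → u ≡ v
    rep         : ∀ i → i ≤ N → ∃ λ v → lay v ≡ i
    clique₂     : ∃ λ v → ∃ λ w → lay v ≡ q × lay w ≡ q × v ≢ w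
    leaf₁       : ∃ λ v → lay v ≡ suc N × leaf v ≡ true

TwoStars : ∀ {n} {G : Graph n} {N q : ℕ} → Layered G N q → Set
TwoStars {N = N} S = ∃ λ y₁ → ∃ λ y₂ →
  (lay y₁ ≡ suc N × leaf y₁ ≡ true) × (lay y₂ ≡ suc N × leaf y₂ ≡ true) × centre y₁ ≢ centre y₂
  where open Layered S

-- With a single star, of centre a, the layers close up to a cycle of length N + 4 when a is joined to layer 0.
module SingleStar {n N q k : ℕ} {G : Graph n} (S : Layered G N q) (critical : Critical G k) (k≡ : k ≡ 2 + N) (0<N : 0 < N) where

  open Layered S

  two-stars : TwoStars S
  two-stars with leaf₁
  ... | y , ly , leafY
    with any? (λ v → (lay v ≟ℕ suc N) ×-dec (leaf v Bool.≟ true) ×-dec ¬? (centre y ≟ centre v))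
  ... | yes (v , lv , leafV , ne) = y , v , (ly , leafY) , (lv , leafV) , ne
  ... | no none = ⊥-elim contra
    where
    A : RawAdj n
    A = adj G
    a c₀ : Fin n
    a = centre y
    c₀ = proj₁ (rep 0 z≤n)
    l₀ : lay c₀ ≡ 0
    l₀ = proj₂ (rep 0 z≤n)
    la : lay a ≡ suc N
    la = proj₁ (leaf-centre ly leafY)
    leafA : leaf a ≡ false
    leafA = proj₁ (proj₂ (leaf-centre ly leafY))
    single : ∀ {v} → lay v ≡ suc N → leaf v ≡ true → centre v ≡ a
    single {v} lv leafV = decidable-stable (centre v ≟ a) (λ ne → none (v , lv , leafV , (ne ∘ sym)))
    flip-adj : ∀ {u v b} → A u v ≡ b → A v u ≡ b
    flip-adj e = trans (adj-sym G _ _) e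

    -- The tail falls into three layers: the leaves, the other vertices, and the centre a. As a is
    -- non-adjacent to every leaf, it sees only the middle one of these; the edge from a to layer 0
    -- closes the cycle.
    data Place : Fin n → ℕ → Set where
      spine : ∀ {v} → lay v ≤ N → Place v (lay v)
      leafP : ∀ {v} → lay v ≡ suc N → leaf v ≡ true → Place v (suc N)
      rest  : ∀ {v} → lay v ≡ suc N → leaf v ≡ false → v ≢ a → Place v (suc (suc N))
      star  : Place a (suc (suc (suc N)))

    place : ∀ v → ∃ (Place v)
    place v with m≤n⇒m<n∨m≡n (lay≤ v)
    ... | inj₁ lt = lay v , spine (s≤s⁻¹ lt)
    ... | inj₂ lv with leaf v in leafV
    ... | true = _ , leafP lv leafV
    ... | false with v ≟ a
    ... | yes refl = _ , star
    ... | no v≢a = _ , rest lv leafV v≢a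

    off : ∀ {l} → l ≤ N → l ≡ suc N → ⊥
    off l≤ refl = <-irrefl refl l≤

    place-unique : ∀ {v w x y} → Place v x → Place w y → v ≡ w → x ≡ y
    place-unique (spine _) (spine _) refl = refl
    place-unique (spine p) (leafP q _) refl = ⊥-elim (off p q)
    place-unique (spine p) (rest q _ _) refl = ⊥-elim (off p q)
    place-unique (spine p) star refl = ⊥-elim (off p la)
    place-unique (leafP q _) (spine p) refl = ⊥-elim (off p q)
    place-unique (leafP _ _) (leafP _ _) refl = refl
    place-unique (leafP _ q) (rest _ p _) refl = ⊥-elim (false≢true q p)
    place-unique (leafP _ q) star refl = ⊥-elim (false≢true q leafA)
    place-unique (rest q _ _) (spine p) refl = ⊥-elim (off p q)
    place-unique (rest _ p _) (leafP _ q) refl = ⊥-elim (false≢true q p)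
    place-unique (rest _ _ _) (rest _ _ _) refl = refl
    place-unique (rest _ _ ne) star eq = ⊥-elim (ne eq)
    place-unique star (spine p) refl = ⊥-elim (off p la)
    place-unique star (leafP _ q) refl = ⊥-elim (false≢true q leafA)
    place-unique star (rest _ _ ne) eq = ⊥-elim (ne (sym eq))
    place-unique star star _ = refl

    M : ℕ
    M = suc (suc (suc (suc N)))

    g : Fin n → ℕ
    g v = proj₁ (place v)

    g-place : ∀ {v x} → Place v x → g v ≡ x
    g-place {v} p = place-unique (proj₂ (place v)) p refl

    steps : ∀ {x y} → x ≤ suc y → y ≤ suc x → Close M x y
    steps {x} {y} p q with <-cmp x y
    ... | tri≈ _ refl _ = same
    ... | tri< x<y _ _ with ≤-antisym q x<y
    ... | refl = up
    steps {x} {y} p q | tri> _ _ y<x with ≤-antisym p y<x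
    ... | refl = down

    at-head : ∀ {x y} → x ≤ N → y ≡ suc N → y ≤ suc x → x ≡ N
    at-head p q r = ≤-antisym p (s≤s⁻¹ (≤-trans (≤-reflexive (sym q)) r))

    edge-close : ∀ {u v x y} → A u v ≡ true → Place u x → Place v y → Close M x y
    edge-close e (spine _) (spine _) = steps (far e) (far (flip-adj e))
    edge-close e (spine p) (leafP q _) = subst (λ z → Close M z (suc N)) (sym (at-head p q (far (flip-adj e)))) up
    edge-close e (spine p) (rest q r _) =
      ⊥-elim (false≢true (head-leaf⁻ (at-head p q (far (flip-adj e))) q e) r)
    edge-close e (spine p) star =
      ⊥-elim (false≢true (head-leaf⁻ (at-head p la (far (flip-adj e))) la e) leafA)
    edge-close e (leafP q _) (spine p) =
      subst (Close M (suc N)) (sym (at-head p q (far e))) down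
    edge-close e (leafP _ _) (leafP _ _) = same
    edge-close e (leafP _ _) (rest _ _ _) = up
    edge-close e (leafP q r) star = ⊥-elim (false≢true (subst (λ z → A _ z ≡ true) (sym (single q r)) e)
      (proj₂ (proj₂ (leaf-centre q r))))
    edge-close e (rest q r _) (spine p) =
      ⊥-elim (false≢true (head-leaf⁻ (at-head p q (far e)) q (flip-adj e)) r)
    edge-close e (rest _ _ _) (leafP _ _) = down
    edge-close e (rest _ _ _) (rest _ _ _) = same
    edge-close e (rest _ _ _) star = up
    edge-close e star (spine p) =
      ⊥-elim (false≢true (head-leaf⁻ (at-head p la (far e)) la (flip-adj e)) leafA)
    edge-close e star (leafP q r) = ⊥-elim (false≢true (subst (λ z → A _ z ≡ true) (sym (single q r)) (flip-adj e))
      (proj₂ (proj₂ (leaf-centre q r))))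
    edge-close e star (rest _ _ _) = down
    edge-close e star star = same

    c₀≢a : c₀ ≢ a
    c₀≢a eq with trans (sym l₀) (trans (cong lay eq) la)
    ... | ()

    c₀-place : Place c₀ 0
    c₀-place = subst (Place c₀) l₀ (spine (subst (_≤ N) (sym l₀) z≤n))

    c₀≁a : A c₀ a ≡ false
    c₀≁a = Bool.¬-not λ e → <⇒≱ 0<N (s≤s⁻¹ (≤-trans (≤-reflexive (sym la))
             (≤-trans (far (flip-adj e)) (≤-reflexive (cong suc l₀)))))

    gained : Σ (Subset n) λ E → IsCDS (addEdge A c₀ a) E × ∣ E ∣ < k
    gained = proj₂ critical c₀ a c₀≢a c₀≁a

    E : Subset n
    E = proj₁ gained

    cdsE : IsCDS (addEdge A c₀ a) E
    cdsE = proj₁ (proj₂ gained)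

    edges : ∀ {u v} → addEdge A c₀ a u v ≡ true → Close M (g u) (g v)
    edges {u} {v} e with addEdge⁻ A c₀ a e
    ... | inj₁ old = edge-close old (proj₂ (place u)) (proj₂ (place v))
    ... | inj₂ (inj₁ (refl , refl)) rewrite g-place c₀-place | g-place star = wrap refl
    ... | inj₂ (inj₂ (refl , refl)) rewrite g-place c₀-place | g-place star = wrap′ refl

    -- The layer before a is not empty: a has some neighbour, which can be neither a leaf nor in an
    -- earlier layer.
    rest-exists : ∃ λ v → lay v ≡ suc N × leaf v ≡ false × v ≢ a
    rest-exists with cds⇒neighbour (adj-sym G) (proj₁ (proj₂ (proj₁ (proj₁ critical)))) c₀≢a
    ... | z , az with place z
    ... | _ , rest p q r = z , p , q , r
    ... | _ , star = ⊥-elim (false≢true az (adj-irrefl G a))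
    ... | _ , leafP p q = ⊥-elim (false≢true (subst (λ x → A z x ≡ true) (sym (single p q)) (flip-adj az))
            (proj₂ (proj₂ (leaf-centre p q))))
    ... | _ , spine p =
            ⊥-elim (false≢true (head-leaf⁻ (at-head p la (far az)) la (flip-adj az)) leafA)

    inhabited : ∀ i → i < M → ∃ λ v → g v ≡ i
    inhabited i i<M with m≤n⇒m<n∨m≡n (s≤s⁻¹ i<M)
    ... | inj₂ refl = a , g-place star
    ... | inj₁ lt with m≤n⇒m<n∨m≡n (s≤s⁻¹ lt)
    ... | inj₂ refl = let (v , p , q , r) = rest-exists in v , g-place (rest p q r)
    ... | inj₁ lt′ with m≤n⇒m<n∨m≡n (s≤s⁻¹ lt′)
    ... | inj₂ refl = y , g-place (leafP ly leafY)
    ... | inj₁ lt″ with rep i (s≤s⁻¹ lt″)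
    ... | v , refl = v , g-place (spine (s≤s⁻¹ lt″))

    dominated : ∀ i → i < M → ∃ λ d → d ∈ E × Close M i (g d)
    dominated i i<M with inhabited i i<M
    ... | v , refl with proj₁ cdsE v
    ... | inj₁ v∈ = v , v∈ , same
    ... | inj₂ (d , d∈ , e) = d , d∈ , edges e

    contra : ⊥
    contra with cycle-hits M g edges (proj₂ cdsE) dominated
    -- The cycle has N + 4 layers, so E hits at least N + 2 = k of them.
    ... | e , f , hits = <⇒≱ (proj₂ (proj₂ gained))
            (subst (_≤ ∣ E ∣) (sym k≡) (s≤s⁻¹ (s≤s⁻¹ (all-but-two-hits M E g e f hits))))

-- From chains of blocks to layers

-- Layer of the left end of block t: the central block j takes up two layers.
shift : ℕ → ℕ → ℕ
shift j t with t ≤? j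
... | yes _ = t
... | no _  = suc t

shift-low : ∀ {j t} → t ≤ j → shift j t ≡ t
shift-low {j} {t} t≤j with t ≤? j
... | yes _ = refl
... | no t≰j = ⊥-elim (t≰j t≤j)

shift-high : ∀ {j t} → j < t → shift j t ≡ suc t
shift-high {j} {t} j<t with t ≤? j
... | yes t≤j = ⊥-elim (<⇒≱ j<t t≤j)
... | no _ = refl

shift-suc : ∀ {j t} → t ≢ j → shift j (suc t) ≡ suc (shift j t)
shift-suc {j} {t} t≢j with <-cmp t j
... | tri< t<j _ _ = trans (shift-low t<j) (cong suc (sym (shift-low (<⇒≤ t<j))))
... | tri≈ _ eq _ = ⊥-elim (t≢j eq)
... | tri> _ _ j<t = trans (shift-high (m≤n⇒m≤1+n j<t)) (cong suc (sym (shift-high j<t)))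

shift-suc-j : ∀ {j} → shift j (suc j) ≡ suc (suc j)
shift-suc-j = shift-high ≤-refl

-- The value left out is the layer of the clique, so no cut vertex shares a layer with the clique.
shift≢suc : ∀ {j t} → shift j t ≢ suc j
shift≢suc {j} {t} eq with t ≤? j
... | yes t≤j = <-irrefl eq (s≤s t≤j)
... | no t≰j = t≰j (≤-reflexive (cong (_∸ 1) eq))

shift-mono-< : ∀ {j s t} → s < t → shift j s < shift j t
shift-mono-< {j} {s} {t} s<t with s ≤? j | t ≤? j
... | yes _ | yes _ = s<t
... | yes _ | no _ = m≤n⇒m≤1+n s<t
... | no s≰j | yes t≤j = ⊥-elim (s≰j (≤-trans (<⇒≤ s<t) t≤j))
... | no _ | no _ = s≤s s<t

shift-injective : ∀ {j s t} → shift j s ≡ shift j t → s ≡ t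
shift-injective {j} {s} {t} eq with <-cmp s t
... | tri< s<t _ _ = ⊥-elim (<-irrefl eq (shift-mono-< s<t))
... | tri≈ _ st _ = st
... | tri> _ _ t<s = ⊥-elim (<-irrefl (sym eq) (shift-mono-< t<s))

module ChainLayers {n κ : ℕ} (G : Graph n) (C : Chain n (suc κ))
  (edge : ∀ {u v} → adj G u v ≡ true → ∃ λ t → t ≤ suc κ × u ∈ Chain.bl C t × v ∈ Chain.bl C t)
  (nonsep : ∀ {t} → t ≤ suc κ → Nonsep (adj G) (Chain.bl C t))
  {k : ℕ} (critical : Critical G k) (D : Subset n) (cdsD : IsCDS (adj G) D) (∣D∣≡k : ∣ D ∣ ≡ k) where

  open Chain C
  open ChainCDS C
  open CriticalChain G C edge nonsep critical D cdsD ∣D∣≡k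
  open BlockShapes G C edge nonsep critical D cdsD ∣D∣≡k

  K : ℕ
  K = suc κ

  -- The star forest in the complement of the last block

  module LastBlock (two-in-D : 2 ≤ ∣ D ∩ inner K ∣) (two-in-D′ : ∣ D ∩ inner K ∣ ≤ 2) where

    c : Fin n
    c = cv κ

    In : Fin n → Set
    In v = v ∈ bl K × ¬ IsCv v

    in≢c : ∀ {v} → In v → v ≢ c
    in≢c (_ , ¬cv) eq = ¬cv (κ , ≤-refl , eq)

    in⊎c : ∀ {v} → v ∈ bl K → In v ⊎ v ≡ c
    in⊎c {v} v∈ with isCv? v
    ... | no ¬cv = inj₁ (v∈ , ¬cv)
    ... | yes (s , s<K , refl) with cv-block s<K ≤-refl v∈
    ... | inj₁ refl = ⊥-elim (<-irrefl refl s<K)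
    ... | inj₂ refl = inj₂ refl

    c∈ : c ∈ bl K
    c∈ = cv∈′ ≤-refl

    NonNeighbour : Fin n → Fin n → Set
    NonNeighbour y w = In w × A c w ≡ false × A w y ≡ false × w ≢ y

    opaque

      -- Otherwise c and y together would dominate the last block, with a single inner vertex where
      -- D needs two.
      nonneighbour : ∀ {y} → In y → A c y ≡ true → ∃ (NonNeighbour y)
      nonneighbour {y} iy cy with any? (λ w → ((w ∈? bl K) ×-dec ¬? (isCv? w)) ×-dec (A c w Bool.≟ false) ×-dec
                                         (A w y Bool.≟ false) ×-dec ¬? (w ≟ y))
      ... | yes p = p
      ... | no none = ⊥-elim (<⇒≱ (s≤s (subsingleton⇒∣∣≤1 (E ∩ inner K) only-y))
                                   (≤-trans two-in-D (local-minimal ≤-refl E cvE (dom , conn))))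
        where
        E? : ∀ v → Dec (IsCv v ⊎ v ≡ y)
        E? v = isCv? v ⊎-dec (v ≟ y)
        E : Subset n
        E = subset E?
        cvE : ∀ s → s < K → cv s ∈ E
        cvE s s<K = ∈-subset⁺ E? (inj₁ (s , s<K , refl))
        y∈ : y ∈ E
        y∈ = ∈-subset⁺ E? (inj₂ refl)
        only-y : ∀ {v w} → v ∈ E ∩ inner K → w ∈ E ∩ inner K → v ≡ w
        only-y v∈ w∈ = trans (is-y v∈) (sym (is-y w∈))
          where
          is-y : ∀ {v} → v ∈ E ∩ inner K → v ≡ y
          is-y v∈ with x∈p∩q⁻ E (inner K) v∈
          ... | p , q with ∈-subset⁻ E? p
          ... | inj₁ cv′ = ⊥-elim (proj₂ (inner⁻ q) cv′)
          ... | inj₂ eq = eq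
        dom : ∀ v → v ∈ bl K → v ∈ E ⊎ ∃ λ u → u ∈ E × u ∈ bl K × A v u ≡ true
        dom v v∈ with in⊎c v∈
        ... | inj₂ refl = inj₁ (cvE κ ≤-refl)
        ... | inj₁ iv with A c v in cv′
        ... | true = inj₂ (c , cvE κ ≤-refl , c∈ , flip-adj cv′)
        ... | false with A v y in vy
        ... | true = inj₂ (y , y∈ , proj₁ iy , vy)
        ... | false with v ≟ y
        ... | yes refl = inj₁ y∈
        ... | no v≢y = ⊥-elim (none (v , iv , cv′ , vy , v≢y))
        conn : ConnectedOn A (λ x → x ∈ E × x ∈ bl K)
        conn u v (u∈ , u∈K) (v∈ , v∈K) = link (which u∈ u∈K) (which v∈ v∈K) (u∈ , u∈K) (v∈ , v∈K)
          where
          which : ∀ {x} → x ∈ E → x ∈ bl K → x ≡ c ⊎ x ≡ y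
          which x∈ x∈K with in⊎c x∈K | ∈-subset⁻ E? x∈
          ... | inj₂ eq | _ = inj₁ eq
          ... | inj₁ _ | inj₂ eq = inj₂ eq
          ... | inj₁ (_ , ¬cv) | inj₁ cv′ = ⊥-elim (¬cv cv′)
          link : ∀ {P : Fin n → Set} {u v} → u ≡ c ⊎ u ≡ y → v ≡ c ⊎ v ≡ y → P u → P v → Reach A P u v
          link (inj₁ refl) (inj₁ refl) p q = here p
          link (inj₁ refl) (inj₂ refl) p q = reach-edge p q cy
          link (inj₂ refl) (inj₁ refl) p q = reach-edge p q (flip-adj cy)
          link (inj₂ refl) (inj₂ refl) p q = here p

      leaf₀ : ∃ λ u → In u × A c u ≡ true
      leaf₀ with neighbour-in-block ≤-refl c∈
      ... | z , z∈ , cz with in⊎c z∈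
      ... | inj₁ iz = z , iz , cz
      ... | inj₂ eq = ⊥-elim (irreflexive cz (sym eq))

      w₀-exists : ∃ λ w → In w × A c w ≡ false
      w₀-exists with leaf₀
      ... | u , iu , cu with nonneighbour iu cu
      ... | w , iw , cw , _ = w , iw , cw

    Split : Fin n → Fin n → Set
    Split u v = A c u ≡ true × A c v ≡ false × (∀ w → In w → A c w ≡ false → w ≢ v → A w u ≡ true)

    opaque

      -- The gained set E has at most one inner vertex y in the last block, and it has one because c
      -- does not see everything there. Connectedness makes y a neighbour of c, and y must see all
      -- non-neighbours of c in G + uv. By `nonneighbour` it fails to see one of them in G, so the
      -- new edge joins y to that one.
      split : ∀ {u v} → In u → In v → u ≢ v → A u v ≡ false → Split u v ⊎ Split v u
      split {u} {v} iu iv u≢v nonadj with edge-gain ≤-refl (proj₁ iu) (proj₁ iv) u≢v nonadj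
      ... | E , cvE , (dom , conn) , lt = finish y-exists
        where
        A′ : RawAdj n
        A′ = addEdge A u v
        atMostOne : ∣ E ∩ inner K ∣ ≤ 1
        atMostOne = s≤s⁻¹ (≤-trans lt two-in-D′)
        equal : ∀ {x y} → x ∈ E → In x → y ∈ E → In y → x ≡ y
        equal x∈ (x∈K , ¬x) y∈ (y∈K , ¬y) =
          ∣p∣≤1⇒≡ _ atMostOne (x∈p∩q⁺ (x∈ , inner⁺ x∈K ¬x)) (x∈p∩q⁺ (y∈ , inner⁺ y∈K ¬y))
        old-at-c : ∀ {x} → A′ x c ≡ true → A x c ≡ true
        old-at-c a with addEdge⁻ A u v a
        ... | inj₁ old = old
        ... | inj₂ (inj₁ (_ , eq)) = ⊥-elim (in≢c iv (sym eq))
        ... | inj₂ (inj₂ (_ , eq)) = ⊥-elim (in≢c iu (sym eq))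
        y-exists : ∃ λ y → y ∈ E × In y
        y-exists with w₀-exists
        ... | w , iw , cw with dom w (proj₁ iw)
        ... | inj₁ w∈ = w , w∈ , iw
        ... | inj₂ (x , x∈ , x∈K , a) with in⊎c x∈K
        ... | inj₁ ix = x , x∈ , ix
        ... | inj₂ refl = ⊥-elim (false≢true (flip-adj (old-at-c a)) cw)
        module _ (y : Fin n) (y∈ : y ∈ E) (iy : In y) where
          yc : A c y ≡ true
          yc with reach-cross (_≟ y) (conn y c (y∈ , proj₁ iy) (cvE κ ≤-refl , c∈)) refl (in≢c iy ∘ sym)
          ... | a , b , _ , (b∈ , b∈K) , refl , b≢y , ab with in⊎c b∈K
          ... | inj₁ ib = ⊥-elim (b≢y (equal b∈ ib y∈ iy))
          ... | inj₂ refl = flip-adj (old-at-c ab)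
          dominates : ∀ w → In w → A c w ≡ false → A′ w y ≡ true
          dominates w iw cw with dom w (proj₁ iw)
          ... | inj₁ w∈ = ⊥-elim (false≢true (subst (λ z → A c z ≡ true) (equal y∈ iy w∈ iw) yc) cw)
          ... | inj₂ (x , x∈ , x∈K , a) with in⊎c x∈K
          ... | inj₁ ix = subst (λ z → A′ w z ≡ true) (equal x∈ ix y∈ iy) a
          ... | inj₂ refl = ⊥-elim (false≢true (flip-adj (old-at-c a)) cw)
          result : Split u v ⊎ Split v u
          result with nonneighbour iy yc
          ... | w , iw , cw , wy , w≢y with addEdge⁻ A u v (dominates w iw cw)
          ... | inj₁ old = ⊥-elim (false≢true old wy)
          ... | inj₂ (inj₂ (refl , refl)) = inj₁ (yc , cw , λ x ix cx x≢v → old-edge x (dominates x ix cx) cx x≢v)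
            where
            old-edge : ∀ x → A′ x u ≡ true → A c x ≡ false → x ≢ v → A x u ≡ true
            old-edge x a cx x≢v with addEdge⁻ A u v a
            ... | inj₁ old = old
            ... | inj₂ (inj₁ (refl , _)) = ⊥-elim (false≢true yc cx)
            ... | inj₂ (inj₂ (eq , _)) = ⊥-elim (x≢v eq)
          ... | inj₂ (inj₁ (refl , refl)) = inj₂ (yc , cw , λ x ix cx x≢u → old-edge x (dominates x ix cx) cx x≢u)
            where
            old-edge : ∀ x → A′ x v ≡ true → A c x ≡ false → x ≢ u → A x v ≡ true
            old-edge x a cx x≢u with addEdge⁻ A u v a
            ... | inj₁ old = old
            ... | inj₂ (inj₁ (eq , _)) = ⊥-elim (x≢u eq)
            ... | inj₂ (inj₂ (refl , _)) = ⊥-elim (false≢true yc cx)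
        finish : (∃ λ y → y ∈ E × In y) → Split u v ⊎ Split v u
        finish (y , y∈ , iy) = result y y∈ iy

      -- A choice made for every vertex, so that `centre` is a total function; the value `u` is a
      -- dummy for vertices that are not neighbours of c inside the block.
      centre-of : ∀ u → ∃ λ w → In u → A c u ≡ true → NonNeighbour u w
      centre-of u with u ∈? bl K | isCv? u | A c u Bool.≟ true
      ... | yes u∈ | no ¬cv | yes cu = proj₁ p , λ _ _ → proj₂ p
        where
        p : ∃ (NonNeighbour u)
        p = nonneighbour (u∈ , ¬cv) cu
      ... | no u∉ | _ | _ = u , λ iu → ⊥-elim (u∉ (proj₁ iu))
      ... | yes _ | yes cv′ | _ = u , λ iu → ⊥-elim (proj₂ iu cv′)
      ... | yes _ | no _ | no ¬cu = u , λ _ cu → ⊥-elim (¬cu cu)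

    centre : Fin n → Fin n
    centre u = proj₁ (centre-of u)

    centre-nonneighbour : ∀ {u} → In u → A c u ≡ true → NonNeighbour u (centre u)
    centre-nonneighbour {u} = proj₂ (centre-of u)

    -- Of two non-adjacent vertices, `split` makes one a neighbour of c that sees every other
    -- non-neighbour of c but the second vertex. Its chosen non-neighbour is therefore that second
    -- vertex, which makes the missing edges stars.
    last-adjacent : ∀ {u v} → In u → In v → u ≢ v → (A c u ≡ true → A c v ≡ false → centre u ≢ v) →
                    (A c v ≡ true → A c u ≡ false → centre v ≢ u) → A u v ≡ true
    last-adjacent {u} {v} iu iv u≢v notUV notVU with A u v in eq
    ... | true = refl
    ... | false with split iu iv u≢v eq
    ... | inj₁ (cu , cv′ , h) = ⊥-elim (miss (centre-nonneighbour iu cu))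
      where
      miss : NonNeighbour u (centre u) → ⊥
      miss (iw , cw , wu , _) = false≢true (h (centre u) iw cw (notUV cu cv′)) wu
    ... | inj₂ (cv′ , cu , h) = ⊥-elim (miss (centre-nonneighbour iv cv′))
      where
      miss : NonNeighbour v (centre v) → ⊥
      miss (iw , cw , wv , _) = false≢true (h (centre v) iw cw (notVU cv′ cu)) wv

  -- The layers of a chain of blocks

  module Layers {j : ℕ} (j<K : j < K) (central : CentralShape j)
    (none : ∀ t → t < K → t ≢ j → ∣ D ∩ inner t ∣ ≤ 0)
    (two-in-D : 2 ≤ ∣ D ∩ inner K ∣) (two-in-D′ : ∣ D ∩ inner K ∣ ≤ 2) where

    open LastBlock two-in-D two-in-D′
    open CentralShape central

    N : ℕ
    N = suc K

    h : ℕ → ℕ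
    h = shift j

    j≤K : j ≤ K
    j≤K = <⇒≤ j<K

    h-K : h K ≡ N
    h-K = shift-high j<K

    p-cv : ∀ {s} → suc s ≡ j → p ≡ cv s
    p-cv = p-prev _

    cv-in-j : ∀ {v} → IsCv v → v ∈ bl j → v ≡ p ⊎ v ≡ cv j
    cv-in-j (s , s<K , refl) v∈ with cv-block s<K j≤K v∈
    ... | inj₁ refl = inj₂ refl
    ... | inj₂ eq = inj₁ (sym (p-cv (sym eq)))

    p-¬cv : j ≡ 0 → ¬ IsCv p
    p-¬cv j≡0 (s , s<K , eq) with cv-block s<K j≤K (subst (_∈ bl j) eq p∈)
    ... | inj₁ refl = p≢c eq
    ... | inj₂ refl with j≡0
    ... | ()

    -- If block 0 is the central one, only p goes to layer 0 and its remaining inner vertices form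
    -- the clique layer; this is the condition in `end`.
    data Place : Fin n → ℕ → Set where
      end  : ∀ {v} → v ∈ bl 0 → ¬ IsCv v → (j ≡ 0 → v ≡ p) → Place v 0
      cut  : ∀ {s} → s < K → Place (cv s) (h (suc s))
      mid  : ∀ {v} → v ∈ bl j → ¬ IsCv v → v ≢ p → Place v (suc j)
      last : ∀ {v} → In v → Place v (suc N)

    opaque

      place-in : ∀ {t v} → t ≤ K → v ∈ bl t → ∃ (Place v)
      place-in {t} {v} t≤K v∈ with isCv? v
      ... | yes (s , s<K , refl) = _ , cut s<K
      ... | no ¬cv with m≤n⇒m<n∨m≡n t≤K
      ... | inj₂ refl = _ , last (v∈ , ¬cv)
      ... | inj₁ t<K with t ≟ℕ j
      place-in {t} {v} t≤K v∈ | no ¬cv | inj₁ t<K | yes refl with v ≟ p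
      ... | no v≢p = _ , mid v∈ ¬cv v≢p
      place-in {zero} t≤K v∈ | no ¬cv | inj₁ t<K | yes refl | yes eq = _ , end v∈ ¬cv (λ _ → eq)
      place-in {suc t} t≤K v∈ | no ¬cv | inj₁ t<K | yes refl | yes eq =
        ⊥-elim (¬cv (t , <-trans ≤-refl t<K , trans eq (p-cv refl)))
      place-in {zero} t≤K v∈ | no ¬cv | inj₁ t<K | no t≢j = _ , end v∈ ¬cv (λ j≡0 → ⊥-elim (t≢j (sym j≡0)))
      place-in {suc t} t≤K v∈ | no ¬cv | inj₁ t<K | no t≢j with thin-middle t<K (none _ t<K t≢j) v∈
      ... | inj₁ eq = ⊥-elim (¬cv (t , <-trans ≤-refl t<K , eq))
      ... | inj₂ eq = ⊥-elim (¬cv (suc t , t<K , eq))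

      place-unique : ∀ {v w x y} → Place v x → Place w y → v ≡ w → x ≡ y
      place-unique (end _ _ _) (end _ _ _) _ = refl
      place-unique (end _ ¬cv _) (cut s<K) eq = ⊥-elim (¬cv (_ , s<K , eq))
      place-unique (end v∈ ¬cv e) (mid v∈′ _ v≢p) refl = ⊥-elim (v≢p (e (sym (inner-unique z≤n j≤K ¬cv v∈ v∈′))))
      place-unique (end v∈ ¬cv _) (last (v∈′ , _)) refl with inner-unique z≤n ≤-refl ¬cv v∈ v∈′
      ... | ()
      place-unique (cut s<K) (end _ ¬cv _) eq = ⊥-elim (¬cv (_ , s<K , sym eq))
      place-unique (cut s<K) (cut s′<K) eq = cong (λ s → h (suc s)) (cv-injective s<K s′<K eq)
      place-unique (cut s<K) (mid _ ¬cv _) eq = ⊥-elim (¬cv (_ , s<K , sym eq))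
      place-unique (cut s<K) (last (_ , ¬cv)) eq = ⊥-elim (¬cv (_ , s<K , sym eq))
      place-unique (mid v∈′ _ v≢p) (end v∈ ¬cv e) refl = ⊥-elim (v≢p (e (sym (inner-unique z≤n j≤K ¬cv v∈ v∈′))))
      place-unique (mid _ ¬cv _) (cut s<K) eq = ⊥-elim (¬cv (_ , s<K , eq))
      place-unique (mid _ _ _) (mid _ _ _) _ = refl
      place-unique (mid v∈ ¬cv _) (last (v∈′ , _)) refl = ⊥-elim (<⇒≢ j<K (inner-unique j≤K ≤-refl ¬cv v∈ v∈′))
      place-unique (last (v∈′ , _)) (end v∈ ¬cv _) refl with inner-unique z≤n ≤-refl ¬cv v∈ v∈′
      ... | ()
      place-unique (last (_ , ¬cv)) (cut s<K) eq = ⊥-elim (¬cv (_ , s<K , eq))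
      place-unique (last (v∈′ , _)) (mid v∈ ¬cv _) refl = ⊥-elim (<⇒≢ j<K (inner-unique j≤K ≤-refl ¬cv v∈ v∈′))
      place-unique (last _) (last _) _ = refl

    lay : Fin n → ℕ
    lay v = proj₁ (place-in (home≤ v) (home∈ v))

    place : ∀ v → Place v (lay v)
    place v = proj₂ (place-in (home≤ v) (home∈ v))

    lay-place : ∀ {v x} → Place v x → lay v ≡ x
    lay-place p = place-unique (place _) p refl

    -- A vertex of block `t` is in its left layer `h t`, in its right layer `h (suc t)`, in the
    -- clique layer if `t` is `j`, or in the tail if `t` is `K`. In the central block the left layer
    -- holds only p.
    data Position (t : ℕ) (v : Fin n) : Set where
      low  : lay v ≡ h t → (t ≡ j → v ≡ p) → Position t v
      midp : t ≡ j → lay v ≡ suc j → Position t v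
      high : t < K → v ≡ cv t → lay v ≡ h (suc t) → Position t v
      lastp : t ≡ K → lay v ≡ suc N → Position t v

    position : ∀ {t v} → t ≤ K → v ∈ bl t → Position t v
    position {t} {v} t≤K v∈ with isCv? v
    ... | no ¬cv = by-place (place v) refl
      where
      by-place : ∀ {w x} → Place w x → w ≡ v → Position t v
      by-place pl@(end v∈0 _ e) refl with inner-unique t≤K z≤n ¬cv v∈ v∈0
      ... | refl = low (trans (lay-place pl) (sym (shift-low {j} z≤n))) (λ 0≡j → e (sym 0≡j))
      by-place (cut s<K) refl = ⊥-elim (¬cv (_ , s<K , refl))
      by-place pl@(mid v∈j _ v≢p) refl = midp (inner-unique t≤K j≤K ¬cv v∈ v∈j) (lay-place pl)
      by-place pl@(last (v∈K , _)) refl = lastp (inner-unique t≤K ≤-refl ¬cv v∈ v∈K) (lay-place pl)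
    ... | yes (s , s<K , refl) with cv-block s<K t≤K v∈
    ... | inj₁ refl = high s<K refl (lay-place (cut s<K))
    ... | inj₂ refl = low (lay-place (cut s<K)) (λ eq → sym (p-cv eq))

    -- An edge lies in one block, and only the central block spans three layers. Its outermost
    -- layers contain just p and `cv j`, which are not adjacent.
    far : ∀ {u v} → A u v ≡ true → lay u ≤ suc (lay v)
    far {u} {v} e with edge e
    ... | t , t≤K , u∈ , v∈ = lem (position t≤K u∈) (position t≤K v∈)
      where
      by : ∀ {x y a b} → x ≡ a → y ≡ b → a ≤ suc b → x ≤ suc y
      by refl refl p = p
      no-gap : t ≡ j → u ≡ cv t → v ≡ p → ⊥
      no-gap refl refl refl = false≢true (flip-adj e) p≁c
      hK : t ≡ K → h t ≡ N
      hK refl = h-K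
      lem : Position t u → Position t v → lay u ≤ suc (lay v)
      lem (low a _) (low b _) = by a b (n≤1+n _)
      lem (low a _) (midp refl b) = by a b (≤-trans (≤-reflexive (shift-low {j} ≤-refl)) (m≤n⇒m≤1+n (n≤1+n _)))
      lem (low a _) (high _ _ b) = by a b (≤-trans (<⇒≤ (shift-mono-< {j} {t} ≤-refl)) (n≤1+n _))
      lem (low a _) (lastp tK b) = by (trans a (hK tK)) b (m≤n⇒m≤1+n (n≤1+n _))
      lem (midp refl a) (low b _) = by a (trans b (shift-low ≤-refl)) ≤-refl
      lem (midp _ a) (midp _ b) = by a b (n≤1+n _)
      lem (midp refl a) (high _ _ b) = by a (trans b shift-suc-j) (m≤n⇒m≤1+n (n≤1+n _))
      lem (midp refl a) (lastp tK b) = ⊥-elim (<⇒≢ j<K tK)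
      lem (high _ u≡ a) (low b v≡) with t ≟ℕ j
      ... | yes t≡j = ⊥-elim (no-gap t≡j u≡ (v≡ t≡j))
      ... | no t≢j = by (trans a (shift-suc t≢j)) b ≤-refl
      lem (high _ _ a) (midp refl b) = by (trans a shift-suc-j) b ≤-refl
      lem (high _ _ a) (high _ _ b) = by a b (n≤1+n _)
      lem (high t<K _ _) (lastp refl _) = ⊥-elim (<-irrefl refl t<K)
      lem (lastp tK a) (low b _) = by a (trans b (hK tK)) ≤-refl
      lem (lastp tK _) (midp refl _) = ⊥-elim (<⇒≢ j<K tK)
      lem (lastp refl _) (high t<K _ _) = ⊥-elim (<-irrefl refl t<K)
      lem (lastp _ a) (lastp _ b) = by a b (n≤1+n _)

    adjacent-in-j : ∀ {u v} → u ∈ bl j → v ∈ bl j → u ≢ v → (u ≢ p ⊎ v ≢ cv j) → (u ≢ cv j ⊎ v ≢ p) → A u v ≡ true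
    adjacent-in-j {u} {v} u∈ v∈ u≢v n₁ n₂ with A u v in eq
    ... | true = refl
    ... | false with rest u∈ v∈ u≢v eq
    ... | inj₁ (a , b) = ⊥-elim ([ (λ f → f a) , (λ f → f b) ]′ n₁)
    ... | inj₂ (a , b) = ⊥-elim ([ (λ f → f a) , (λ f → f b) ]′ n₂)

    -- Two such vertices share a block. It is complete or else the central one, whose only missing
    -- edge joins vertices two layers apart.
    near : ∀ {u v} → u ≢ v → lay v ≤ N → lay u ≤ lay v → lay v ≤ suc (lay u) → A u v ≡ true
    near {u} {v} = lem (place u) (place v)
      where
      suc≤h : ∀ s → suc s ≤ h (suc s)
      suc≤h s with suc s ≤? j
      ... | yes _ = ≤-refl
      ... | no _ = n≤1+n _
      lem : ∀ {u v x y} → Place u x → Place v y → u ≢ v → y ≤ N → x ≤ y → y ≤ suc x → A u v ≡ true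
      lem _ (last _) _ y≤N _ _ = ⊥-elim (<-irrefl refl y≤N)
      lem (last _) (end _ _ _) _ _ () _
      lem (last _) (cut s<K) _ y≤N x≤y _ = ⊥-elim (<⇒≱ x≤y y≤N)
      lem (last _) (mid _ _ _) _ y≤N x≤y _ = ⊥-elim (<⇒≱ x≤y y≤N)
      lem {u} {v} (end u∈ ¬u eu) (end v∈ ¬v ev) u≢v _ _ _ with j ≟ℕ 0
      ... | yes j≡0 = ⊥-elim (u≢v (trans (eu j≡0) (sym (ev j≡0))))
      ... | no j≢0 = ⊥-elim (u≢v (thin 0<K (none 0 0<K (j≢0 ∘ sym)) v∈ (λ eq → ¬v (0 , 0<K , eq)) (λ _ ())
                       u∈ (λ eq → ¬u (0 , 0<K , eq))))
        where
        0<K : 0 < K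
        0<K = s≤s z≤n
      lem (end u∈ ¬u _) (cut {s} s<K) u≢v _ _ le with n≤0⇒n≡0 (s≤s⁻¹ (≤-trans (suc≤h s) le))
      ... | refl with j ≟ℕ 0
      ... | yes refl with ≤-trans (≤-reflexive (sym (shift-suc-j {0}))) le
      ... | s≤s ()
      lem (end u∈ ¬u _) (cut {s} s<K) u≢v _ _ le | refl | no j≢0 =
        complete z≤n (none 0 s<K (j≢0 ∘ sym)) u∈ (cv∈ s<K) u≢v
      lem (end u∈ ¬u _) (mid v∈ ¬v v≢p) u≢v _ _ (s≤s le) =
        adjacent-in-j (subst (λ t → _ ∈ bl t) (sym (n≤0⇒n≡0 le)) u∈) v∈ u≢v
          (inj₂ λ eq → ¬v (j , j<K , eq)) (inj₂ v≢p)
      lem (cut {s} s<K) (end _ _ _) _ _ le _ with ≤-trans (suc≤h s) le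
      ... | ()
      lem (cut {s} s<K) (cut {s′} s′<K) u≢v _ x≤y y≤ with <-cmp s s′
      ... | tri≈ _ refl _ = ⊥-elim (u≢v refl)
      ... | tri> _ _ gt = ⊥-elim (<⇒≱ (shift-mono-< (s≤s gt)) x≤y)
      ... | tri< lt _ _ with m≤n⇒m<n∨m≡n lt
      ... | inj₁ lt′ = ⊥-elim (<⇒≱ (≤-<-trans (shift-mono-< {j} {suc s} ≤-refl) (shift-mono-< (s≤s lt′))) y≤)
      ... | inj₂ refl with suc s ≟ℕ j
      ... | no ne = complete (<⇒≤ s′<K) (none _ s′<K ne) (cv∈′ s<K) (cv∈ s′<K) u≢v
      ... | yes refl = ⊥-elim (<-irrefl refl (≤-trans (≤-reflexive (sym (shift-suc-j {j})))
                         (≤-trans y≤ (≤-reflexive (cong suc (shift-low {j} ≤-refl))))))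
      lem (cut {s} s<K) (mid {v} v∈ ¬v v≢p) u≢v _ x≤y y≤ with <-cmp (suc s) j
      ... | tri> _ _ gt = ⊥-elim (<⇒≱ (≤-trans (s≤s gt) (≤-reflexive (sym (shift-high gt)))) x≤y)
      ... | tri< lt _ _ = ⊥-elim (<⇒≱ lt (≤-trans (s≤s⁻¹ y≤) (≤-reflexive (shift-low (<⇒≤ lt)))))
      ... | tri≈ _ refl _ = adjacent-in-j (cv∈′ s<K) v∈ u≢v (inj₂ λ eq → ¬v (j , j<K , eq)) (inj₂ v≢p)
      lem (mid _ _ _) (end _ _ _) _ _ () _
      lem (mid u∈ ¬u u≢p) (cut {s} s<K) u≢v _ x≤y y≤ with <-cmp s j
      ... | tri< lt _ _ = ⊥-elim (<⇒≱ (s≤s lt) (≤-trans x≤y (≤-reflexive (shift-low lt))))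
      ... | tri> _ _ gt = ⊥-elim (<⇒≱ (s≤s (s≤s gt)) (≤-trans (≤-reflexive (sym (shift-high (m≤n⇒m≤1+n gt)))) y≤))
      ... | tri≈ _ refl _ = adjacent-in-j u∈ (cv∈ s<K) u≢v (inj₁ u≢p) (inj₁ λ eq → ¬u (j , j<K , eq))
      lem (mid u∈ ¬u u≢p) (mid v∈ ¬v v≢p) u≢v _ _ _ =
        adjacent-in-j u∈ v∈ u≢v (inj₁ u≢p) (inj₂ v≢p)

    head-is-c : ∀ {u} → lay u ≡ N → u ≡ c
    head-is-c {u} = lem (place u)
      where
      lem : ∀ {u x} → Place u x → x ≡ N → u ≡ c
      lem (end _ _ _) ()
      lem (cut {s} s<K) eq with shift-injective {j} {suc s} {K} (trans eq (sym h-K))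
      ... | refl = refl
      lem (mid _ _ _) eq = ⊥-elim (<⇒≢ j<K (cong (_∸ 1) eq))
      lem (last _) eq = ⊥-elim (<-irrefl (sym eq) ≤-refl)

    last-In : ∀ {v} → lay v ≡ suc N → In v
    last-In {v} = lem (place v)
      where
      lem : ∀ {v x} → Place v x → x ≡ suc N → In v
      lem (end _ _ _) ()
      lem (cut {s} s<K) eq = ⊥-elim (<-irrefl (trans eq (cong suc (sym h-K)))
        (s≤s ([ (λ lt → <⇒≤ (shift-mono-< lt)) , (λ e → ≤-reflexive (cong h e)) ]′ (m≤n⇒m<n∨m≡n s<K))))
      lem (mid _ _ _) eq = ⊥-elim (<⇒≢ (m≤n⇒m≤1+n j<K) (cong (_∸ 1) eq))
      lem (last iv) _ = iv

    unique : ∀ {u v} → lay u ≡ lay v → lay v ≤ N → lay v ≢ suc j → u ≡ v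
    unique {u} {v} = lem (place u) (place v)
      where
      lem : ∀ {u v x y} → Place u x → Place v y → x ≡ y → y ≤ N → y ≢ suc j → u ≡ v
      lem (end u∈ ¬u eu) (end v∈ ¬v ev) _ _ _ with j ≟ℕ 0
      ... | yes j≡0 = trans (eu j≡0) (sym (ev j≡0))
      ... | no j≢0 = thin (s≤s z≤n) (none 0 (s≤s z≤n) (j≢0 ∘ sym)) v∈ (λ eq → ¬v (0 , s≤s z≤n , eq)) (λ _ ())
                       u∈ (λ eq → ¬u (0 , s≤s z≤n , eq))
      lem (end _ _ _) (cut {s} s<K) eq _ _ with shift-injective {j} {0} {suc s} (trans (shift-low {j} z≤n) eq)
      ... | ()
      lem (cut {s} s<K) (end _ _ _) eq _ _ with shift-injective {j} {suc s} {0} (trans eq (sym (shift-low {j} z≤n)))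
      ... | ()
      lem (cut {s} s<K) (cut {s′} s′<K) eq _ _ with shift-injective {j} {suc s} {suc s′} eq
      ... | refl = refl
      lem (mid _ _ _) _ eq _ ne = ⊥-elim (ne (sym eq))
      lem _ (mid _ _ _) eq _ ne = ⊥-elim (ne refl)
      lem _ (last _) _ y≤N _ = ⊥-elim (<-irrefl refl y≤N)
      lem (last _) (end _ _ _) () _ _
      lem (last _) (cut _) eq y≤N _ = ⊥-elim (<⇒≱ (≤-reflexive eq) y≤N)

    -- A neighbour of p in the block is not `cv j`, hence in the clique layer. Deleting it leaves
    -- the block connected, so p has a second neighbour there.
    clique₂ : ∃ λ v → ∃ λ w → lay v ≡ suc j × lay w ≡ suc j × v ≢ w
    clique₂ with neighbour-in-block j≤K p∈
    ... | x , x∈ , px with second-neighbour-in-block j≤K p∈ (cv∈ j<K) x∈ (irreflexive px) (c≢ px) (p≢c ∘ sym)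
      where
      c≢ : ∀ {x} → A p x ≡ true → cv j ≢ x
      c≢ px refl = false≢true px p≁c
    ... | y , y∈ , y≢x , py = x , y , at x∈ px , at y∈ py , (y≢x ∘ sym)
      where
      at : ∀ {z} → z ∈ bl j → A p z ≡ true → lay z ≡ suc j
      at {z} z∈ pz = lay-place (mid z∈ ¬cv (irreflexive pz ∘ sym))
        where
        ¬cv : ¬ IsCv z
        ¬cv cvz with cv-in-j cvz z∈
        ... | inj₁ refl = irreflexive pz refl
        ... | inj₂ refl = false≢true pz p≁c

    rep : ∀ i → i ≤ N → ∃ λ v → lay v ≡ i
    rep zero _ with j ≟ℕ 0
    ... | yes refl = p , lay-place (end p∈ (p-¬cv refl) (λ _ → refl))
    ... | no j≢0 with two z≤n (cv 0)
    ... | w , w∈ , w≢ = w , lay-place (end w∈ ¬cv (λ e → ⊥-elim (j≢0 e)))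
      where
      ¬cv : ¬ IsCv w
      ¬cv (s , s<K , refl) with cv-block s<K z≤n w∈
      ... | inj₁ refl = w≢ refl
    rep (suc i) i<N with <-cmp i j
    ... | tri< lt _ _ = cv i , trans (lay-place (cut (<-trans lt j<K))) (shift-low lt)
    ... | tri≈ _ refl _ = let (v , _ , lv , _) = clique₂ in v , lv
    rep (suc (suc i)) i<N | tri> _ _ gt = cv i , trans (lay-place (cut (s≤s⁻¹ i<N))) (shift-high gt)

    lay≤ : ∀ v → lay v ≤ suc N
    lay≤ v = lem (place v)
      where
      lem : ∀ {v x} → Place v x → x ≤ suc N
      lem (end _ _ _) = z≤n
      lem (cut {s} s<K) with suc s ≤? j
      ... | yes _ = ≤-trans s<K (m≤n⇒m≤1+n (n≤1+n _))
      ... | no _ = ≤-trans (s≤s s<K) (n≤1+n _)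
      lem (mid _ _ _) = s≤s (≤-trans j≤K (n≤1+n _))
      lem (last _) = ≤-refl

    layered : Layered G N (suc j)
    layered = record
      { lay = lay ; leaf = A c ; centre = centre ; lay≤ = lay≤ ; far = far ; near = near
      ; head-leaf = λ {u} {v} lu lv cv′ → subst (λ z → A z v ≡ true) (sym (head-is-c lu)) cv′
      ; head-leaf⁻ = λ {u} {v} lu lv uv → subst (λ z → A z v ≡ true) (head-is-c lu) uv
      ; tail = λ lu lv u≢v nu nv → last-adjacent (last-In lu) (last-In lv) u≢v nu nv
      ; leaf-centre = λ lu cu → at-centre (centre-nonneighbour (last-In lu) cu)
      ; unique = unique ; rep = rep ; clique₂ = clique₂
      ; leaf₁ = let (u , iu , cu) = leaf₀ in u , lay-place (last iu) , cu }
      where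
      at-centre : ∀ {u w} → NonNeighbour u w → lay w ≡ suc N × A c w ≡ false × A u w ≡ false
      at-centre (iw , cw , wu , _) = lay-place (last iw) , cw , flip-adj wu

-- Graphs in ℋ are layered

module _ {κ : ℕ} (b : Fin (suc κ) → ℕ) where

  private
    k : ℕ
    k = 4 + κ

  extB-< : ∀ i (i< : toℕ i < suc κ) → extB k b i ≡ b (fromℕ< i<)
  extB-< i i< with toℕ i <? suc κ
  ... | yes _ = refl
  ... | no i≮ = ⊥-elim (i≮ i<)

  extB-last : ∀ i → toℕ i ≡ suc κ → extB k b i ≡ 2
  extB-last i eq with toℕ i <? suc κ
  ... | yes i< = ⊥-elim (<-irrefl eq i<)
  ... | no _ = refl

module FromChain {κ n : ℕ} (b : Fin (suc κ) → ℕ) (j : Fin (suc κ)) (bj : b j ≡ 1) (b0 : ∀ i → i ≢ j → b i ≡ 0)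
  (G : Graph n) (C : Chain n (suc κ))
  (edge : ∀ {u v} → adj G u v ≡ true → ∃ λ t → t ≤ suc κ × u ∈ Chain.bl C t × v ∈ Chain.bl C t)
  (nonsep : ∀ {t} → t ≤ suc κ → Nonsep (adj G) (Chain.bl C t))
  (critical : Critical G (4 + κ)) (D : Subset n) (cdsD : IsCDS (adj G) D)
  (∣D∣≡k : ∣ D ∣ ≡ 4 + κ)
  (count : ∀ t → HasCard (λ v → v ∈ Chain.bl C (toℕ t) × ¬ (∃ λ s → s < suc κ × v ≡ Chain.cv C s) × v ∈ D)
                         (extB (4 + κ) b t)) where

  open Chain C using (bl; cv)
  open CriticalChain G C edge nonsep critical D cdsD ∣D∣≡k using (inner; inner⁺; inner⁻; IsCv)
  open BlockShapes G C edge nonsep critical D cdsD ∣D∣≡k using (CentralShape; central)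
  open ChainLayers G C edge nonsep critical D cdsD ∣D∣≡k using (module Layers)

  private
    k K : ℕ
    k = 4 + κ
    K = suc κ

    fin≤ : ∀ {t} → t ≤ K → ∃ λ i → toℕ {suc K} i ≡ t
    fin≤ t≤K = fromℕ< (s≤s t≤K) , toℕ-fromℕ< (s≤s t≤K)

    into : ∀ t {v} → v ∈ D ∩ inner t → v ∈ bl t × ¬ IsCv v × v ∈ D
    into t v∈ with x∈p∩q⁻ D (inner t) v∈
    ... | v∈D , v∈i with inner⁻ v∈i
    ... | v∈b , ¬cv = v∈b , ¬cv , v∈D

    onto : ∀ t {v} → v ∈ bl t × ¬ IsCv v × v ∈ D → v ∈ D ∩ inner t
    onto t (v∈b , ¬cv , v∈D) = x∈p∩q⁺ (v∈D , inner⁺ v∈b ¬cv)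

    card≤ : ∀ t {t′ m} → toℕ t ≡ t′ → extB k b t ≡ m → ∣ D ∩ inner t′ ∣ ≤ m
    card≤ t refl refl = HasCard-∣∣ (D ∩ inner (toℕ t)) (count t) (into (toℕ t))

    ≤card : ∀ t {t′ m} → toℕ t ≡ t′ → extB k b t ≡ m → m ≤ ∣ D ∩ inner t′ ∣
    ≤card t refl refl = HasCard-≤∣∣ (D ∩ inner (toℕ t)) (count t) (onto (toℕ t))

    extB-at : ∀ {m} s → b s ≡ m → ∃ λ t → toℕ t ≡ toℕ s × extB k b t ≡ m
    extB-at s bs with fin≤ (<⇒≤ (toℕ<n s))
    ... | t , t≡s = t , t≡s ,
      trans (extB-< b t (subst (_< K) (sym t≡s) (toℕ<n s)))
        (trans (cong b (toℕ-injective (trans (toℕ-fromℕ< _) t≡s))) bs)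

    none : ∀ t → t < K → t ≢ toℕ j → ∣ D ∩ inner t ∣ ≤ 0
    none t t<K t≢j with extB-at (fromℕ< t<K) (b0 _ λ eq → t≢j (trans (sym (toℕ-fromℕ< t<K)) (cong toℕ eq)))
    ... | i , i≡ , e = card≤ i (trans i≡ (toℕ-fromℕ< t<K)) e

    one : ∣ D ∩ inner (toℕ j) ∣ ≤ 1 × 1 ≤ ∣ D ∩ inner (toℕ j) ∣
    one with extB-at j bj
    ... | i , i≡ , e = card≤ i i≡ e , ≤card i i≡ e

    two : 2 ≤ ∣ D ∩ inner K ∣ × ∣ D ∩ inner K ∣ ≤ 2
    two with fin≤ ≤-refl
    ... | t , t≡K = ≤card t t≡K (extB-last b t t≡K) , card≤ t t≡K (extB-last b t t≡K)

    shape : CentralShape (toℕ j)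
    shape = central (toℕ j) (toℕ<n j) (proj₁ one) (proj₂ one)
      (λ t t<j → none t (<-trans t<j (toℕ<n j)) (<⇒≢ t<j))

    with-two-stars : Layered G (suc K) (suc (toℕ j)) → Σ (Layered G (suc K) (suc (toℕ j))) TwoStars
    with-two-stars S = S , SingleStar.two-stars S critical refl (s≤s z≤n)

  opaque

    layered : Σ (Layered G (suc K) (suc (toℕ j))) TwoStars
    layered = with-two-stars (Layers.layered (toℕ<n j) shape none (proj₁ two) (proj₂ two))

module _ {κ n : ℕ} (b : Fin (suc κ) → ℕ) (j : Fin (suc κ)) (bj : b j ≡ 1) (b0 : ∀ i → i ≢ j → b i ≡ 0)
  (G : Graph n) where

  private
    k : ℕ
    k = 4 + κ

  inH⇒layered : InH k (extB k b) G → Σ (Layered G (suc (suc κ)) (suc (toℕ j))) TwoStars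
  inH⇒layered ((critical , _) , L , D , (cdsD , _ , min′) , count) =
    FromChain.layered b j bj b0 G chain edge nonsep critical D cdsD (∣D∣≡k (proj₁ critical))
      λ t → transport t (count t)
    where
    open LabelingChain G L cdsD
    ∣D∣≡k : GammaC (adj G) k → ∣ D ∣ ≡ k
    ∣D∣≡k ((E , cdsE , ∣E∣≡k) , min) = ≤-antisym (subst (∣ D ∣ ≤_) ∣E∣≡k (min′ E cdsE)) (min D cdsD)
    transport : ∀ t {m} → HasCard (λ v → v ∈ Labeling.Bl L t × ¬ IsCut (adj G) v × v ∈ D) m →
                HasCard (λ v → v ∈ bl (toℕ t) × ¬ (∃ λ s → s < suc κ × v ≡ cv s) × v ∈ D) m
    transport t (f , f-inj , Pf , onto) =
      f , f-inj , (λ i → to (Pf i)) , λ v q → onto v (from q)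
      where
      to : ∀ {v} → v ∈ Labeling.Bl L t × ¬ IsCut (adj G) v × v ∈ D →
           v ∈ bl (toℕ t) × ¬ (∃ λ s → s < suc κ × v ≡ cv s) × v ∈ D
      to (v∈ , ¬cut , v∈D) = subst (_ ∈_) (sym (bl-toℕ t)) v∈ , (λ { (s , s<K , refl) → ¬cut (cv-isCut s<K) }) , v∈D
      from : ∀ {v} → v ∈ bl (toℕ t) × ¬ (∃ λ s → s < suc κ × v ≡ cv s) × v ∈ D →
             v ∈ Labeling.Bl L t × ¬ IsCut (adj G) v × v ∈ D
      from (v∈ , ¬cv , v∈D) = subst (_ ∈_) (bl-toℕ t) v∈ , (λ c → ¬cv (isCut-cv c)) , v∈D

-- Layered graphs with two stars are critical

module LayeredCritical {n N q : ℕ} {G : Graph n} (S : Layered G N q) (stars : TwoStars S)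
  (0<q : 0 < q) (q<N : q < N) where

  open Layered S

  A : RawAdj n
  A = adj G

  flip-adj : ∀ {u v b} → A u v ≡ b → A v u ≡ b
  flip-adj e = trans (adj-sym G _ _) e

  y₁ y₂ κ₁ : Fin n
  y₁ = proj₁ stars
  y₂ = proj₁ (proj₂ stars)
  κ₁ = proj₁ clique₂

  Tail Leaf : Fin n → Set
  Tail v = lay v ≡ suc N
  Leaf v = Tail v × leaf v ≡ true

  leafY₁ : Leaf y₁
  leafY₁ = proj₁ (proj₂ (proj₂ stars))

  leafY₂ : Leaf y₂
  leafY₂ = proj₁ (proj₂ (proj₂ (proj₂ stars)))

  centres≢ : centre y₁ ≢ centre y₂
  centres≢ = proj₂ (proj₂ (proj₂ (proj₂ stars)))

  κ₁-lay : lay κ₁ ≡ q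
  κ₁-lay = proj₁ (proj₂ (proj₂ clique₂))

  q≤N : q ≤ N
  q≤N = <⇒≤ q<N

  1≤N : 1 ≤ N
  1≤N = ≤-trans 0<q q≤N

  2≤N : 2 ≤ N
  2≤N = ≤-trans (s≤s 0<q) q<N

  leaf-leaf : ∀ {u v} → Leaf u → Leaf v → u ≢ v → A u v ≡ true
  leaf-leaf (lu , fu) (lv , fv) u≢v = tail lu lv u≢v
    (λ _ fv′ → ⊥-elim (false≢true fv fv′)) (λ _ fu′ → ⊥-elim (false≢true fu fu′))

  inner-inner : ∀ {u v} → Tail u → leaf u ≡ false → Tail v → leaf v ≡ false → u ≢ v → A u v ≡ true
  inner-inner lu fu lv fv u≢v = tail lu lv u≢v
    (λ fu′ _ → ⊥-elim (false≢true fu′ fu)) (λ fv′ _ → ⊥-elim (false≢true fv′ fv))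

  leaf-inner : ∀ {u v} → Leaf u → Tail v → leaf v ≡ false → centre u ≢ v → A u v ≡ true
  leaf-inner (lu , fu) lv fv ne = tail lu lv (λ { refl → false≢true fu fv })
    (λ _ _ → ne) (λ fv′ _ → ⊥-elim (false≢true fv′ fv))

  leaf-head : ∀ {u v} → Leaf u → lay v ≡ N → A u v ≡ true
  leaf-head (lu , fu) lv = flip-adj (head-leaf lv lu fu)

  -- The star of a vertex of the tail, named by its centre.
  core : Fin n → Fin n
  core v with leaf v
  ... | true  = centre v
  ... | false = v

  core-leaf : ∀ {v} → leaf v ≡ true → core v ≡ centre v
  core-leaf {v} eq rewrite eq = refl

  -- The pair z, w dominates the whole tail and is connected, and w reaches the head because it is a
  -- leaf.
  Partner : Fin n → Fin n → Set
  Partner z w = Leaf w × A z w ≡ true × (∀ x → Tail x → x ≡ z ⊎ x ≡ w ⊎ A x z ≡ true ⊎ A x w ≡ true)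

  -- The leaf w misses nothing in the tail except its own centre, and z sees that centre because it
  -- belongs to another star or to none.
  partner : ∀ {z w} → Tail z → Leaf w → centre w ≢ core z → Partner z w
  partner {z} {w} lz lw ne = lw , zw , dominated
    where
    zw : A z w ≡ true
    zw with leaf z in fz
    ... | true  = leaf-leaf (lz , fz) lw (λ { refl → ne refl })
    ... | false = flip-adj (leaf-inner lw lz fz ne)
    dominated : ∀ x → Tail x → x ≡ z ⊎ x ≡ w ⊎ A x z ≡ true ⊎ A x w ≡ true
    dominated x lx with x ≟ z | x ≟ w | leaf x in fx
    ... | yes eq | _ | _ = inj₁ eq
    ... | no _ | yes eq | _ = inj₂ (inj₁ eq)
    ... | no _ | no x≢w | true = inj₂ (inj₂ (inj₂ (leaf-leaf (lx , fx) lw x≢w)))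
    ... | no x≢z | no x≢w | false with centre w ≟ x
    ... | no ne′ = inj₂ (inj₂ (inj₂ (flip-adj (leaf-inner lw lx fx ne′))))
    ... | yes refl with leaf z in fz
    ... | true = inj₂ (inj₂ (inj₁ (flip-adj (leaf-inner (lz , fz) lx fx (λ eq → ne (sym eq))))))
    ... | false = inj₂ (inj₂ (inj₁ (inner-inner lx fx lz fz x≢z)))

  partner-exists : ∀ {z} → Tail z → ∃ (Partner z)
  partner-exists {z} lz with centre y₁ ≟ core z
  ... | no ne = y₁ , partner lz leafY₁ ne
  ... | yes eq = y₂ , partner lz leafY₂ (λ eq′ → centres≢ (trans eq (sym eq′)))

  partner₁₂ : Partner y₁ y₂
  partner₁₂ = partner (proj₁ leafY₁) leafY₂
    (λ eq → centres≢ (sym (trans eq (core-leaf (proj₂ leafY₁)))))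

  -- Every connected dominating set has at least N + 2 vertices

  module LowerBound {D : Subset n} (dom : Dominating A D) (conn : ConnectedOn A (_∈ D)) where

    -- If layer i were avoided, the dominator of a vertex in layer 0 would lie before it and that of
    -- a vertex in the tail after it. Edges skip no layer, so D could not be connected.
    layer-hit : ∀ i → 0 < i → i ≤ N → ∃ λ d → d ∈ D × lay d ≡ i
    layer-hit i 0<i i≤N = decidable-stable (any? (λ d → (d ∈? D) ×-dec (lay d ≟ℕ i))) contra
      where
      contra : ¬ ¬ ∃ λ d → d ∈ D × lay d ≡ i
      contra none = cross lower upper
        where
        miss : ∀ {d} → d ∈ D → lay d ≢ i
        miss d∈ eq = none (_ , d∈ , eq)
        lower : ∃ λ d → d ∈ D × lay d < i
        lower with rep 0 z≤n
        ... | v , lv with dom v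
        ... | inj₁ v∈ = v , v∈ , subst (_< i) (sym lv) 0<i
        ... | inj₂ (d , d∈ , e) = d , d∈ ,
                ≤∧≢⇒< (≤-trans (far (flip-adj e)) (≤-trans (≤-reflexive (cong suc lv)) 0<i)) (miss d∈)
        upper : ∃ λ d → d ∈ D × ¬ lay d < i
        upper with dom y₁
        ... | inj₁ y∈ = y₁ , y∈ , λ lt → <⇒≱ lt (≤-trans i≤N (≤-trans (n≤1+n N) (≤-reflexive (sym (proj₁ leafY₁)))))
        ... | inj₂ (d , d∈ , e) = d , d∈ , λ lt →
                <⇒≱ lt (≤-trans i≤N (s≤s⁻¹ (≤-trans (≤-reflexive (sym (proj₁ leafY₁))) (far e))))
        cross : (∃ λ d → d ∈ D × lay d < i) → (∃ λ d → d ∈ D × ¬ lay d < i) → ⊥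
        cross (d , d∈ , lo) (d′ , d′∈ , hi) with reach-cross (λ v → lay v <? i) (conn d d′ d∈ d′∈) lo hi
        ... | a , b , _ , b∈ , a<i , b≮i , e = miss b∈ (≤-antisym (≤-trans (far (flip-adj e)) a<i) (≮⇒≥ b≮i))

    tail-neighbour : ∀ {w d} → Tail w → leaf w ≡ false → A w d ≡ true → Tail d
    tail-neighbour {w} {d} lw fw e with m≤n⇒m<n∨m≡n (lay≤ d)
    ... | inj₂ ld = ld
    ... | inj₁ lt = ⊥-elim (false≢true (head-leaf⁻
            (≤-antisym (s≤s⁻¹ lt) (s≤s⁻¹ (≤-trans (≤-reflexive (sym lw)) (far e)))) lw (flip-adj e)) fw)

    inner-dominated : ∀ {w} → Tail w → leaf w ≡ false → ∃ λ d → d ∈ D × Tail d × (d ≡ w ⊎ A w d ≡ true)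
    inner-dominated {w} lw fw with dom w
    ... | inj₁ w∈ = w , w∈ , lw , inj₁ refl
    ... | inj₂ (d , d∈ , e) = d , d∈ , tail-neighbour lw fw e , inj₂ e

    -- A star centre is dominated only from the tail, which gives y. Were y alone there, it would
    -- have to be a leaf in order to be connected to layer N; but then its own centre would stay
    -- undominated.
    two-in-tail : ∃ λ y → ∃ λ y′ → (y ∈ D × Tail y) × (y′ ∈ D × Tail y′) × y ≢ y′
    two-in-tail with leaf-centre (proj₁ leafY₁) (proj₂ leafY₁)
    ... | lc , fc , _ with inner-dominated lc fc
    ... | y , y∈ , ly , _ with any? (λ y′ → (y′ ∈? D) ×-dec (lay y′ ≟ℕ suc N) ×-dec ¬? (y ≟ y′))
    ... | yes (y′ , y′∈ , ly′ , ne) = y , y′ , (y∈ , ly) , (y′∈ , ly′) , ne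
    ... | no none = ⊥-elim (alone (leaf-centre ly leafY))
      where
      only : ∀ {x} → x ∈ D → Tail x → x ≡ y
      only {x} x∈ lx = decidable-stable (x ≟ y) λ ne → none (x , x∈ , lx , (ne ∘ sym))
      leafY : leaf y ≡ true
      leafY with layer-hit N 1≤N ≤-refl
      ... | d , d∈ , ld with reach-cross (λ v → lay v ≟ℕ suc N) (conn y d y∈ d∈) ly
                               (λ eq → <-irrefl (trans (sym ld) eq) ≤-refl)
      ... | a , b , a∈ , _ , la , ¬lb , e with only a∈ la
      ... | refl = head-leaf⁻ (≤-antisym (s≤s⁻¹ (≤∧≢⇒< (lay≤ b) ¬lb))
                     (s≤s⁻¹ (≤-trans (≤-reflexive (sym la)) (far e)))) la (flip-adj e)
      alone : lay (centre y) ≡ suc N × leaf (centre y) ≡ false × A y (centre y) ≡ false → ⊥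
      alone (lw , fw , nonadj) with inner-dominated lw fw
      ... | d , d∈ , ld , adj-or with only d∈ ld
      ... | refl with adj-or
      ... | inj₁ eq = false≢true leafY (trans (cong leaf eq) fw)
      ... | inj₂ e = false≢true (flip-adj e) nonadj

    lower-bound : 2 + N ≤ ∣ D ∣
    lower-bound with two-in-tail
    ... | y , y′ , (y∈ , ly) , (y′∈ , ly′) , y≢y′ = hits⇒≤∣∣ D g hit
      where
      g′ : ∀ v → Dec (v ≡ y′) → ℕ
      -- The second tail vertex gets a label of its own; the layers 1..N + 1 are renumbered to 0..N.
      g′ v (yes _) = suc N
      g′ v (no _)  = lay v ∸ 1
      g : Fin n → ℕ
      g v = g′ v (v ≟ y′)
      g-at : g y′ ≡ suc N
      g-at with y′ ≟ y′
      ... | yes _ = refl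
      ... | no ne = ⊥-elim (ne refl)
      g-off : ∀ {v} → v ≢ y′ → g v ≡ lay v ∸ 1
      g-off {v} ne with v ≟ y′
      ... | yes eq = ⊥-elim (ne eq)
      ... | no _ = refl
      hit : ∀ i → i < 2 + N → ∃ λ d → d ∈ D × g d ≡ i
      hit i i< with m≤n⇒m<n∨m≡n (s≤s⁻¹ i<)
      ... | inj₂ refl = y′ , y′∈ , g-at
      ... | inj₁ lt with m≤n⇒m<n∨m≡n (s≤s⁻¹ lt)
      ... | inj₂ refl = y , y∈ , trans (g-off y≢y′) (cong (_∸ 1) ly)
      ... | inj₁ i<N with layer-hit (suc i) (s≤s z≤n) i<N
      ... | d , d∈ , ld = d , d∈ , trans (g-off d≢y′) (cong (_∸ 1) ld)
        where
        d≢y′ : d ≢ y′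
        d≢y′ refl = <-irrefl (trans (sym ld) ly′) (s≤s i<N)

  -- A spine picks one vertex from each of the layers 0..N; c is its vertex in layer q, and the junk value beyond N.
  module Spine (c : Fin n) (lc : lay c ≡ q) where

    ρ : ℕ → Fin n
    ρ i with i ≟ℕ q | i ≤? N
    ... | yes _ | _      = c
    ... | no _  | yes i≤ = proj₁ (rep i i≤)
    ... | no _  | no _   = c

    ρ-lay : ∀ {i} → i ≤ N → lay (ρ i) ≡ i
    ρ-lay {i} i≤N with i ≟ℕ q | i ≤? N
    ... | yes eq | _      = trans lc (sym eq)
    ... | no _   | yes i≤ = proj₂ (rep i i≤)
    ... | no _   | no i≰  = ⊥-elim (i≰ i≤N)

    ρ-q : ∀ {i} → i ≡ q → ρ i ≡ c
    ρ-q {i} eq with i ≟ℕ q | i ≤? N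
    ... | yes _ | _ = refl
    ... | no ne | _ = ⊥-elim (ne eq)

    ρ-unique : ∀ {v} → lay v ≤ N → (lay v ≡ q → v ≡ c) → ρ (lay v) ≡ v
    ρ-unique {v} lv≤ at-q = by-layer (lay v ≟ℕ q)
      where
      by-layer : Dec (lay v ≡ q) → ρ (lay v) ≡ v
      by-layer (no ne) = unique (ρ-lay lv≤) lv≤ ne
      by-layer (yes eq) = trans (ρ-q eq) (sym (at-q eq))

    near-or-equal : ∀ {v i} → lay v ≤ N → i ≤ N → i ≤ suc (lay v) → lay v ≤ suc i → v ≡ ρ i ⊎ A v (ρ i) ≡ true
    near-or-equal {v} {i} lv≤ i≤N p r with v ≟ ρ i
    ... | yes eq = inj₁ eq
    ... | no ne with ≤-total (lay v) i
    ... | inj₁ le = inj₂ (near ne (subst (_≤ N) (sym (ρ-lay i≤N)) i≤N)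
            (subst (lay v ≤_) (sym (ρ-lay i≤N)) le) (subst (_≤ suc (lay v)) (sym (ρ-lay i≤N)) p))
    ... | inj₂ ge = inj₂ (flip-adj (near (ne ∘ sym) lv≤
            (subst (_≤ lay v) (sym (ρ-lay i≤N)) ge) (subst (λ l → lay v ≤ suc l) (sym (ρ-lay i≤N)) r)))

    ρ-step : ∀ {i} → suc i ≤ N → A (ρ i) (ρ (suc i)) ≡ true
    ρ-step {i} i<N with near-or-equal {ρ i} {suc i} (≤-trans (≤-reflexive (ρ-lay (<⇒≤ i<N))) (<⇒≤ i<N)) i<N
        (s≤s (≤-reflexive (sym (ρ-lay (<⇒≤ i<N))))) (≤-trans (≤-reflexive (ρ-lay (<⇒≤ i<N))) (m≤n⇒m≤1+n (n≤1+n i)))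
    ... | inj₂ e = e
    ... | inj₁ eq = ⊥-elim (<-irrefl (trans (sym (ρ-lay (<⇒≤ i<N))) (trans (cong lay eq) (ρ-lay i<N))) ≤-refl)

    seg : ℕ → ℕ → List (Fin n)
    seg a zero    = []
    seg a (suc m) = ρ a ∷ seg (suc a) m

    length-seg : ∀ a m → length (seg a m) ≡ m
    length-seg a zero    = refl
    length-seg a (suc m) = cong suc (length-seg (suc a) m)

    ∈-seg⁺ : ∀ {a m i} → a ≤ i → i < a + m → ρ i ∈ˡ seg a m
    ∈-seg⁺ {a} {zero} a≤i i< = ⊥-elim (<⇒≱ i< (≤-trans (≤-reflexive (+-identityʳ a)) a≤i))
    ∈-seg⁺ {a} {suc m} {i} a≤i i< with m≤n⇒m<n∨m≡n a≤i
    ... | inj₂ refl = Any.here refl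
    ... | inj₁ a<i = Any.there (∈-seg⁺ a<i (≤-trans i< (≤-reflexive (+-suc a m))))

    ∈-seg⁻ : ∀ {a m x} → x ∈ˡ seg a m → ∃ λ i → a ≤ i × i < a + m × x ≡ ρ i
    ∈-seg⁻ {a} {suc m} (Any.here refl) = a , ≤-refl , ≤-trans (s≤s (m≤m+n a m)) (≤-reflexive (sym (+-suc a m))) , refl
    ∈-seg⁻ {a} {suc m} (Any.there x∈) with ∈-seg⁻ {suc a} {m} x∈
    ... | i , a<i , i< , eq = i , <⇒≤ a<i , ≤-trans i< (≤-reflexive (sym (+-suc a m))) , eq

    -- Smaller connected dominating sets after an edge is added

    module Gain (A′ : RawAdj n) (A′-sym : ∀ u v → A′ u v ≡ A′ v u) (A⊆A′ : ∀ {u v} → A u v ≡ true → A′ u v ≡ true) where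

      flip′ : ∀ {u v} → A′ u v ≡ true → A′ v u ≡ true
      flip′ e = trans (A′-sym _ _) e

      climb : ∀ {D : Subset n} {a b} → b ≤ N → (∀ i → a ≤ i → i ≤ b → ρ i ∈ D) → ∀ i → a ≤ i → i ≤ b →
              Reach A′ (_∈ D) (ρ i) (ρ b)
      climb {D} {a} {b} b≤N seg∈ i a≤i i≤b = go (b ∸ i) i a≤i (m∸n+n≡m i≤b)
        where
        go : ∀ m i → a ≤ i → m + i ≡ b → Reach A′ (_∈ D) (ρ i) (ρ b)
        go zero i a≤i refl = here (seg∈ i a≤i ≤-refl)
        go (suc m) i a≤i eq = step (seg∈ i a≤i (<⇒≤ i<b)) (A⊆A′ (ρ-step (≤-trans i<b b≤N)))
          (go m (suc i) (m≤n⇒m≤1+n a≤i) (trans (+-suc m i) eq))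
          where
          i<b : i < b
          i<b = ≤-trans (s≤s (m≤n+m i m)) (≤-reflexive eq)

      by-spine : ∀ {D : Subset n} {v i} → lay v ≤ N → i ≤ N → i ≤ suc (lay v) → lay v ≤ suc i → ρ i ∈ D →
                 v ∈ D ⊎ Σ (Fin n) λ u → u ∈ D × A′ v u ≡ true
      by-spine {D} lv≤ i≤N p r ρ∈ with near-or-equal lv≤ i≤N p r
      ... | inj₁ refl = inj₁ ρ∈
      ... | inj₂ e = inj₂ (_ , ρ∈ , A⊆A′ e)

      by-pair : ∀ {D : Subset n} {z w} → Partner z w → z ∈ D → w ∈ D → ∀ v → Tail v →
                v ∈ D ⊎ Σ (Fin n) λ u → u ∈ D × A′ v u ≡ true
      by-pair (_ , _ , dominated) z∈ w∈ v lv with dominated v lv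
      ... | inj₁ refl = inj₁ z∈
      ... | inj₂ (inj₁ refl) = inj₁ w∈
      ... | inj₂ (inj₂ (inj₁ e)) = inj₂ (_ , z∈ , A⊆A′ e)
      ... | inj₂ (inj₂ (inj₂ e)) = inj₂ (_ , w∈ , A⊆A′ e)

      dominating : ∀ {D : Subset n} → (∀ v → lay v ≤ N → v ∈ D ⊎ Σ (Fin n) λ u → u ∈ D × A′ v u ≡ true) →
                   (∀ v → Tail v → v ∈ D ⊎ Σ (Fin n) λ u → u ∈ D × A′ v u ≡ true) → Dominating A′ D
      dominating spine tl v with m≤n⇒m<n∨m≡n (lay≤ v)
      ... | inj₁ lt = spine v (s≤s⁻¹ lt)
      ... | inj₂ lv = tl v lv

      -- One vertex from each of the layers 1..N dominates all layers up to N, layer 0 being seen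
      -- from layer 1. What remains is to attach `zs` to the head and to dominate the tail.
      full-spine : ∀ {zs : List (Fin n)} → (∀ {z} → z ∈ˡ zs → Reach A′ (_∈ fromList (seg 1 N ++ zs)) z (ρ N)) →
        (∀ v → Tail v → v ∈ fromList (seg 1 N ++ zs) ⊎ Σ (Fin n) λ u → u ∈ fromList (seg 1 N ++ zs) × A′ v u ≡ true) →
        IsCDS A′ (fromList (seg 1 N ++ zs))
      full-spine {zs} attach tl = dominating spine tl , connected-via A′-sym (ρ N) toHub
        where
        D : Subset n
        D = fromList (seg 1 N ++ zs)
        ρ∈ : ∀ i → 1 ≤ i → i ≤ N → ρ i ∈ D
        ρ∈ i 1≤i i≤N = ∈-fromList⁺ (∈-++⁺ˡ (∈-seg⁺ 1≤i (s≤s i≤N)))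
        spine : ∀ v → lay v ≤ N → v ∈ D ⊎ Σ (Fin n) λ u → u ∈ D × A′ v u ≡ true
        spine v lv≤ with lay v ≟ℕ 0
        ... | yes eq = by-spine lv≤ 1≤N (s≤s z≤n) (≤-trans (≤-reflexive eq) z≤n) (ρ∈ 1 ≤-refl 1≤N)
        ... | no ne = by-spine lv≤ lv≤ (n≤1+n _) (n≤1+n _) (ρ∈ (lay v) (n≢0⇒n>0 ne) lv≤)
        toHub : ∀ x → x ∈ D → Reach A′ (_∈ D) x (ρ N)
        toHub x x∈ with ∈-++⁻ (seg 1 N) (∈-fromList⁻ x∈)
        ... | inj₂ z∈ = attach z∈
        ... | inj₁ s∈ with ∈-seg⁻ s∈
        ... | i , 1≤i , i< , refl = climb ≤-refl ρ∈ i 1≤i (s≤s⁻¹ i<)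

      -- For the added edges that let the head and a single tail vertex dominate the tail, which
      -- spares the second tail vertex.
      one-tail : ∀ z → A′ (ρ N) z ≡ true → (∀ x → Tail x → x ≡ z ⊎ A′ x (ρ N) ≡ true ⊎ A′ x z ≡ true) →
                 IsCDS A′ (fromList (seg 1 N ++ z ∷ []))
      one-tail z hz dominated = full-spine attach tl
        where
        D : Subset n
        D = fromList (seg 1 N ++ z ∷ [])
        z∈ : z ∈ D
        z∈ = ∈-fromList⁺ (∈-++⁺ʳ (seg 1 N) (Any.here refl))
        h∈ : ρ N ∈ D
        h∈ = ∈-fromList⁺ (∈-++⁺ˡ (∈-seg⁺ 1≤N ≤-refl))
        attach : ∀ {x} → x ∈ˡ z ∷ [] → Reach A′ (_∈ D) x (ρ N)
        attach (Any.here refl) = reach-edge z∈ h∈ (flip′ hz)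
        tl : ∀ v → Tail v → v ∈ D ⊎ Σ (Fin n) λ u → u ∈ D × A′ v u ≡ true
        tl v lv with dominated v lv
        ... | inj₁ refl = inj₁ z∈
        ... | inj₂ (inj₁ e) = inj₂ (_ , h∈ , e)
        ... | inj₂ (inj₂ e) = inj₂ (_ , z∈ , e)

      two-tails : IsCDS A′ (fromList (seg 1 N ++ y₁ ∷ y₂ ∷ []))
      two-tails = full-spine attach (by-pair partner₁₂ y₁∈ y₂∈)
        where
        D : Subset n
        D = fromList (seg 1 N ++ y₁ ∷ y₂ ∷ [])
        y₁∈ : y₁ ∈ D
        y₁∈ = ∈-fromList⁺ (∈-++⁺ʳ (seg 1 N) (Any.here refl))
        y₂∈ : y₂ ∈ D
        y₂∈ = ∈-fromList⁺ (∈-++⁺ʳ (seg 1 N) (Any.there (Any.here refl)))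
        h∈ : ρ N ∈ D
        h∈ = ∈-fromList⁺ (∈-++⁺ˡ (∈-seg⁺ 1≤N ≤-refl))
        attach : ∀ {x} → x ∈ˡ y₁ ∷ y₂ ∷ [] → Reach A′ (_∈ D) x (ρ N)
        attach (Any.here refl) = reach-edge y₁∈ h∈ (A⊆A′ (leaf-head leafY₁ (ρ-lay ≤-refl)))
        attach (Any.there (Any.here refl)) = reach-edge y₂∈ h∈ (A⊆A′ (leaf-head leafY₂ (ρ-lay ≤-refl)))

      -- Layer p + 1 is spared: the new edge bridges it, and layer p + 2 dominates it. If p = 0, the
      -- spared layer is the one that dominated layer 0; this layer is a single vertex, an end of
      -- the new edge, and is seen by `ρ r`.
      shortcut : ∀ {p r} → suc (suc p) ≤ r → r ≤ N → A′ (ρ p) (ρ r) ≡ true →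
                 IsCDS A′ (fromList (seg 1 p ++ seg (2 + p) (N ∸ suc p) ++ y₁ ∷ y₂ ∷ []))
      shortcut {p} {r} p<r r≤N pr = dominating spine (by-pair partner₁₂ y₁∈ y₂∈) , connected-via A′-sym (ρ N) toHub
        where
        D : Subset n
        D = fromList (seg 1 p ++ seg (2 + p) (N ∸ suc p) ++ y₁ ∷ y₂ ∷ [])
        p+2≤N : 2 + p ≤ N
        p+2≤N = ≤-trans p<r r≤N
        end : 2 + p + (N ∸ suc p) ≡ suc N
        end = cong suc (m+[n∸m]≡n (≤-trans (n≤1+n _) p+2≤N))
        low∈ : ∀ i → 1 ≤ i → i ≤ p → ρ i ∈ D
        low∈ i 1≤i i≤p = ∈-fromList⁺ (∈-++⁺ˡ (∈-seg⁺ 1≤i (s≤s i≤p)))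
        high∈ : ∀ i → 2 + p ≤ i → i ≤ N → ρ i ∈ D
        high∈ i p≤i i≤N = ∈-fromList⁺ (∈-++⁺ʳ (seg 1 p) (∈-++⁺ˡ (∈-seg⁺ p≤i (subst (i <_) (sym end) (s≤s i≤N)))))
        y₁∈ : y₁ ∈ D
        y₁∈ = ∈-fromList⁺ (∈-++⁺ʳ (seg 1 p) (∈-++⁺ʳ (seg (2 + p) (N ∸ suc p)) (Any.here refl)))
        y₂∈ : y₂ ∈ D
        y₂∈ = ∈-fromList⁺ (∈-++⁺ʳ (seg 1 p) (∈-++⁺ʳ (seg (2 + p) (N ∸ suc p)) (Any.there (Any.here refl))))
        h∈ : ρ N ∈ D
        h∈ = high∈ N p+2≤N ≤-refl
        p≤N : p ≤ N
        p≤N = ≤-trans (≤-trans (n≤1+n _) (n≤1+n _)) p+2≤N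
        spine : ∀ v → lay v ≤ N → v ∈ D ⊎ Σ (Fin n) λ u → u ∈ D × A′ v u ≡ true
        spine v lv≤ with <-cmp (lay v) (suc p)
        ... | tri> _ _ gt = by-spine lv≤ lv≤ (n≤1+n _) (n≤1+n _) (high∈ (lay v) gt lv≤)
        ... | tri≈ _ eq _ = by-spine lv≤ p+2≤N (s≤s (≤-reflexive (sym eq)))
                (≤-trans (≤-reflexive eq) (≤-trans (n≤1+n _) (n≤1+n _))) (high∈ (2 + p) ≤-refl p+2≤N)
        ... | tri< lt _ _ with lay v ≟ℕ 0
        ... | no ne = by-spine lv≤ lv≤ (n≤1+n _) (n≤1+n _) (low∈ (lay v) (n≢0⇒n>0 ne) (s≤s⁻¹ lt))
        ... | yes eq with p ≟ℕ 0
        ... | no p≢0 = by-spine lv≤ 1≤N (s≤s z≤n) (≤-trans (≤-reflexive eq) z≤n) (low∈ 1 ≤-refl (n≢0⇒n>0 p≢0))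
        ... | yes refl = inj₂ (ρ r , high∈ r p<r r≤N , subst (λ x → A′ x (ρ r) ≡ true) (sym v≡) pr)
          where
          v≡ : v ≡ ρ 0
          v≡ = unique (trans eq (sym (ρ-lay z≤n))) (≤-trans (≤-reflexive (ρ-lay z≤n)) z≤n)
                 (λ l → <-irrefl (trans (sym (ρ-lay z≤n)) l) 0<q)
        toHub : ∀ x → x ∈ D → Reach A′ (_∈ D) x (ρ N)
        toHub x x∈ with ∈-++⁻ (seg 1 p) (∈-fromList⁻ x∈)
        ... | inj₁ s∈ = low (∈-seg⁻ s∈)
          where
          low : (∃ λ i → 1 ≤ i × i < suc p × x ≡ ρ i) → Reach A′ (_∈ D) x (ρ N)
          low (i , 1≤i , i≤p , refl) = reach-trans (climb p≤N low∈ i 1≤i (s≤s⁻¹ i≤p))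
            (step (low∈ p (≤-trans 1≤i (s≤s⁻¹ i≤p)) ≤-refl) pr (climb ≤-refl high∈ r p<r r≤N))
        ... | inj₂ rest∈ with ∈-++⁻ (seg (2 + p) (N ∸ suc p)) rest∈
        ... | inj₂ (Any.here refl) = reach-edge y₁∈ h∈ (A⊆A′ (leaf-head leafY₁ (ρ-lay ≤-refl)))
        ... | inj₂ (Any.there (Any.here refl)) = reach-edge y₂∈ h∈ (A⊆A′ (leaf-head leafY₂ (ρ-lay ≤-refl)))
        ... | inj₁ s∈ with ∈-seg⁻ s∈
        ... | i , p≤i , i< , refl = climb ≤-refl high∈ i p≤i (s≤s⁻¹ (subst (i <_) end i<))

      -- The head is spared: the new edge attaches the tail pair to the spine, the pair dominates
      -- the tail by itself, and layer N is seen from layer N - 1.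
      skip-head : ∀ {p z w} → 1 ≤ p → p < N → Tail z → Partner z w → A′ (ρ p) z ≡ true →
                  IsCDS A′ (fromList (seg 1 (N ∸ 1) ++ z ∷ w ∷ []))
      skip-head {p} {z} {w} 1≤p p<N lz pw pz = dominating spine (by-pair pw z∈ w∈) , connected-via A′-sym (ρ p) toHub
        where
        D : Subset n
        D = fromList (seg 1 (N ∸ 1) ++ z ∷ w ∷ [])
        end : suc (N ∸ 1) ≡ N
        end = m+[n∸m]≡n 1≤N
        ρ∈ : ∀ i → 1 ≤ i → i ≤ N ∸ 1 → ρ i ∈ D
        ρ∈ i 1≤i i≤ = ∈-fromList⁺ (∈-++⁺ˡ (∈-seg⁺ 1≤i (s≤s i≤)))
        z∈ : z ∈ D
        z∈ = ∈-fromList⁺ (∈-++⁺ʳ (seg 1 (N ∸ 1)) (Any.here refl))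
        w∈ : w ∈ D
        w∈ = ∈-fromList⁺ (∈-++⁺ʳ (seg 1 (N ∸ 1)) (Any.there (Any.here refl)))
        pred≤ : ∀ {i} → i < N → i ≤ N ∸ 1
        pred≤ i<N = s≤s⁻¹ (subst (_ <_) (sym end) i<N)
        spine : ∀ v → lay v ≤ N → v ∈ D ⊎ Σ (Fin n) λ u → u ∈ D × A′ v u ≡ true
        spine v lv≤ with lay v ≟ℕ 0 | m≤n⇒m<n∨m≡n lv≤
        ... | yes eq | _ = by-spine lv≤ 1≤N (s≤s z≤n) (≤-trans (≤-reflexive eq) z≤n) (ρ∈ 1 ≤-refl (pred≤ 2≤N))
        ... | no ne | inj₁ lt = by-spine lv≤ lv≤ (n≤1+n _) (n≤1+n _) (ρ∈ (lay v) (n≢0⇒n>0 ne) (pred≤ lt))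
        ... | no ne | inj₂ eq = by-spine lv≤ (m∸n≤m N 1) (≤-trans (m∸n≤m N 1) (≤-trans (≤-reflexive (sym eq)) (n≤1+n _)))
                (≤-trans lv≤ (≤-reflexive (sym end))) (ρ∈ (N ∸ 1) (pred≤ 2≤N) ≤-refl)
        toHub : ∀ x → x ∈ D → Reach A′ (_∈ D) x (ρ p)
        toHub x x∈ with ∈-++⁻ (seg 1 (N ∸ 1)) (∈-fromList⁻ x∈)
        ... | inj₂ (Any.here refl) = reach-edge z∈ (ρ∈ p 1≤p (pred≤ p<N)) (flip′ pz)
        ... | inj₂ (Any.there (Any.here refl)) =
                step w∈ (A⊆A′ (flip-adj (proj₁ (proj₂ pw)))) (reach-edge z∈ (ρ∈ p 1≤p (pred≤ p<N)) (flip′ pz))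
        ... | inj₁ s∈ with ∈-seg⁻ s∈
        ... | i , 1≤i , i< , refl with ≤-total i p
        ... | inj₁ i≤p = climb (<⇒≤ p<N) (λ l 1≤l l≤p → ρ∈ l 1≤l (≤-trans l≤p (pred≤ p<N))) i 1≤i i≤p
        ... | inj₂ p≤i = reach-sym A′-sym (climb (≤-trans (s≤s⁻¹ i<) (m∸n≤m N 1))
                (λ l 1≤l l≤i → ρ∈ l 1≤l (≤-trans l≤i (s≤s⁻¹ i<))) p 1≤p p≤i)

      -- Layer 1 is spared: layer 0 is a single vertex and is now seen by z, while layer 1 is seen
      -- from layer 2. The pair stays connected to the head through the leaf w.
      skip-first : ∀ {z w} → Tail z → Partner z w → A′ (ρ 0) z ≡ true → IsCDS A′ (fromList (seg 2 (N ∸ 1) ++ z ∷ w ∷ []))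
      skip-first {z} {w} lz pw 0z = dominating spine (by-pair pw z∈ w∈) , connected-via A′-sym (ρ N) toHub
        where
        D : Subset n
        D = fromList (seg 2 (N ∸ 1) ++ z ∷ w ∷ [])
        end : 2 + (N ∸ 1) ≡ suc N
        end = cong suc (m+[n∸m]≡n 1≤N)
        ρ∈ : ∀ i → 2 ≤ i → i ≤ N → ρ i ∈ D
        ρ∈ i 2≤i i≤N = ∈-fromList⁺ (∈-++⁺ˡ (∈-seg⁺ 2≤i (subst (i <_) (sym end) (s≤s i≤N))))
        z∈ : z ∈ D
        z∈ = ∈-fromList⁺ (∈-++⁺ʳ (seg 2 (N ∸ 1)) (Any.here refl))
        w∈ : w ∈ D
        w∈ = ∈-fromList⁺ (∈-++⁺ʳ (seg 2 (N ∸ 1)) (Any.there (Any.here refl)))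
        wh : Reach A′ (_∈ D) w (ρ N)
        wh = reach-edge w∈ (ρ∈ N 2≤N ≤-refl) (A⊆A′ (leaf-head (proj₁ pw) (ρ-lay ≤-refl)))
        spine : ∀ v → lay v ≤ N → v ∈ D ⊎ Σ (Fin n) λ u → u ∈ D × A′ v u ≡ true
        spine v lv≤ with <-cmp (lay v) 1
        ... | tri> _ _ gt = by-spine lv≤ lv≤ (n≤1+n _) (n≤1+n _) (ρ∈ (lay v) gt lv≤)
        ... | tri≈ _ eq _ = by-spine lv≤ 2≤N (s≤s (≤-reflexive (sym eq))) (≤-trans (≤-reflexive eq) (s≤s z≤n)) (ρ∈ 2 ≤-refl 2≤N)
        ... | tri< lt _ _ = inj₂ (z , z∈ , subst (λ x → A′ x z ≡ true) (sym v≡) 0z)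
          where
          v≡ : v ≡ ρ 0
          v≡ = unique (trans (n≤0⇒n≡0 (s≤s⁻¹ lt)) (sym (ρ-lay z≤n))) (≤-trans (≤-reflexive (ρ-lay z≤n)) z≤n)
                 (λ l → <-irrefl (trans (sym (ρ-lay z≤n)) l) 0<q)
        toHub : ∀ x → x ∈ D → Reach A′ (_∈ D) x (ρ N)
        toHub x x∈ with ∈-++⁻ (seg 2 (N ∸ 1)) (∈-fromList⁻ x∈)
        ... | inj₂ (Any.here refl) = step z∈ (A⊆A′ (proj₁ (proj₂ pw))) wh
        ... | inj₂ (Any.there (Any.here refl)) = wh
        ... | inj₁ s∈ with ∈-seg⁻ s∈
        ... | i , 2≤i , i< , refl = climb ≤-refl ρ∈ i 2≤i (s≤s⁻¹ (subst (i <_) end i<))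

  module _ (A′ : RawAdj n) (A′-sym : ∀ u v → A′ u v ≡ A′ v u) (A⊆A′ : ∀ {u v} → A u v ≡ true → A′ u v ≡ true) where

    Gained : Set
    Gained = Σ (Subset n) λ D → IsCDS A′ D × ∣ D ∣ < 2 + N

    -- The spine has to pass through those ends of the new edge that lie in layers up to N. A choice
    -- exists only in layer q, and at most one end is there: two ends in layers up to N are at least
    -- two layers apart, as `near` would join them otherwise.
    gain : ∀ {u v} → u ≢ v → A u v ≡ false → A′ u v ≡ true → lay u ≤ lay v → Gained
    gain {u} {v} u≢v nonadj uv u≤v with m≤n⇒m<n∨m≡n (lay≤ v)
    ... | inj₁ lt = within (lay u ≟ℕ q) (lay v ≟ℕ q)
      where
      lv≤ : lay v ≤ N
      lv≤ = s≤s⁻¹ lt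
      gap : 2 + lay u ≤ lay v
      gap = ≰⇒> λ le → false≢true (near u≢v lv≤ u≤v le) nonadj
      use : ∀ c (lc : lay c ≡ q) → (lay u ≡ q → u ≡ c) → (lay v ≡ q → v ≡ c) → Gained
      use c lc u-at v-at = _ , shortcut gap lv≤ (trans (cong₂ A′ (ρ-unique (≤-trans u≤v lv≤) u-at) (ρ-unique lv≤ v-at)) uv) ,
        s≤s (≤-trans (∣fromList∣≤ _) (≤-reflexive len))
        where
        open Spine c lc
        open Gain A′ A′-sym A⊆A′
        len : length (seg 1 (lay u) ++ seg (2 + lay u) (N ∸ suc (lay u)) ++ y₁ ∷ y₂ ∷ []) ≡ 1 + N
        len = begin
          length (seg 1 (lay u) ++ seg (2 + lay u) (N ∸ suc (lay u)) ++ y₁ ∷ y₂ ∷ [])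
            ≡⟨ length-++ (seg 1 (lay u)) ⟩
          length (seg 1 (lay u)) + length (seg (2 + lay u) (N ∸ suc (lay u)) ++ y₁ ∷ y₂ ∷ [])
            ≡⟨ cong₂ _+_ (length-seg 1 (lay u)) (trans (length-++ (seg (2 + lay u) (N ∸ suc (lay u))))
                 (trans (cong (_+ 2) (length-seg (2 + lay u) (N ∸ suc (lay u)))) (+-comm _ 2))) ⟩
          lay u + (2 + (N ∸ suc (lay u)))       ≡⟨ +-suc (lay u) _ ⟩
          1 + (lay u + (1 + (N ∸ suc (lay u)))) ≡⟨ cong (1 +_) (+-suc (lay u) _) ⟩
          1 + (suc (lay u) + (N ∸ suc (lay u))) ≡⟨ cong (1 +_) (m+[n∸m]≡n (≤-trans (n≤1+n _) (≤-trans gap lv≤))) ⟩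
          1 + N ∎
          where open ≡-Reasoning
      within : Dec (lay u ≡ q) → Dec (lay v ≡ q) → Gained
      within (yes lu) _ = use u lu (λ _ → refl) (λ lv → ⊥-elim (<⇒≱ gap (≤-trans (≤-reflexive (trans lv (sym lu))) (n≤1+n _))))
      within (no nu) (yes lv) = use v lv (λ lu → ⊥-elim (nu lu)) (λ _ → refl)
      within (no nu) (no nv) = use κ₁ κ₁-lay (λ lu → ⊥-elim (nu lu)) (λ lv → ⊥-elim (nv lv))
    ... | inj₂ lv = to-tail (<-cmp (lay u) N)
      where
      1+N : ∀ (xs : List (Fin n)) → length xs ≡ suc N → ∣ fromList xs ∣ < 2 + N
      1+N xs eq = s≤s (≤-trans (∣fromList∣≤ xs) (≤-reflexive eq))
      from-spine : lay u ≤ N → ∀ c (lc : lay c ≡ q) → (lay u ≡ q → u ≡ c) → Gained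
      from-spine lu≤ c lc u-at = by-layer (lay u ≟ℕ 0) (<-cmp (lay u) N) (partner-exists lv)
        where
        open Spine c lc
        open Gain A′ A′-sym A⊆A′
        ρu : ρ (lay u) ≡ u
        ρu = ρ-unique lu≤ u-at
        ρv : A′ (ρ (lay u)) v ≡ true
        ρv = subst (λ x → A′ x v ≡ true) (sym ρu) uv
        len : ∀ a {z w} → length (seg a (N ∸ 1) ++ z ∷ w ∷ []) ≡ suc N
        len a = trans (length-++ (seg a (N ∸ 1))) (trans (cong (_+ 2) (length-seg a (N ∸ 1)))
                  (trans (+-comm _ 2) (cong suc (m+[n∸m]≡n 1≤N))))
        by-layer : Dec (lay u ≡ 0) → Tri (lay u < N) (lay u ≡ N) (N < lay u) → ∃ (Partner v) → Gained
        by-layer (yes eq) _ (w , pw) = _ , skip-first lv pw (subst (λ l → A′ (ρ l) v ≡ true) eq ρv) , 1+N _ (len 2)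
        by-layer (no ne) (tri< lt _ _) (w , pw) = _ , skip-head (n≢0⇒n>0 ne) lt lv pw ρv , 1+N _ (len 1)
        by-layer (no ne) (tri> _ _ gt) _ = ⊥-elim (<⇒≱ gt lu≤)
        -- The head did not see v, so v is no leaf. Now the head sees all leaves and v all other
        -- vertices of the tail.
        by-layer (no ne) (tri≈ _ eq _) _ = _ , one-tail v (subst (λ l → A′ (ρ l) v ≡ true) eq ρv) dominated ,
            1+N _ (trans (length-++ (seg 1 N)) (trans (cong (_+ 1) (length-seg 1 N)) (+-comm _ 1)))
          where
          fv : leaf v ≡ false
          fv = Bool.¬-not λ fv → false≢true (head-leaf eq lv fv) nonadj
          dominated : ∀ x → Tail x → x ≡ v ⊎ A′ x (ρ N) ≡ true ⊎ A′ x v ≡ true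
          dominated x lx with x ≟ v | leaf x in fx
          ... | yes p | _ = inj₁ p
          ... | no _ | true = inj₂ (inj₁ (A⊆A′ (leaf-head (lx , fx) (ρ-lay ≤-refl))))
          ... | no x≢v | false = inj₂ (inj₂ (A⊆A′ (inner-inner lx fx lv fv x≢v)))
      choose : lay u ≤ N → Dec (lay u ≡ q) → Gained
      choose lu≤ (yes lu) = from-spine lu≤ u lu (λ _ → refl)
      choose lu≤ (no nu) = from-spine lu≤ κ₁ κ₁-lay (λ lu → ⊥-elim (nu lu))
      -- A leaf joined to its own centre sees every non-leaf of the tail; the head sees the leaves.
      star-edge : ∀ {x c} → Leaf x → Tail c → leaf c ≡ false → centre x ≡ c → A′ x c ≡ true → Gained
      star-edge {x} {c} lx lc fc refl xc =
        _ , one-tail x (A⊆A′ (flip-adj (leaf-head lx (ρ-lay ≤-refl)))) dominated ,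
        1+N _ (trans (length-++ (seg 1 N)) (trans (cong (_+ 1) (length-seg 1 N)) (+-comm _ 1)))
        where
        open Spine κ₁ κ₁-lay
        open Gain A′ A′-sym A⊆A′
        dominated : ∀ w → Tail w → w ≡ x ⊎ A′ w (ρ N) ≡ true ⊎ A′ w x ≡ true
        dominated w lw with leaf w in fw | centre x ≟ w
        ... | true | _ = inj₂ (inj₁ (A⊆A′ (leaf-head (lw , fw) (ρ-lay ≤-refl))))
        ... | false | yes refl = inj₂ (inj₂ (flip′ xc))
        ... | false | no ne = inj₂ (inj₂ (A⊆A′ (flip-adj (leaf-inner lx lw fw ne))))
      in-tail : Tail u → Gained
      in-tail lu with leaf u in fu | leaf v in fv
      ... | true | true = ⊥-elim (false≢true (leaf-leaf (lu , fu) (lv , fv) u≢v) nonadj)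
      ... | false | false = ⊥-elim (false≢true (inner-inner lu fu lv fv u≢v) nonadj)
      ... | true | false with centre u ≟ v
      ... | yes eq = star-edge (lu , fu) lv fv eq uv
      ... | no ne = ⊥-elim (false≢true (leaf-inner (lu , fu) lv fv ne) nonadj)
      in-tail lu | false | true with centre v ≟ u
      ... | yes eq = star-edge (lv , fv) lu fu eq (trans (A′-sym _ _) uv)
      ... | no ne = ⊥-elim (false≢true (flip-adj (leaf-inner (lv , fv) lu fu ne)) nonadj)
      to-tail : Tri (lay u < N) (lay u ≡ N) (N < lay u) → Gained
      to-tail (tri< lt _ _) = choose (<⇒≤ lt) (lay u ≟ℕ q)
      to-tail (tri≈ _ eq _) = choose (≤-reflexive eq) (lay u ≟ℕ q)
      to-tail (tri> _ _ gt) = in-tail (≤-antisym (lay≤ u) gt)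

  open Spine κ₁ κ₁-lay public using (ρ; ρ-lay; ρ-q; seg; ∈-seg⁺; ∈-seg⁻; length-seg; module Gain)

  minimum : Subset n
  minimum = fromList (seg 1 N ++ y₁ ∷ y₂ ∷ [])

  minimum-cds : IsCDS A minimum
  minimum-cds = Gain.two-tails A (adj-sym G) id

  ∣minimum∣ : ∣ minimum ∣ ≡ 2 + N
  ∣minimum∣ = ≤-antisym (≤-trans (∣fromList∣≤ _) (≤-reflexive
      (trans (length-++ (seg 1 N)) (trans (cong (_+ 2) (length-seg 1 N)) (+-comm _ 2)))))
    (LowerBound.lower-bound (proj₁ minimum-cds) (proj₂ minimum-cds))

  gammaC : GammaC A (2 + N)
  gammaC = (minimum , minimum-cds , ∣minimum∣) , λ D cds → LowerBound.lower-bound (proj₁ cds) (proj₂ cds)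

  critical : Critical G (2 + N)
  critical = gammaC , gains
    where
    gains : ∀ u v → u ≢ v → A u v ≡ false → Gained (addEdge A u v) (addEdge-sym A u v (adj-sym G)) (addEdge-old A u v)
    gains u v u≢v nonadj with ≤-total (lay u) (lay v)
    ... | inj₁ le = gain _ (addEdge-sym A u v (adj-sym G)) (addEdge-old A u v) u≢v nonadj (addEdge-new A u v) le
    ... | inj₂ ge = gain _ (addEdge-sym A u v (adj-sym G)) (addEdge-old A u v) (u≢v ∘ sym) (flip-adj nonadj) (addEdge-new′ A u v) ge

-- The blocks of a layered graph

module LayeredBlocks {n κ j : ℕ} {G : Graph n} (j<K : j < suc κ) (S : Layered G (suc (suc κ)) (suc j))
  (stars : TwoStars S) where

  K N : ℕ
  K = suc κ
  N = suc K

  open Layered S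
  open LayeredCritical S stars (s≤s z≤n) (s≤s j<K)
    using (A; flip-adj; y₁; y₂; κ₁; Tail; Leaf; leafY₁; leafY₂; centres≢; κ₁-lay; inner-inner; leaf-inner; leaf-head;
           partner-exists; ρ; ρ-lay; ρ-q; ∈-seg⁻; minimum; seg; ∈-seg⁺)

  A-sym : ∀ u v → A u v ≡ A v u
  A-sym = adj-sym G

  h : ℕ → ℕ
  h = shift j

  h-K : h K ≡ N
  h-K = shift-high j<K

  h-end : h (suc K) ≡ suc N
  h-end = shift-high (m≤n⇒m≤1+n j<K)

  h-mono : ∀ {s t} → s ≤ t → h s ≤ h t
  h-mono s≤t with m≤n⇒m<n∨m≡n s≤t
  ... | inj₁ lt = <⇒≤ (shift-mono-< lt)
  ... | inj₂ refl = ≤-refl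

  h≤N : ∀ {t} → t ≤ K → h t ≤ N
  h≤N t≤K = ≤-trans (h-mono t≤K) (≤-reflexive h-K)

  -- A block is the interval between two consecutive cut layers: two layers in general, the three
  -- layers j, j + 1, j + 2 for block j, and the layers N, N + 1 for the last one.
  InBl : ℕ → Fin n → Set
  InBl t v = h t ≤ lay v × lay v ≤ h (suc t)

  inBl? : ∀ t v → Dec (InBl t v)
  inBl? t v = (h t ≤? lay v) ×-dec (lay v ≤? h (suc t))

  bl : ℕ → Subset n
  bl t = subset (inBl? t)

  bl⁺ : ∀ {t v} → InBl t v → v ∈ bl t
  bl⁺ {t} = ∈-subset⁺ (inBl? t)

  bl⁻ : ∀ {t v} → v ∈ bl t → InBl t v
  bl⁻ {t} = ∈-subset⁻ (inBl? t)

  cv : ℕ → Fin n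
  cv s = ρ (h (suc s))

  cv-lay : ∀ {s} → s < K → lay (cv s) ≡ h (suc s)
  cv-lay s<K = ρ-lay (h≤N s<K)

  cv-unique : ∀ {s v} → s < K → lay v ≡ h (suc s) → v ≡ cv s
  cv-unique {s} s<K lv = unique (trans lv (sym (cv-lay s<K))) (≤-trans (≤-reflexive (cv-lay s<K)) (h≤N s<K))
    (λ eq → shift≢suc {j} {suc s} (trans (sym (cv-lay s<K)) eq))

  cv∈ : ∀ {s} → s < K → cv s ∈ bl s
  cv∈ {s} s<K = bl⁺ (≤-trans (h-mono (n≤1+n s)) (≤-reflexive (sym (cv-lay s<K))) , ≤-reflexive (cv-lay s<K))

  cv∈′ : ∀ {s} → s < K → cv s ∈ bl (suc s)
  cv∈′ {s} s<K = bl⁺ (≤-reflexive (sym (cv-lay s<K)) , ≤-trans (≤-reflexive (cv-lay s<K)) (h-mono (n≤1+n (suc s))))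

  cv-injective : ∀ {s s′} → s < K → s′ < K → cv s ≡ cv s′ → s ≡ s′
  cv-injective {s} {s′} s<K s′<K eq with shift-injective {j} {suc s} {suc s′}
    (trans (sym (cv-lay s<K)) (trans (cong lay eq) (cv-lay s′<K)))
  ... | refl = refl

  cover : ∀ v → ∃ λ t → t ≤ K × v ∈ bl t
  -- The greatest t up to `K` with `h t ≤ lay v`, found as the last failure of the negated
  -- inequality.
  cover v with greatest-counterexample (λ t → ¬? (h t ≤? lay v)) (suc K)
  ... | inj₁ all = ⊥-elim (all 0 (s≤s z≤n) (≤-trans (≤-reflexive (shift-low {j} z≤n)) z≤n))
  ... | inj₂ (t , t≤K , ¬¬le , above) = t , s≤s⁻¹ t≤K , bl⁺ (decidable-stable (h t ≤? lay v) ¬¬le , upper)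
    where
    upper : lay v ≤ h (suc t)
    upper with m≤n⇒m<n∨m≡n (s≤s⁻¹ t≤K)
    ... | inj₁ t<K = <⇒≤ (≰⇒> (above (suc t) ≤-refl (s≤s t<K)))
    ... | inj₂ refl = ≤-trans (lay≤ v) (≤-reflexive (sym h-end))

  head≢tail : ∀ {u v} → lay u ≡ N → Tail v → u ≢ v
  head≢tail lu lv refl = <-irrefl (trans (sym lu) lv) ≤-refl

  -- With c outside block t this also gives that the block itself is connected.
  module Avoiding (c : Fin n) where

    In : ℕ → Fin n → Set
    In t x = x ∈ bl t × x ≢ c

    adjacent-or-equal : ∀ {t x y} → In t x → In t y → x ≡ y ⊎ A x y ≡ true → Reach A (In t) x y
    adjacent-or-equal ix iy (inj₁ refl) = here ix
    adjacent-or-equal ix iy (inj₂ e) = reach-edge ix iy e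

    narrow : ∀ {x y} → lay y ≤ N → lay x ≤ lay y → lay y ≤ suc (lay x) → x ≡ y ⊎ A x y ≡ true
    narrow {x} {y} ly p r with x ≟ y
    ... | yes eq = inj₁ eq
    ... | no ne = inj₂ (near ne ly p r)

    clique-vertex : ∃ λ w → lay w ≡ suc j × w ≢ c
    clique-vertex with clique₂
    ... | v , w , lv , lw , v≢w with v ≟ c
    ... | no ne = v , lv , ne
    ... | yes refl = w , lw , (v≢w ∘ sym)

    -- Only block j contains vertices two layers apart. The clique between them has two vertices, so
    -- one of these remains when c is deleted.
    upward : ∀ {t} → t < K → ∀ {x y} → In t x → In t y → lay x ≤ lay y → Reach A (In t) x y
    upward {t} t<K {x} {y} ix iy x≤y with lay y ≤? suc (lay x)
    ... | yes le = adjacent-or-equal ix iy (narrow (≤-trans (proj₂ (bl⁻ (proj₁ iy))) (h≤N t<K)) x≤y le)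
    ... | no gap with t ≟ℕ j
    ... | no t≢j = ⊥-elim (gap (≤-trans (proj₂ (bl⁻ (proj₁ iy)))
                     (≤-trans (≤-reflexive (shift-suc t≢j)) (s≤s (proj₁ (bl⁻ (proj₁ ix)))))))
    ... | yes refl with clique-vertex
    ... | w , lw , w≢c = step ix xw (reach-edge iw iy wy)
      where
      x≥ : j ≤ lay x
      x≥ = ≤-trans (≤-reflexive (sym (shift-low {j} ≤-refl))) (proj₁ (bl⁻ (proj₁ ix)))
      y≤ : lay y ≤ suc (suc j)
      y≤ = ≤-trans (proj₂ (bl⁻ (proj₁ iy))) (≤-reflexive shift-suc-j)
      lx : lay x ≡ j
      lx = ≤-antisym (s≤s⁻¹ (s≤s⁻¹ (≤-trans (≰⇒> gap) y≤))) x≥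
      ly : lay y ≡ suc (suc j)
      ly = ≤-antisym y≤ (≤-trans (s≤s (s≤s x≥)) (≰⇒> gap))
      y≤N : lay y ≤ N
      y≤N = ≤-trans (≤-reflexive ly) (s≤s j<K)
      iw : In j w
      iw = bl⁺ (≤-trans (≤-reflexive (shift-low {j} ≤-refl)) (≤-trans (n≤1+n j) (≤-reflexive (sym lw))) ,
                ≤-trans (≤-reflexive lw) (≤-trans (n≤1+n _) (≤-reflexive (sym shift-suc-j)))) , w≢c
      xw : A x w ≡ true
      xw = near (λ { refl → <-irrefl (trans (sym lx) lw) ≤-refl }) (≤-trans (≤-reflexive lw) (m≤n⇒m≤1+n j<K))
             (≤-trans (≤-reflexive lx) (≤-trans (n≤1+n j) (≤-reflexive (sym lw))))
             (≤-reflexive (trans lw (cong suc (sym lx))))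
      wy : A w y ≡ true
      wy = near (λ { refl → <-irrefl (trans (sym lw) ly) ≤-refl }) y≤N
             (≤-trans (≤-reflexive lw) (≤-trans (n≤1+n _) (≤-reflexive (sym ly))))
             (≤-reflexive (trans ly (cong suc (sym lw))))

    tail∈ : ∀ {x} → Tail x → x ∈ bl K
    tail∈ {x} lx = bl⁺ (≤-trans (≤-trans (≤-reflexive h-K) (n≤1+n N)) (≤-reflexive (sym lx)) ,
                        ≤-trans (≤-reflexive lx) (≤-reflexive (sym h-end)))

    in-last : ∀ {x} → x ∈ bl K → lay x ≡ N ⊎ Tail x
    in-last {x} x∈ with m≤n⇒m<n∨m≡n (lay≤ x)
    ... | inj₂ lx = inj₂ lx
    ... | inj₁ lt = inj₁ (≤-antisym (s≤s⁻¹ lt) (≤-trans (≤-reflexive (sym h-K)) (proj₁ (bl⁻ x∈))))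

    -- A non-leaf is joined to the head through a leaf of another star, or around the removed leaf.
    to-head : ∀ {H} → lay H ≡ N → H ≢ c → ∀ x → Tail x → x ≢ c → Reach A (In K) x H
    to-head {H} lH H≢c x lx x≢c = by-leaf (leaf x) refl
      where
      iH : In K H
      iH = bl⁺ (≤-trans (≤-reflexive h-K) (≤-reflexive (sym lH)) ,
                ≤-trans (≤-reflexive lH) (≤-trans (n≤1+n N) (≤-reflexive (sym h-end)))) , H≢c
      ix : In K x
      ix = tail∈ lx , x≢c
      via : ∀ {y} → Leaf y → y ≢ c → A x y ≡ true → Reach A (In K) x H
      via ly y≢c xy = step ix xy (reach-edge (tail∈ (proj₁ ly) , y≢c) iH (leaf-head ly lH))
      -- With z deleted, the only remaining designated leaf y has x as its centre. The path runs
      -- from x to the centre of z, on to y, and then to the head.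
      around : ∀ {y z} → leaf x ≡ false → Leaf y → Leaf z → centre y ≢ centre z → centre y ≡ x → z ≡ c → Reach A (In K) x H
      around {y} {z} fx ly lz ne refl refl = step ix xm (step im (flip-adj (leaf-inner ly lm fm ne)) (reach-edge iy iH (leaf-head ly lH)))
        where
        m : Fin n
        m = centre z
        lm : Tail m
        lm = proj₁ (leaf-centre (proj₁ lz) (proj₂ lz))
        fm : leaf m ≡ false
        fm = proj₁ (proj₂ (leaf-centre (proj₁ lz) (proj₂ lz)))
        im : In K m
        im = tail∈ lm , λ eq → false≢true (proj₂ lz) (trans (cong leaf (sym eq)) fm)
        iy : In K y
        iy = tail∈ (proj₁ ly) , λ { refl → ne refl }
        xm : A x m ≡ true
        xm = inner-inner lx fx lm fm ne
      by-leaf : ∀ b → leaf x ≡ b → Reach A (In K) x H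
      by-leaf true fx = reach-edge ix iH (leaf-head (lx , fx) lH)
      by-leaf false fx with centre y₁ ≟ x | y₁ ≟ c | centre y₂ ≟ x | y₂ ≟ c
      ... | no n₁ | no m₁ | _ | _ = via leafY₁ m₁ (flip-adj (leaf-inner leafY₁ lx fx n₁))
      ... | _ | _ | no n₂ | no m₂ = via leafY₂ m₂ (flip-adj (leaf-inner leafY₂ lx fx n₂))
      ... | yes e₁ | _ | yes e₂ | _ = ⊥-elim (centres≢ (trans e₁ (sym e₂)))
      ... | yes e₁ | _ | no _ | yes d₂ = around fx leafY₁ leafY₂ centres≢ e₁ d₂
      ... | no _ | yes d₁ | yes e₂ | _ = around fx leafY₂ leafY₁ (centres≢ ∘ sym) e₂ d₁
      ... | no _ | yes d₁ | no _ | yes d₂ = ⊥-elim (centres≢ (cong centre (trans d₁ (sym d₂))))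

    -- The deleted vertex is the head. If y is not adjacent to x, then the partner of x is y or sees
    -- it.
    within-tail : lay c ≡ N → ∀ x y → Tail x → Tail y → Reach A (In K) x y
    within-tail lc x y lx ly with A x y in xy | x ≟ y
    ... | _ | yes refl = here (tail∈ lx , head≢tail lc lx ∘ sym)
    ... | true | no _ = reach-edge (tail∈ lx , head≢tail lc lx ∘ sym) (tail∈ ly , head≢tail lc ly ∘ sym) xy
    ... | false | no x≢y with partner-exists lx
    ... | w , lw , xw , dominated with dominated y ly
    ... | inj₁ eq = ⊥-elim (x≢y (sym eq))
    ... | inj₂ (inj₁ refl) = reach-edge (tail∈ lx , head≢tail lc lx ∘ sym) (tail∈ ly , head≢tail lc ly ∘ sym) xw
    ... | inj₂ (inj₂ (inj₁ yx)) = ⊥-elim (false≢true (flip-adj yx) xy)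
    ... | inj₂ (inj₂ (inj₂ yw)) = step (tail∈ lx , head≢tail lc lx ∘ sym) xw
            (reach-edge (tail∈ (proj₁ lw) , head≢tail lc (proj₁ lw) ∘ sym) (tail∈ ly , head≢tail lc ly ∘ sym) (flip-adj yw))

    connected : ∀ {t} → t ≤ K → ConnectedOn A (In t)
    connected {t} t≤K x y ix iy with m≤n⇒m<n∨m≡n t≤K
    ... | inj₁ t<K = [ upward t<K ix iy , (λ ge → reach-sym A-sym (upward t<K iy ix ge)) ]′ (≤-total (lay x) (lay y))
    ... | inj₂ refl with lay c ≟ℕ N
    ... | yes lc = within-tail lc x y (is-tail x ix) (is-tail y iy)
      where
      is-tail : ∀ x → In K x → Tail x
      is-tail x (x∈ , x≢c) with in-last x∈
      ... | inj₂ lx = lx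
      ... | inj₁ lx = ⊥-elim (x≢c (trans (cv-unique ≤-refl (trans lx (sym h-K))) (sym (cv-unique ≤-refl (trans lc (sym h-K))))))
    ... | no ¬lc = reach-trans (reach-H x ix) (reach-sym A-sym (reach-H y iy))
      where
      H : Fin n
      H = cv κ
      lH : lay H ≡ N
      lH = trans (cv-lay ≤-refl) h-K
      H≢c : H ≢ c
      H≢c eq = ¬lc (trans (cong lay (sym eq)) lH)
      reach-H : ∀ x → In K x → Reach A (In K) x H
      reach-H x ix@(x∈ , x≢c) with in-last x∈
      ... | inj₂ lx = to-head lH H≢c x lx x≢c
      ... | inj₁ lx with cv-unique {κ} ≤-refl (trans lx (sym h-K))
      ... | refl = here ix

  low-vertex : ∀ {t} → t ≤ K → ∃ λ v → lay v ≡ h t × v ∈ bl t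
  low-vertex {t} t≤K = ρ (h t) , ρ-lay (h≤N t≤K) ,
    bl⁺ (≤-reflexive (sym (ρ-lay (h≤N t≤K))) , ≤-trans (≤-reflexive (ρ-lay (h≤N t≤K))) (h-mono (n≤1+n t)))

  high-vertex : ∀ {t} → t ≤ K → ∃ λ v → lay v ≡ h (suc t) × v ∈ bl t
  high-vertex {t} t≤K with m≤n⇒m<n∨m≡n t≤K
  ... | inj₁ t<K = cv t , cv-lay t<K , cv∈ t<K
  ... | inj₂ refl = y₁ , trans (proj₁ leafY₁) (sym h-end) , Avoiding.tail∈ y₁ (proj₁ leafY₁)

  outside-vertex : ∀ {t} → t ≤ K → ∃ λ v → v ∉ bl t
  outside-vertex {zero} t≤K = y₁ , λ y∈ → <⇒≱ (s≤s (h≤N {1} (s≤s z≤n)))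
    (≤-trans (≤-reflexive (sym (proj₁ leafY₁))) (proj₂ (bl⁻ y∈)))
  outside-vertex {suc t} t≤K with low-vertex {0} z≤n
  ... | v , lv , _ = v , λ v∈ → <⇒≱ (shift-mono-< {j} {0} {suc t} (s≤s z≤n))
                           (≤-trans (proj₁ (bl⁻ v∈)) (≤-reflexive lv))

  nonsep : ∀ {t} → t ≤ K → Nonsep A (bl t)
  nonsep {t} t≤K = (proj₁ (low-vertex t≤K) , proj₂ (proj₂ (low-vertex t≤K))) , conn ,
                   λ c _ → Avoiding.connected c t≤K
    where
    conn : ConnectedOn A (_∈ bl t)
    conn x y x∈ y∈ with outside-vertex t≤K
    ... | o , o∉ = reach-weaken proj₁ (λ _ _ e → e)
            (Avoiding.connected o t≤K x y (x∈ , λ { refl → o∉ x∈ }) (y∈ , λ { refl → o∉ y∈ }))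

  -- Edges skip no layer, and `cv s` is alone in the layer `h (suc s)`.
  cross-cv : ∀ {s u w} → s < K → lay u < h (suc s) → h (suc s) < lay w → ¬ Reach A (_≢ cv s) u w
  cross-cv {s} s<K lo hi r with reach-cross (λ v → lay v <? h (suc s)) r lo (<-asym hi)
  ... | a , b , _ , b≢ , a< , ¬b< , e =
          b≢ (cv-unique s<K (≤-antisym (≤-trans (far (flip-adj e)) a<) (≮⇒≥ ¬b<)))

  -- Take the first block whose right layer B does not exceed, or the last block. B then has
  -- vertices beyond the left cut vertex of that block, so a vertex before it would be separated
  -- from them within B.
  nonsep⊆bl : ∀ B → Nonsep A B → ∃ λ t → t ≤ K × B ⊆ bl t
  nonsep⊆bl B ns with least-counterexample (λ t → any? (λ v → (v ∈? B) ×-dec (h (suc t) <? lay v))) K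
  ... | inj₁ all = K , ≤-refl , λ {x} x∈ → bl⁺ (lower x x∈ κ refl , ≤-trans (lay≤ x) (≤-reflexive (sym h-end)))
    where
    lower : ∀ x → x ∈ B → ∀ i → suc i ≡ K → h K ≤ lay x
    lower x x∈ i refl with h K ≤? lay x
    ... | yes le = le
    ... | no gt with all i ≤-refl
    ... | v , v∈ , hi = ⊥-elim (cross-cv ≤-refl (≰⇒> gt) hi
            (nonsep-reach A-sym ns (cv i) x v x∈ v∈
              (λ { refl → <-irrefl (cv-lay ≤-refl) (≰⇒> gt) }) (λ { refl → <-irrefl (sym (cv-lay ≤-refl)) hi })))
  ... | inj₂ (t , t<K , none , below) = t , <⇒≤ t<K , λ {x} x∈ → bl⁺ (lower x x∈ t t<K below , upper x x∈)
    where
    upper : ∀ x → x ∈ B → lay x ≤ h (suc t)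
    upper x x∈ = ≮⇒≥ λ lt → none (x , x∈ , lt)
    lower : ∀ x → x ∈ B → ∀ t → t < K → (∀ i → i < t → ∃ λ v → v ∈ B × h (suc i) < lay v) → h t ≤ lay x
    lower x x∈ zero _ _ = ≤-trans (≤-reflexive (shift-low {j} z≤n)) z≤n
    lower x x∈ (suc i) i<K below with h (suc i) ≤? lay x
    ... | yes le = le
    ... | no gt with below i ≤-refl
    ... | v , v∈ , hi = ⊥-elim (cross-cv (<⇒≤ i<K) (≰⇒> gt) hi
            (nonsep-reach A-sym ns (cv i) x v x∈ v∈
              (λ { refl → <-irrefl (cv-lay (<⇒≤ i<K)) (≰⇒> gt) }) (λ { refl → <-irrefl (sym (cv-lay (<⇒≤ i<K))) hi })))

  bl⊆bl : ∀ {t t′} → t ≤ K → bl t ⊆ bl t′ → t ≡ t′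
  bl⊆bl {t} {t′} t≤K sub with low-vertex t≤K | high-vertex t≤K
  ... | v , lv , v∈ | w , lw , w∈ = ≤-antisym (≮⇒≥ t′≮t) (≮⇒≥ t≮t′)
    where
    t≮t′ : ¬ t < t′
    t≮t′ lt = <⇒≱ (shift-mono-< lt) (≤-trans (proj₁ (bl⁻ (sub v∈))) (≤-reflexive lv))
    t′≮t : ¬ t′ < t
    t′≮t lt = <⇒≱ (shift-mono-< (s≤s lt)) (≤-trans (≤-reflexive (sym lw)) (proj₂ (bl⁻ (sub w∈))))

  block : ∀ {t} → t ≤ K → IsBlock A (bl t)
  block {t} t≤K = nonsep t≤K , maximal
    where
    maximal : ∀ B → Nonsep A B → bl t ⊆ B → B ≡ bl t
    maximal B ns sub with nonsep⊆bl B ns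
    ... | t′ , t′≤K , sub′ with bl⊆bl t≤K (λ x∈ → sub′ (sub x∈))
    ... | refl = ⊆-antisym sub′ sub

  bl-all : ∀ B → IsBlock A B → ∃ λ t → t ≤ K × bl t ≡ B
  bl-all B (ns , maximal) with nonsep⊆bl B ns
  ... | t , t≤K , sub = t , t≤K , maximal (bl t) (nonsep t≤K) sub

  join : ∀ {P : Fin n → Set} → (∀ {s} → s < K → P (cv s)) →
         (∀ {t} → t ≤ K → ∀ u v → u ∈ bl t → v ∈ bl t → P u → P v → Reach A P u v) →
         ∀ u v → P u → P v → Reach A P u v
  join {P} cvP in-block u v pu pw with cover u | cover v
  ... | t , t≤K , u∈ | t′ , t′≤K , v∈ = [ (λ le → climb le t′≤K u∈ v∈ pu pw) ,
          (λ ge → reach-sym A-sym (climb ge t≤K v∈ u∈ pw pu)) ]′ (≤-total t t′)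
    where
    climb : ∀ {t t′ u v} → t ≤ t′ → t′ ≤ K → u ∈ bl t → v ∈ bl t′ → P u → P v → Reach A P u v
    climb {t} {t′} {u} {v} t≤t′ t′≤K u∈ v∈ p r = chain-reach bl cv A P 0 K
      (λ s _ s<K → cvP s<K , cv∈ s<K , cv∈′ s<K) (λ t _ t≤K → in-block t≤K) t t′ z≤n t≤t′ t′≤K u v u∈ v∈ p r

  cv-isCut : ∀ {s} → s < K → IsCut A (cv s)
  cv-isCut {s} s<K with low-vertex {0} z≤n
  ... | u , lu , _ = u , y₁ , lower≢ lo , upper≢ hi ,
        join (λ _ → tt) (λ t≤K x y x∈ y∈ _ _ →
          reach-weaken (λ _ → tt) (λ _ _ e → e) (proj₁ (proj₂ (nonsep t≤K)) x y x∈ y∈)) u y₁ tt tt ,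
        cross-cv s<K lo hi
    where
    lower≢ : ∀ {v} → lay v < h (suc s) → v ≢ cv s
    lower≢ lt eq = <-irrefl (trans (cong lay eq) (cv-lay s<K)) lt
    upper≢ : ∀ {v} → h (suc s) < lay v → v ≢ cv s
    upper≢ lt eq = <-irrefl (sym (trans (cong lay eq) (cv-lay s<K))) lt
    lo : lay u < h (suc s)
    lo = ≤-trans (s≤s (≤-reflexive lu)) (shift-mono-< (s≤s z≤n))
    hi : h (suc s) < lay y₁
    hi = ≤-trans (s≤s (h≤N s<K)) (≤-reflexive (sym (proj₁ leafY₁)))

  isCut-cv : ∀ {c} → IsCut A c → ∃ λ s → s < K × c ≡ cv s
  isCut-cv {c} (u , w , u≢c , w≢c , _ , apart) = decidable-stable (anyUpTo? (λ s → c ≟ cv s) K)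
    λ none → apart (join (λ {s} s<K eq → none (s , s<K , sym eq))
      (λ t≤K x y x∈ y∈ x≢c y≢c → nonsep-reach A-sym (nonsep t≤K) c x y x∈ y∈ x≢c y≢c) u w u≢c w≢c)

  private
    k : ℕ
    k = 4 + κ

  labeling : Labeling k A
  labeling = record
    { Bl = λ t → bl (toℕ t)
    ; cv = λ s → cv (toℕ s)
    ; Bl-inj = λ {t} {t′} eq → toℕ-injective (bl⊆bl (s≤s⁻¹ (toℕ<n t)) (λ x∈ → subst (_ ∈_) eq x∈))
    ; Bl-blk = λ t → block (s≤s⁻¹ (toℕ<n t))
    ; Bl-all = λ B blk → let (t , t≤K , eq) = bl-all B blk in
        fromℕ< (s≤s t≤K) , trans (cong bl (toℕ-fromℕ< (s≤s t≤K))) eq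
    ; cv-inj = λ {s} {s′} eq → toℕ-injective (cv-injective (toℕ<n s) (toℕ<n s′) eq)
    ; cv-cut = λ s → cv-isCut (toℕ<n s)
    ; cv-all = λ c cut → let (s , s<K , eq) = isCut-cv cut in
        fromℕ< s<K , trans (cong cv (toℕ-fromℕ< s<K)) (sym eq)
    ; incid = λ { t s (inj₁ eq) → subst (λ i → cv (toℕ s) ∈ bl i) eq (cv∈ (toℕ<n s))
                ; t s (inj₂ eq) → subst (λ i → cv (toℕ s) ∈ bl i) eq (cv∈′ (toℕ<n s)) } }

  cuts : HasCard (IsCut A) K
  cuts = (λ s → cv (toℕ s)) , (λ {s} {s′} eq → toℕ-injective (cv-injective (toℕ<n s) (toℕ<n s′) eq)) ,
         (λ s → cv-isCut (toℕ<n s)) , λ c cut → let (s , s<K , eq) = isCut-cv cut in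
           fromℕ< s<K , trans (cong cv (toℕ-fromℕ< s<K)) (sym eq)

  Chosen : ℕ → Fin n → Set
  Chosen t v = v ∈ bl t × ¬ IsCut A v × v ∈ minimum

  noncut : ∀ {v} → (∀ {s} → s < K → lay v ≢ h (suc s)) → ¬ IsCut A v
  noncut miss cut with isCut-cv cut
  ... | s , s<K , refl = miss s<K (cv-lay s<K)

  κ₁-noncut : ¬ IsCut A κ₁
  κ₁-noncut = noncut λ {s} _ eq → shift≢suc {j} {suc s} (trans (sym eq) κ₁-lay)

  tail-noncut : ∀ {v} → Tail v → ¬ IsCut A v
  tail-noncut lv = noncut λ s<K eq → <⇒≱ ≤-refl (≤-trans (≤-reflexive (trans (sym lv) eq)) (h≤N s<K))

  cut-layer : ∀ i → 1 ≤ i → i ≤ N → i ≢ suc j → ∃ λ s → s < K × i ≡ h (suc s)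
  cut-layer (suc i) _ i≤ ne with <-cmp i j
  ... | tri< lt _ _ = i , <-trans lt j<K , sym (shift-low lt)
  ... | tri≈ _ eq _ = ⊥-elim (ne (cong suc eq))
  cut-layer (suc (suc i)) _ i≤ ne | tri> _ _ gt = i , s≤s⁻¹ i≤ , sym (shift-high gt)

  spine-isCut : ∀ i → 1 ≤ i → i ≤ N → i ≢ suc j → IsCut A (ρ i)
  spine-isCut i 1≤i i≤N ne with cut-layer i 1≤i i≤N ne
  ... | s , s<K , refl = cv-isCut s<K

  -- A spine vertex outside the clique layer is a cut vertex. Thus only these three are counted: one
  -- in block j and two in the last block.
  chosen : ∀ {t v} → Chosen t v → v ≡ κ₁ ⊎ v ≡ y₁ ⊎ v ≡ y₂
  chosen (_ , ¬cut , v∈) with ∈-++⁻ (seg 1 N) (∈-fromList⁻ v∈)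
  ... | inj₂ (Any.here refl) = inj₂ (inj₁ refl)
  ... | inj₂ (Any.there (Any.here refl)) = inj₂ (inj₂ refl)
  ... | inj₁ s∈ with ∈-seg⁻ s∈
  ... | i , 1≤i , i≤ , refl = inj₁ (ρ-q (decidable-stable (i ≟ℕ suc j) λ ne → ¬cut (spine-isCut i 1≤i (s≤s⁻¹ i≤) ne)))

  κ₁∈ : κ₁ ∈ minimum
  κ₁∈ = subst (_∈ minimum) (ρ-q refl) (∈-fromList⁺ (∈-++⁺ˡ (∈-seg⁺ (s≤s z≤n) (s≤s (m≤n⇒m≤1+n j<K)))))

  y₁∈ : y₁ ∈ minimum
  y₁∈ = ∈-fromList⁺ (∈-++⁺ʳ (seg 1 N) (Any.here refl))

  y₂∈ : y₂ ∈ minimum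
  y₂∈ = ∈-fromList⁺ (∈-++⁺ʳ (seg 1 N) (Any.there (Any.here refl)))

  κ₁-block : ∀ {t} → κ₁ ∈ bl t → t ≡ j
  κ₁-block {t} κ∈ with <-cmp t j | bl⁻ κ∈
  ... | tri≈ _ eq _ | _ = eq
  ... | tri< lt _ _ | _ , le = ⊥-elim (<⇒≱ (s≤s lt) (≤-trans (≤-reflexive (sym κ₁-lay)) (≤-trans le (≤-reflexive (shift-low lt)))))
  ... | tri> _ _ gt | ge , _ = ⊥-elim (<⇒≱ (s≤s gt) (≤-trans (≤-reflexive (sym (shift-high gt))) (≤-trans ge (≤-reflexive κ₁-lay))))

  tail-block : ∀ {t v} → Tail v → v ∈ bl t → ¬ t < K
  tail-block lv v∈ t<K = <⇒≱ ≤-refl (≤-trans (≤-reflexive (sym lv)) (≤-trans (proj₂ (bl⁻ v∈)) (h≤N t<K)))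

  κ₁∈bl : κ₁ ∈ bl j
  κ₁∈bl = bl⁺ (≤-trans (≤-reflexive (shift-low {j} ≤-refl)) (≤-trans (n≤1+n j) (≤-reflexive (sym κ₁-lay))) ,
               ≤-trans (≤-reflexive κ₁-lay) (≤-trans (n≤1+n _) (≤-reflexive (sym shift-suc-j))))

  chosen-j : HasCard (Chosen j) 1
  chosen-j = (λ _ → κ₁) , (λ { {zero} {zero} _ → refl }) , (λ _ → κ₁∈bl , κ₁-noncut , κ₁∈) , onto
    where
    onto : ∀ v → Chosen j v → Σ (Fin 1) λ _ → κ₁ ≡ v
    onto v ch with chosen {j} ch
    ... | inj₁ refl = zero , refl
    ... | inj₂ (inj₁ refl) = ⊥-elim (tail-block (proj₁ leafY₁) (proj₁ ch) j<K)
    ... | inj₂ (inj₂ refl) = ⊥-elim (tail-block (proj₁ leafY₂) (proj₁ ch) j<K)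

  chosen-none : ∀ {t} → t < K → t ≢ j → HasCard (Chosen t) 0
  chosen-none {t} t<K t≢j = (λ ()) , (λ { {()} }) , (λ ()) , λ v ch → ⊥-elim (contra ch)
    where
    contra : ∀ {v} → Chosen t v → ⊥
    contra ch with chosen {t} ch
    ... | inj₁ refl = t≢j (κ₁-block (proj₁ ch))
    ... | inj₂ (inj₁ refl) = tail-block (proj₁ leafY₁) (proj₁ ch) t<K
    ... | inj₂ (inj₂ refl) = tail-block (proj₁ leafY₂) (proj₁ ch) t<K

  chosen-last : HasCard (Chosen K) 2
  chosen-last = f , f-inj , f∈ , onto
    where
    f : Fin 2 → Fin n
    f zero = y₁
    f (suc zero) = y₂
    y₁≢y₂ : y₁ ≢ y₂
    y₁≢y₂ eq = centres≢ (cong centre eq)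
    f-inj : Injective _≡_ _≡_ f
    f-inj {zero} {zero} _ = refl
    f-inj {zero} {suc zero} eq = ⊥-elim (y₁≢y₂ eq)
    f-inj {suc zero} {zero} eq = ⊥-elim (y₁≢y₂ (sym eq))
    f-inj {suc zero} {suc zero} _ = refl
    f∈ : ∀ i → Chosen K (f i)
    f∈ zero = Avoiding.tail∈ y₁ (proj₁ leafY₁) , tail-noncut (proj₁ leafY₁) , y₁∈
    f∈ (suc zero) = Avoiding.tail∈ y₂ (proj₁ leafY₂) , tail-noncut (proj₁ leafY₂) , y₂∈
    onto : ∀ v → Chosen K v → Σ (Fin 2) λ i → f i ≡ v
    onto v ch with chosen {K} ch
    ... | inj₁ refl = ⊥-elim (<⇒≢ j<K (sym (κ₁-block (proj₁ ch))))
    ... | inj₂ (inj₁ refl) = zero , refl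
    ... | inj₂ (inj₂ refl) = suc zero , refl

layered⇒inH : ∀ {κ n} (b : Fin (suc κ) → ℕ) (j : Fin (suc κ)) → b j ≡ 1 → (∀ i → i ≢ j → b i ≡ 0) → (G : Graph n) →
  (S : Layered G (suc (suc κ)) (suc (toℕ j))) → TwoStars S →
  InH (4 + κ) (extB (4 + κ) b) G
layered⇒inH {κ} {n} b j bj b0 G S stars =
  (critical , cuts) , labeling , minimum , (minimum-cds , subst (GammaC (adj G)) (sym ∣minimum∣) gammaC) , count
  where
  open LayeredBlocks (toℕ<n j) S stars
  open LayeredCritical S stars (s≤s z≤n) (s≤s (toℕ<n j)) using (critical; minimum; minimum-cds; ∣minimum∣; gammaC)
  count : ∀ t → HasCard (Chosen (toℕ t)) (extB (4 + κ) b t)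
  count t with toℕ t <? suc κ
  ... | no t≮ = subst (λ i → HasCard (Chosen i) 2) (≤-antisym (≮⇒≥ t≮) (s≤s⁻¹ (toℕ<n t))) chosen-last
  ... | yes t< with fromℕ< t< ≟ j
  ... | yes eq = subst (HasCard (Chosen (toℕ t))) (trans (sym bj) (cong b (sym eq)))
          (subst (λ i → HasCard (Chosen i) 1) (trans (cong toℕ (sym eq)) (toℕ-fromℕ< t<)) chosen-j)
  ... | no ne = subst (HasCard (Chosen (toℕ t))) (sym (b0 _ ne))
          (chosen-none t< (λ eq → ne (toℕ-injective (trans (toℕ-fromℕ< t<) eq))))

-- Layered graphs and the construction 𝒢₁

-- The axioms of `Layered` that tie adjacency to layers, leaves and centres, for a relation on any
-- type, so that G and the construction are instances of the same notion. The axiom `tail⁻` is the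
-- adjacency part of `leaf-centre`.
record LayeredRelation {V : Set} (E : V → V → Set) (N : ℕ) : Set where
  field
    lay    : V → ℕ
    leaf   : V → Bool
    centre : V → V
    E-sym       : ∀ {u v} → E u v → E v u
    E-irrefl    : ∀ {u} → ¬ E u u
    lay≤        : ∀ v → lay v ≤ suc N
    far         : ∀ {u v} → E u v → lay u ≤ suc (lay v)
    near        : ∀ {u v} → u ≢ v → lay v ≤ N → lay u ≤ lay v → lay v ≤ suc (lay u) → E u v
    head-leaf   : ∀ {u v} → lay u ≡ N → lay v ≡ suc N → leaf v ≡ true → E u v
    head-leaf⁻  : ∀ {u v} → lay u ≡ N → lay v ≡ suc N → E u v → leaf v ≡ true
    tail        : ∀ {u v} → lay u ≡ suc N → lay v ≡ suc N → u ≢ v →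
                  (leaf u ≡ true → leaf v ≡ false → centre u ≢ v) →
                  (leaf v ≡ true → leaf u ≡ false → centre v ≢ u) → E u v
    tail⁻       : ∀ {u} → lay u ≡ suc N → leaf u ≡ true → ¬ E u (centre u)

-- The layers, the leaves and the centres determine the relation.
module _ {V W : Set} {E : V → V → Set} {F : W → W → Set} {N : ℕ}
  (R₁ : LayeredRelation E N) (R₂ : LayeredRelation F N) (f : V → W) where

  private
    module V = LayeredRelation R₁
    module W = LayeredRelation R₂

  module _ (f-inj : Injective _≡_ _≡_ f) (f-lay : ∀ x → W.lay (f x) ≡ V.lay x)
    (f-leaf : ∀ x → V.lay x ≡ suc N → W.leaf (f x) ≡ V.leaf x)
    (f-centre : ∀ x → V.lay x ≡ suc N → V.leaf x ≡ true → W.centre (f x) ≡ f (V.centre x)) where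

    private
      distinct : ∀ {x y} → E x y → f x ≢ f y
      distinct {x} e eq = V.E-irrefl (subst (E x) (sym (f-inj eq)) e)

      not-star : ∀ {x y} → V.lay x ≡ suc N → E x y → W.leaf (f x) ≡ true → W.leaf (f y) ≡ false → W.centre (f x) ≢ f y
      not-star {x} {y} lx e fx _ eq = V.tail⁻ lx leafX
        (subst (E x) (sym (f-inj (trans (sym (f-centre x lx leafX)) eq))) e)
        where
        leafX : V.leaf x ≡ true
        leafX = trans (sym (f-leaf x lx)) fx

      upward : ∀ {x y} → E x y → V.lay x ≤ V.lay y → F (f x) (f y)
      upward {x} {y} e le with m≤n⇒m<n∨m≡n (V.lay≤ y)
      ... | inj₁ lt = W.near (distinct e)
              (≤-trans (≤-reflexive (f-lay y)) (s≤s⁻¹ lt))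
              (≤-trans (≤-reflexive (f-lay x)) (≤-trans le (≤-reflexive (sym (f-lay y)))))
              (≤-trans (≤-reflexive (f-lay y)) (≤-trans (V.far (V.E-sym e)) (≤-reflexive (cong suc (sym (f-lay x))))))
      ... | inj₂ ly with m≤n⇒m<n∨m≡n (V.lay≤ x)
      ... | inj₁ lt = W.head-leaf (trans (f-lay x) lx) (trans (f-lay y) ly) (trans (f-leaf y ly) (V.head-leaf⁻ lx ly e))
        where
        lx : V.lay x ≡ N
        lx = ≤-antisym (s≤s⁻¹ lt) (s≤s⁻¹ (≤-trans (≤-reflexive (sym ly)) (V.far (V.E-sym e))))
      ... | inj₂ lx = W.tail (trans (f-lay x) lx) (trans (f-lay y) ly)
              (distinct e) (not-star lx e) (not-star ly (V.E-sym e))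

    transfer : ∀ {x y} → E x y → F (f x) (f y)
    transfer {x} {y} e with ≤-total (V.lay x) (V.lay y)
    ... | inj₁ le = upward e le
    ... | inj₂ ge = W.E-sym (upward (V.E-sym e) ge)

layered⇒relation : ∀ {n N q} {G : Graph n} → Layered G N q → LayeredRelation (λ u v → adj G u v ≡ true) N
layered⇒relation {G = G} S = record
  { lay = lay ; leaf = leaf ; centre = centre
  ; E-sym = λ e → trans (adj-sym G _ _) e
  ; E-irrefl = λ e → false≢true e (adj-irrefl G _)
  ; lay≤ = lay≤ ; far = far ; near = near ; head-leaf = head-leaf ; head-leaf⁻ = head-leaf⁻ ; tail = tail
  ; tail⁻ = λ lu fu e → false≢true e (proj₂ (proj₂ (leaf-centre lu fu))) }
  where open Layered S

-- The layering of the construction 𝒢₁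

module _ {κ nl s r : ℕ} {m : Fin s → ℕ} (j : Fin (suc κ)) where

  private
    K N : ℕ
    K = suc κ
    N = suc K

    V : Set
    V = G1V (4 + κ) nl s m r

    J : ℕ
    J = toℕ j

    Rⱼ : V → V → Set
    Rⱼ = R j

    Eⱼ : V → V → Set
    Eⱼ = G1Adj j

  layV : V → ℕ
  layV (pv a)   = shift J (toℕ a)
  layV (kv _)   = suc J
  layV (ctr _)  = suc N
  layV (lf _ _) = suc N
  layV (iso _)  = suc N

  leafV : V → Bool
  leafV (lf _ _) = true
  leafV _        = false

  centreV : V → V
  centreV (lf i _) = ctr i
  centreV x        = x

  shift-K : shift J K ≡ N
  shift-K = shift-high (toℕ<n j)

  pv-lay≤ : ∀ (a : Fin (suc K)) → shift J (toℕ a) ≤ N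
  pv-lay≤ a with m≤n⇒m<n∨m≡n (s≤s⁻¹ (toℕ<n a))
  ... | inj₁ lt = ≤-trans (<⇒≤ (shift-mono-< {J} lt)) (≤-reflexive shift-K)
  ... | inj₂ eq = ≤-reflexive (trans (cong (shift J) eq) shift-K)

  J≤K : J ≤ K
  J≤K = <⇒≤ (toℕ<n j)

  layV≤ : ∀ x → layV x ≤ suc N
  layV≤ (pv a)   = ≤-trans (pv-lay≤ a) (n≤1+n N)
  layV≤ (kv _)   = s≤s (≤-trans J≤K (n≤1+n K))
  layV≤ (ctr _)  = ≤-refl
  layV≤ (lf _ _) = ≤-refl
  layV≤ (iso _)  = ≤-refl

  inT-lay : ∀ x → inT x → layV x ≡ suc N
  inT-lay (ctr _) _ = refl
  inT-lay (lf _ _) _ = refl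
  inT-lay (iso _) _ = refl

  lay-inT : ∀ x → layV x ≡ suc N → inT x
  lay-inT (pv a) eq = ⊥-elim (<-irrefl eq (s≤s (pv-lay≤ a)))
  lay-inT (kv _) eq = ⊥-elim (<-irrefl eq (s≤s (m≤n⇒m≤1+n (toℕ<n j))))
  lay-inT (ctr _) _ = tt
  lay-inT (lf _ _) _ = tt
  lay-inT (iso _) _ = tt

  R-lay : ∀ x y → Rⱼ x y → layV x ≤ suc (layV y) × layV y ≤ suc (layV x)
  R-lay (pv a) (pv b) (eq , a≢j) =
    ≤-trans (<⇒≤ (shift-mono-< {J} (≤-reflexive eq))) (n≤1+n _) ,
    ≤-reflexive (trans (cong (shift J) (sym eq)) (shift-suc a≢j))
  R-lay (pv a) (lf _ _) eq = ≤-trans (pv-lay≤ a) (≤-trans (n≤1+n _) (n≤1+n _)) ,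
    s≤s (≤-reflexive (sym (trans (cong (shift J) eq) shift-K)))
  R-lay (kv _) (kv _) _ = n≤1+n _ , n≤1+n _
  R-lay (kv _) (pv a) (inj₁ eq) = s≤s (≤-reflexive (sym a≡)) , ≤-trans (≤-reflexive a≡) (≤-trans (n≤1+n _) (n≤1+n _))
    where
    a≡ : shift J (toℕ a) ≡ J
    a≡ = trans (cong (shift J) eq) (shift-low ≤-refl)
  R-lay (kv _) (pv a) (inj₂ eq) = ≤-trans (≤-trans (n≤1+n _) (n≤1+n _)) (≤-reflexive (cong suc (sym a≡))) , ≤-reflexive a≡
    where
    a≡ : shift J (toℕ a) ≡ suc (suc J)
    a≡ = trans (cong (shift J) eq) shift-suc-j
  R-lay (pv _) (kv _) ()
  R-lay (pv _) (ctr _) ()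
  R-lay (pv _) (iso _) ()
  R-lay (kv _) (ctr _) ()
  R-lay (kv _) (lf _ _) ()
  R-lay (kv _) (iso _) ()
  R-lay (ctr _) _ ()
  R-lay (lf _ _) _ ()
  R-lay (iso _) _ ()

  R-irrefl : ∀ x → ¬ Rⱼ x x
  R-irrefl (pv a) (eq , _) = <-irrefl (sym eq) ≤-refl
  R-irrefl (kv _) ne = ne refl
  R-irrefl (ctr _) ()
  R-irrefl (lf _ _) ()
  R-irrefl (iso _) ()

  TEdge-sym : ∀ (x y : V) → TEdge x y → TEdge y x
  TEdge-sym (ctr _) (lf _ _) eq = sym eq
  TEdge-sym (lf _ _) (ctr _) eq = sym eq

  nearV : ∀ x y → x ≢ y → layV y ≤ N → layV x ≤ layV y → layV y ≤ suc (layV x) → Eⱼ x y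
  nearV (pv a) (pv b) x≢y _ x≤y y≤ with <-cmp (toℕ a) (toℕ b)
  ... | tri≈ _ eq _ = ⊥-elim (x≢y (cong pv (toℕ-injective eq)))
  ... | tri> _ _ gt = ⊥-elim (<⇒≱ (shift-mono-< {J} gt) x≤y)
  ... | tri< lt _ _ with m≤n⇒m<n∨m≡n lt
  ... | inj₁ lt′ = ⊥-elim (<⇒≱ (≤-<-trans (shift-mono-< {J} {toℕ a} ≤-refl) (shift-mono-< {J} lt′)) y≤)
  -- The deleted path edge does not get in the way: its ends are in layers J and J + 2, hence too
  -- far apart.
  ... | inj₂ eq = inj₂ (inj₁ (eq , λ a≡J → <⇒≱ (≤-reflexive (jump a≡J)) y≤))
    where
    jump : toℕ a ≡ J → suc (suc (shift J (toℕ a))) ≡ shift J (toℕ b)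
    jump a≡J = trans (cong (λ t → suc (suc t)) (trans (cong (shift J) a≡J) (shift-low ≤-refl)))
      (trans (sym shift-suc-j) (cong (shift J) (trans (cong suc (sym a≡J)) eq)))
  nearV (pv a) (kv _) _ _ x≤y y≤ with <-cmp (toℕ a) J
  ... | tri≈ _ eq _ = inj₂ (inj₂ (inj₁ eq))
  ... | tri< lt _ _ = ⊥-elim (<⇒≱ lt (≤-trans (s≤s⁻¹ y≤) (≤-reflexive (shift-low (<⇒≤ lt)))))
  ... | tri> _ _ gt = ⊥-elim (<⇒≱ (s≤s gt) (≤-trans (≤-reflexive (sym (shift-high gt))) x≤y))
  nearV (kv _) (pv a) _ _ x≤y y≤ with <-cmp (toℕ a) (suc J)
  ... | tri≈ _ eq _ = inj₂ (inj₁ (inj₂ eq))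
  ... | tri< lt _ _ = ⊥-elim (<⇒≱ (s≤s (s≤s⁻¹ lt)) (≤-trans x≤y (≤-reflexive (shift-low (s≤s⁻¹ lt)))))
  ... | tri> _ _ gt = ⊥-elim (<⇒≱ (s≤s gt) (≤-trans (≤-reflexive (sym (shift-high (<-trans ≤-refl gt)))) y≤))
  nearV (kv _) (kv _) x≢y _ _ _ = inj₂ (inj₁ (λ eq → x≢y (cong kv eq)))
  nearV (ctr _) (pv _) _ y≤N x≤y _ = ⊥-elim (<⇒≱ x≤y y≤N)
  nearV (lf _ _) (pv _) _ y≤N x≤y _ = ⊥-elim (<⇒≱ x≤y y≤N)
  nearV (iso _) (pv _) _ y≤N x≤y _ = ⊥-elim (<⇒≱ x≤y y≤N)
  nearV (ctr _) (kv _) _ y≤N x≤y _ = ⊥-elim (<⇒≱ x≤y y≤N)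
  nearV (lf _ _) (kv _) _ y≤N x≤y _ = ⊥-elim (<⇒≱ x≤y y≤N)
  nearV (iso _) (kv _) _ y≤N x≤y _ = ⊥-elim (<⇒≱ x≤y y≤N)
  nearV _ (ctr _) _ y≤N _ _ = ⊥-elim (<-irrefl refl y≤N)
  nearV _ (lf _ _) _ y≤N _ _ = ⊥-elim (<-irrefl refl y≤N)
  nearV _ (iso _) _ y≤N _ _ = ⊥-elim (<-irrefl refl y≤N)

  head-leafV : ∀ x y → layV x ≡ N → layV y ≡ suc N → leafV y ≡ true → Eⱼ x y
  head-leafV (pv a) (lf _ _) eq _ _ = inj₂ (inj₁ (shift-injective {J} (trans eq (sym shift-K))))
  head-leafV (kv _) (lf _ _) eq _ _ = ⊥-elim (<⇒≢ (toℕ<n j) (cong (_∸ 1) eq))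
  head-leafV (ctr _) (lf _ _) eq _ _ = ⊥-elim (<-irrefl (sym eq) ≤-refl)
  head-leafV (lf _ _) (lf _ _) eq _ _ = ⊥-elim (<-irrefl (sym eq) ≤-refl)
  head-leafV (iso _) (lf _ _) eq _ _ = ⊥-elim (<-irrefl (sym eq) ≤-refl)

  head-leafV⁻ : ∀ x y → layV x ≡ N → layV y ≡ suc N → Eⱼ x y → leafV y ≡ true
  head-leafV⁻ x y lx ly (inj₁ (tx , _)) = ⊥-elim (<-irrefl (trans (sym lx) (inT-lay x tx)) ≤-refl)
  head-leafV⁻ x (lf _ _) lx ly (inj₂ _) = refl
  head-leafV⁻ x (pv a) lx ly (inj₂ _) = ⊥-elim (<-irrefl ly (s≤s (pv-lay≤ a)))
  head-leafV⁻ x (kv _) lx ly (inj₂ _) = ⊥-elim (<-irrefl ly (s≤s (m≤n⇒m≤1+n (toℕ<n j))))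
  head-leafV⁻ (pv _) (ctr _) lx ly (inj₂ (inj₁ ()))
  head-leafV⁻ (kv _) (ctr _) lx ly (inj₂ (inj₁ ()))
  head-leafV⁻ (pv _) (iso _) lx ly (inj₂ (inj₁ ()))
  head-leafV⁻ (kv _) (iso _) lx ly (inj₂ (inj₁ ()))

  tailV : ∀ x y → inT x → inT y → x ≢ y → (leafV x ≡ true → leafV y ≡ false → centreV x ≢ y) →
          (leafV y ≡ true → leafV x ≡ false → centreV y ≢ x) → Eⱼ x y
  tailV x y tx ty x≢y nx ny = inj₁ (tx , ty , x≢y , no-star x y nx ny)
    where
    no-star : ∀ x y → (leafV x ≡ true → leafV y ≡ false → centreV x ≢ y) →
              (leafV y ≡ true → leafV x ≡ false → centreV y ≢ x) → ¬ TEdge x y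
    no-star (ctr i) (lf .i _) _ ny refl = ny refl refl refl
    no-star (lf i _) (ctr .i) nx _ refl = nx refl refl refl

  tailV⁻ : ∀ x → leafV x ≡ true → ¬ Eⱼ x (centreV x)
  tailV⁻ (lf i t) _ (inj₁ (_ , _ , _ , ¬star)) = ¬star refl
  tailV⁻ (lf i t) _ (inj₂ (inj₁ ()))
  tailV⁻ (lf i t) _ (inj₂ (inj₂ ()))

  G1-relation : LayeredRelation Eⱼ N
  G1-relation = record
    { lay = layV ; leaf = leafV ; centre = centreV
    ; E-sym = λ { {u} {v} (inj₁ (tu , tv , ne , ¬star)) → inj₁ (tv , tu , (ne ∘ sym) , λ st → ¬star (TEdge-sym v u st))
                ; (inj₂ (inj₁ r)) → inj₂ (inj₂ r) ; (inj₂ (inj₂ r)) → inj₂ (inj₁ r) }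
    ; E-irrefl = λ { (inj₁ (_ , _ , ne , _)) → ne refl
                   ; {u} (inj₂ (inj₁ r)) → R-irrefl u r ; {u} (inj₂ (inj₂ r)) → R-irrefl u r }
    ; lay≤ = layV≤
    ; far = λ { {u} {v} (inj₁ (tu , tv , _)) → ≤-trans (layV≤ u) (m≤n⇒m≤1+n (≤-reflexive (sym (inT-lay v tv))))
              ; {u} {v} (inj₂ (inj₁ r)) → proj₁ (R-lay u v r) ; {u} {v} (inj₂ (inj₂ r)) → proj₂ (R-lay v u r) }
    ; near = λ {u} {v} → nearV u v
    ; head-leaf = λ {u} {v} → head-leafV u v
    ; head-leaf⁻ = λ {u} {v} → head-leafV⁻ u v
    ; tail = λ {u} {v} lu lv → tailV u v (lay-inT u lu) (lay-inT v lv)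
    ; tail⁻ = λ {u} _ → tailV⁻ u }

  leaf-centreV : ∀ x → leafV x ≡ true → layV (centreV x) ≡ suc N × leafV (centreV x) ≡ false
  leaf-centreV (lf _ _) _ = refl , refl

  uniqueV : ∀ x y → layV x ≡ layV y → layV y ≤ N → layV y ≢ suc J → x ≡ y
  uniqueV (pv a) (pv b) eq _ _ = cong pv (toℕ-injective (shift-injective {J} eq))
  uniqueV _ (kv _) _ _ ne = ⊥-elim (ne refl)
  uniqueV (kv _) (pv _) eq _ ne = ⊥-elim (ne (sym eq))
  uniqueV (ctr _) (pv b) eq le _ = ⊥-elim (<⇒≱ (≤-reflexive eq) le)
  uniqueV (lf _ _) (pv b) eq le _ = ⊥-elim (<⇒≱ (≤-reflexive eq) le)
  uniqueV (iso _) (pv b) eq le _ = ⊥-elim (<⇒≱ (≤-reflexive eq) le)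
  uniqueV _ (ctr _) _ le _ = ⊥-elim (<-irrefl refl le)
  uniqueV _ (lf _ _) _ le _ = ⊥-elim (<-irrefl refl le)
  uniqueV _ (iso _) _ le _ = ⊥-elim (<-irrefl refl le)

  repV : Fin nl → ∀ i → i ≤ N → ∃ λ x → layV x ≡ i
  repV x₀ i i≤N with <-cmp i (suc J)
  ... | tri≈ _ eq _ = kv x₀ , sym eq
  ... | tri< lt _ _ = pv (fromℕ< (≤-trans lt (s≤s J≤K))) ,
          trans (cong (shift J) (toℕ-fromℕ< (≤-trans lt (s≤s J≤K)))) (shift-low (s≤s⁻¹ lt))
  repV x₀ (suc i) i≤N | tri> _ _ gt = pv (fromℕ< i≤N) ,
          trans (cong (shift J) (toℕ-fromℕ< i≤N)) (shift-high (s≤s⁻¹ gt))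

inG1⇒layered : ∀ {κ n} (j : Fin (suc κ)) (G : Graph n) → InG1 (4 + κ) j G →
               Σ (Layered G (suc (suc κ)) (suc (toℕ j))) TwoStars
inG1⇒layered {κ} {n} j G (suc (suc nl) , s≤s (s≤s _) , suc (suc s) , s≤s (s≤s _) , m , 1≤m , r , φ , iff) =
  S , from leaf₁′ , from leaf₂′ , at leaf₁′ refl refl , at leaf₂′ refl refl , centres≢
  where
  V : Set
  V = G1V (4 + κ) (suc (suc nl)) (suc (suc s)) m r
  to : Fin n → V
  to = Inverse.to φ
  from : V → Fin n
  from = Inverse.from φ
  to-from : ∀ x → to (from x) ≡ x
  to-from x = Inverse.inverseˡ φ refl
  from-to : ∀ u → from (to u) ≡ u
  from-to u = Inverse.inverseʳ φ refl
  to-inj : ∀ {u v} → to u ≡ to v → u ≡ v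
  to-inj {u} {v} eq = trans (sym (from-to u)) (trans (cong from eq) (from-to v))
  open LayeredRelation (G1-relation {κ} {suc (suc nl)} {suc (suc s)} {r} {m} j)
  centre′ : Fin n → Fin n
  centre′ u = from (centre (to u))
  centre-to : ∀ {u v} → centre′ u ≢ v → centre (to u) ≢ to v
  centre-to ne eq = ne (trans (cong from eq) (from-to _))
  lift : ∀ {i} → (∃ λ x → lay x ≡ i) → ∃ λ v → lay (to v) ≡ i
  lift (x , lx) = from x , trans (cong lay (to-from x)) lx
  leaf₁′ leaf₂′ : V
  leaf₁′ = lf zero (fromℕ< (1≤m zero))
  leaf₂′ = lf (suc zero) (fromℕ< (1≤m (suc zero)))
  at : ∀ x → lay x ≡ suc (suc (suc κ)) → leaf x ≡ true → lay (to (from x)) ≡ suc (suc (suc κ)) × leaf (to (from x)) ≡ true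
  at x lx fx = trans (cong lay (to-from x)) lx , trans (cong leaf (to-from x)) fx
  S : Layered G (suc (suc κ)) (suc (toℕ j))
  S = record
    { lay = λ u → lay (to u) ; leaf = λ u → leaf (to u) ; centre = centre′
    ; lay≤ = λ u → lay≤ (to u)
    ; far = λ {u} {v} e → far (proj₁ (iff u v) e)
    ; near = λ {u} {v} u≢v p q t → proj₂ (iff u v) (near (u≢v ∘ to-inj) p q t)
    ; head-leaf = λ {u} {v} p q t → proj₂ (iff u v) (head-leaf p q t)
    ; head-leaf⁻ = λ {u} {v} p q e → head-leaf⁻ p q (proj₁ (iff u v) e)
    ; tail = λ {u} {v} p q u≢v nu nv → proj₂ (iff u v) (tail p q (u≢v ∘ to-inj)
        (λ a b → centre-to (nu a b)) (λ a b → centre-to (nv a b)))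
    ; leaf-centre = λ {u} lu fu → trans (cong lay (to-from _)) (proj₁ (leaf-centreV j (to u) fu)) ,
        trans (cong leaf (to-from _)) (proj₂ (leaf-centreV j (to u) fu)) ,
        Bool.¬-not (λ e → tail⁻ lu fu (subst (G1Adj j (to u)) (to-from _) (proj₁ (iff u _) e)))
    ; unique = λ {u} {v} p q t → to-inj (uniqueV j (to u) (to v) p q t)
    ; rep = λ i i≤N → lift (repV j zero i i≤N)
    ; clique₂ = from (kv zero) , from (kv (suc zero)) , cong lay (to-from _) , cong lay (to-from _) ,
        λ eq → kv≢ (trans (sym (to-from _)) (trans (cong to eq) (to-from _)))
    ; leaf₁ = from leaf₁′ , at leaf₁′ refl refl }
    where
    kv≢ : kv zero ≢ kv (suc zero)
    kv≢ ()
  centres≢ : centre′ (from leaf₁′) ≢ centre′ (from leaf₂′)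
  centres≢ eq = ctr≢ (trans (sym (centre-at leaf₁′)) (trans (cong to eq) (centre-at leaf₂′)))
    where
    centre-at : ∀ x → to (centre′ (from x)) ≡ centre x
    centre-at x = trans (to-from _) (cong centre (to-from x))
    ctr≢ : ctr zero ≢ ctr (suc zero)
    ctr≢ ()

-- Reading the parameters of 𝒢₁ off a layering

module LayeredG1 {κ n : ℕ} (j : Fin (suc κ)) {G : Graph n}
  (S : Layered G (suc (suc κ)) (suc (toℕ j))) (stars : TwoStars S) where

  open Layered S

  private
    K N J : ℕ
    K = suc κ
    N = suc K
    J = toℕ j

  Leaf : Fin n → Set
  Leaf v = lay v ≡ suc N × leaf v ≡ true

  leaf? : ∀ v → Dec (Leaf v)
  leaf? v = (lay v ≟ℕ suc N) ×-dec (leaf v Bool.≟ true)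

  -- The star forest is read off the map `centre`: its values on leaves are the star centres, its
  -- fibres are the leaves of each star, and the tail vertices that are neither leaves nor values
  -- are the isolated vertices of T.
  IsCentre : Fin n → Set
  IsCentre v = ∃ λ u → Leaf u × centre u ≡ v

  isCentre? : ∀ v → Dec (IsCentre v)
  isCentre? v = any? (λ u → leaf? u ×-dec (centre u ≟ v))

  isolated? : ∀ v → Dec ((lay v ≡ suc N × leaf v ≡ false) × ¬ IsCentre v)
  isolated? v = ((lay v ≟ℕ suc N) ×-dec (leaf v Bool.≟ false)) ×-dec ¬? (isCentre? v)

  clique? : ∀ v → Dec (lay v ≡ suc J)
  clique? v = lay v ≟ℕ suc J

  cliqueSet centreSet isolatedSet : Subset n
  cliqueSet = subset clique?
  centreSet = subset isCentre?
  isolatedSet = subset isolated?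

  leaves? : ∀ c v → Dec (Leaf v × centre v ≡ c)
  leaves? c v = leaf? v ×-dec (centre v ≟ c)

  leavesOf : Fin n → Subset n
  leavesOf c = subset (leaves? c)

  nl ns nr : ℕ
  nl = ∣ cliqueSet ∣
  ns = ∣ centreSet ∣
  nr = ∣ isolatedSet ∣

  m : Fin ns → ℕ
  m i = ∣ leavesOf (elem centreSet i) ∣

  V : Set
  V = G1V (4 + κ) nl ns m nr

  relation : LayeredRelation (G1Adj {4 + κ} {nl} {ns} {m} {nr} j) N
  relation = G1-relation j

  module V = LayeredRelation relation

  path : ∀ (a : Fin (suc K)) → ∃ λ v → lay v ≡ shift J (toℕ a)
  path a = rep (shift J (toℕ a)) (pv-lay≤ {κ} {nl} {ns} {nr} {m} j a)

  f : V → Fin n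
  f (pv a)   = proj₁ (path a)
  f (kv x)   = elem cliqueSet x
  f (ctr i)  = elem centreSet i
  f (lf i t) = elem (leavesOf (elem centreSet i)) t
  f (iso x)  = elem isolatedSet x

  centre-props : ∀ {v} → IsCentre v → lay v ≡ suc N × leaf v ≡ false
  centre-props (u , (lu , fu) , refl) = proj₁ (leaf-centre lu fu) , proj₁ (proj₂ (leaf-centre lu fu))

  at-ctr : ∀ i → IsCentre (elem centreSet i)
  at-ctr i = ∈-subset⁻ isCentre? (elem∈ centreSet i)

  at-lf : ∀ i t → Leaf (f (lf i t)) × centre (f (lf i t)) ≡ f (ctr i)
  at-lf i t = ∈-subset⁻ (leaves? (elem centreSet i)) (elem∈ (leavesOf (elem centreSet i)) t)

  at-iso : ∀ x → (lay (f (iso x)) ≡ suc N × leaf (f (iso x)) ≡ false) × ¬ IsCentre (f (iso x))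
  at-iso x = ∈-subset⁻ isolated? (elem∈ isolatedSet x)

  at-kv : ∀ x → lay (f (kv x)) ≡ suc J
  at-kv x = ∈-subset⁻ clique? (elem∈ cliqueSet x)

  f-lay : ∀ x → lay (f x) ≡ V.lay x
  f-lay (pv a)   = proj₂ (path a)
  f-lay (kv x)   = at-kv x
  f-lay (ctr i)  = proj₁ (centre-props (at-ctr i))
  f-lay (lf i t) = proj₁ (proj₁ (at-lf i t))
  f-lay (iso x)  = proj₁ (proj₁ (at-iso x))

  f-leaf : ∀ x → V.lay x ≡ suc N → leaf (f x) ≡ V.leaf x
  f-leaf (pv a) eq = ⊥-elim (lay-inT j (pv {nl = nl} {s = ns} {m = m} {r = nr} a) eq)
  f-leaf (kv x) eq = ⊥-elim (lay-inT j (kv {s = ns} {m = m} {r = nr} x) eq)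
  f-leaf (ctr i) _ = proj₂ (centre-props (at-ctr i))
  f-leaf (lf i t) _ = proj₂ (proj₁ (at-lf i t))
  f-leaf (iso x) _ = proj₂ (proj₁ (at-iso x))

  f-centre : ∀ x → V.lay x ≡ suc N → V.leaf x ≡ true → centre (f x) ≡ f (V.centre x)
  f-centre (lf i t) _ _ = proj₂ (at-lf i t)

  same-kind : ∀ {x y} → f x ≡ f y → V.lay x ≡ suc N → V.lay y ≡ suc N → V.leaf x ≡ V.leaf y
  same-kind {x} {y} eq lx ly = trans (sym (f-leaf x lx)) (trans (cong leaf eq) (f-leaf y ly))

  f-injective : Injective _≡_ _≡_ f
  f-injective {x} {y} eq = lem x y eq (trans (sym (f-lay x)) (trans (cong lay eq) (f-lay y)))
    where
    lf-lf : ∀ i t i′ t′ → i ≡ i′ → f (lf i t) ≡ f (lf i′ t′) → lf i t ≡ lf i′ t′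
    lf-lf i t .i t′ refl eq = cong (lf i) (elem-injective (leavesOf (elem centreSet i)) eq)
    lem : ∀ x y → f x ≡ f y → V.lay x ≡ V.lay y → x ≡ y
    lem (pv a) (pv b) _ l = cong pv (toℕ-injective (shift-injective {J} l))
    lem (kv x) (kv y) eq _ = cong kv (elem-injective cliqueSet eq)
    lem (ctr i) (ctr i′) eq _ = cong ctr (elem-injective centreSet eq)
    lem (iso x) (iso y) eq _ = cong iso (elem-injective isolatedSet eq)
    lem (lf i t) (lf i′ t′) eq _ = lf-lf i t i′ t′ (elem-injective centreSet
      (trans (sym (proj₂ (at-lf i t))) (trans (cong centre eq) (proj₂ (at-lf i′ t′))))) eq
    lem x@(pv a) y@(kv _) _ l = ⊥-elim (shift≢suc {J} {toℕ a} l)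
    lem x@(kv _) y@(pv a) _ l = ⊥-elim (shift≢suc {J} {toℕ a} (sym l))
    lem x@(pv _) (ctr _) _ l = ⊥-elim (lay-inT j x l)
    lem x@(pv _) (lf _ _) _ l = ⊥-elim (lay-inT j x l)
    lem x@(pv _) (iso _) _ l = ⊥-elim (lay-inT j x l)
    lem x@(kv _) (ctr _) _ l = ⊥-elim (lay-inT j x l)
    lem x@(kv _) (lf _ _) _ l = ⊥-elim (lay-inT j x l)
    lem x@(kv _) (iso _) _ l = ⊥-elim (lay-inT j x l)
    lem (ctr _) y@(pv _) _ l = ⊥-elim (lay-inT j y (sym l))
    lem (lf _ _) y@(pv _) _ l = ⊥-elim (lay-inT j y (sym l))
    lem (iso _) y@(pv _) _ l = ⊥-elim (lay-inT j y (sym l))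
    lem (ctr _) y@(kv _) _ l = ⊥-elim (lay-inT j y (sym l))
    lem (lf _ _) y@(kv _) _ l = ⊥-elim (lay-inT j y (sym l))
    lem (iso _) y@(kv _) _ l = ⊥-elim (lay-inT j y (sym l))
    lem x@(ctr _) y@(lf _ _) eq _ with same-kind {x} {y} eq refl refl
    ... | ()
    lem x@(lf _ _) y@(ctr _) eq _ with same-kind {x} {y} eq refl refl
    ... | ()
    lem x@(lf _ _) y@(iso _) eq _ with same-kind {x} {y} eq refl refl
    ... | ()
    lem x@(iso _) y@(lf _ _) eq _ with same-kind {x} {y} eq refl refl
    ... | ()
    lem (ctr i) (iso x) eq _ = ⊥-elim (proj₂ (at-iso x) (subst IsCentre eq (at-ctr i)))
    lem (iso x) (ctr i) eq _ = ⊥-elim (proj₂ (at-iso x) (subst IsCentre (sym eq) (at-ctr i)))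

  f-surjective : ∀ v → ∃ λ x → f x ≡ v
  f-surjective v with m≤n⇒m<n∨m≡n (lay≤ v)
  ... | inj₁ lt with lay v ≟ℕ suc J
  ... | yes eq = kv (index v∈) , elem-index v∈
    where
    v∈ : v ∈ cliqueSet
    v∈ = ∈-subset⁺ clique? eq
  ... | no ne = on-path (repV-path)
    where
    repV-path : ∃ λ (a : Fin (suc K)) → shift J (toℕ a) ≡ lay v
    repV-path with <-cmp (lay v) (suc J)
    ... | tri≈ _ eq _ = ⊥-elim (ne eq)
    ... | tri< lt′ _ _ = fromℕ< lt″ , trans (cong (shift J) (toℕ-fromℕ< lt″)) (shift-low (s≤s⁻¹ lt′))
      where
      lt″ : lay v < suc K
      lt″ = ≤-trans lt′ (s≤s (<⇒≤ (toℕ<n j)))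
    ... | tri> _ _ gt = above (lay v) refl gt (s≤s⁻¹ lt)
      where
      above : ∀ l → l ≡ lay v → suc J < l → l ≤ N → ∃ λ (a : Fin (suc K)) → shift J (toℕ a) ≡ lay v
      above (suc l) eq gt l≤N = fromℕ< l≤N , trans (cong (shift J) (toℕ-fromℕ< l≤N)) (trans (shift-high (s≤s⁻¹ gt)) eq)
    on-path : (∃ λ (a : Fin (suc K)) → shift J (toℕ a) ≡ lay v) → ∃ λ x → f x ≡ v
    on-path (a , eq) = pv a , unique (trans (proj₂ (path a)) eq) (s≤s⁻¹ lt) ne
  f-surjective v | inj₂ lv with leaf v in fv
  ... | true = lf (index c∈) (index v∈) , elem-index v∈
    where
    c∈ : centre v ∈ centreSet
    c∈ = ∈-subset⁺ isCentre? (v , (lv , fv) , refl)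
    v∈ : v ∈ leavesOf (elem centreSet (index c∈))
    v∈ = ∈-subset⁺ (leaves? _) ((lv , fv) , sym (elem-index c∈))
  ... | false with isCentre? v
  ... | yes ic = ctr (index v∈) , elem-index v∈
    where
    v∈ : v ∈ centreSet
    v∈ = ∈-subset⁺ isCentre? ic
  ... | no ¬ic = iso (index v∈) , elem-index v∈
    where
    v∈ : v ∈ isolatedSet
    v∈ = ∈-subset⁺ isolated? ((lv , fv) , ¬ic)

  g : Fin n → V
  g v = proj₁ (f-surjective v)

  f-g : ∀ v → f (g v) ≡ v
  f-g v = proj₂ (f-surjective v)

  g-f : ∀ x → g (f x) ≡ x
  g-f x = f-injective (f-g (f x))

  g-injective : Injective _≡_ _≡_ g
  g-injective {u} {v} eq = trans (sym (f-g u)) (trans (cong f eq) (f-g v))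

  g-lay : ∀ v → V.lay (g v) ≡ lay v
  g-lay v = trans (sym (f-lay (g v))) (cong lay (f-g v))

  g-leaf : ∀ v → lay v ≡ suc N → V.leaf (g v) ≡ leaf v
  g-leaf v lv = trans (sym (f-leaf (g v) (trans (g-lay v) lv))) (cong leaf (f-g v))

  g-centre : ∀ v → lay v ≡ suc N → leaf v ≡ true → V.centre (g v) ≡ g (centre v)
  g-centre v lv fv = f-injective (trans (sym (f-centre (g v) (trans (g-lay v) lv) (trans (g-leaf v lv) fv)))
    (trans (cong centre (f-g v)) (sym (f-g (centre v)))))

  -- A bijection that respects layers, leaves and centres is an isomorphism: `transfer` along `g`
  -- gives one implication, and along `f` the converse.
  inG1 : InG1 (4 + κ) j G
  inG1 = nl , two-clique , ns , two-centres stars , m , some-leaf , nr ,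
    mk↔ₛ′ g f g-f f-g ,
    λ u v → transfer (layered⇒relation S) relation g g-injective g-lay g-leaf g-centre ,
            λ e → subst₂ (λ x y → adj G x y ≡ true) (f-g u) (f-g v)
                    (transfer relation (layered⇒relation S) f f-injective f-lay f-leaf f-centre e)
    where
    pair : ∀ {A B : Fin n} (p : Subset n) → A ∈ p → B ∈ p → A ≢ B → 2 ≤ ∣ p ∣
    pair p a∈ b∈ a≢b = ≰⇒> λ le → a≢b (∣p∣≤1⇒≡ p le a∈ b∈)
    two-clique : 2 ≤ nl
    two-clique = let (v , w , lv , lw , v≢w) = clique₂ in
      pair cliqueSet (∈-subset⁺ clique? lv) (∈-subset⁺ clique? lw) v≢w
    two-centres : TwoStars S → 2 ≤ ns
    two-centres (y₁ , y₂ , l₁ , l₂ , ne) =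
      pair centreSet (∈-subset⁺ isCentre? (y₁ , l₁ , refl)) (∈-subset⁺ isCentre? (y₂ , l₂ , refl)) ne
    some-leaf : ∀ i → 1 ≤ m i
    some-leaf i with at-ctr i
    ... | u , lu , cu = ≤-trans (s≤s z≤n) (nonempty (∈-subset⁺ (leaves? (elem centreSet i)) (lu , cu)))
      where
      nonempty : u ∈ leavesOf (elem centreSet i) → 1 ≤ m i
      nonempty u∈ = ≰⇒> λ le → ∣p∣≡0⇒∉ _ le u∈

theorem10 : (k : ℕ) → 4 ≤ k → (b : Fin (k ∸ 3) → ℕ) (j : Fin (k ∸ 3)) →
    b j ≡ 1 → (∀ i → i ≢ j → b i ≡ 0) →
    (n : ℕ) (G : Graph n) →
    (InH k (extB k b) G → InG1 k j G) × (InG1 k j G → InH k (extB k b) G)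
theorem10 (suc (suc (suc (suc κ)))) (s≤s (s≤s (s≤s (s≤s _)))) b j bj b0 n G = forward , backward
  where
  forward : InH (4 + κ) (extB (4 + κ) b) G → InG1 (4 + κ) j G
  forward inH = let (S , stars) = inH⇒layered b j bj b0 G inH in LayeredG1.inG1 j S stars
  backward : InG1 (4 + κ) j G → InH (4 + κ) (extB (4 + κ) b) G
  backward inG1 = let (S , stars) = inG1⇒layered j G inG1 in layered⇒inH b j bj b0 G S stars
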